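{- Let $C\subseteq\mathbb{R}^d$ be the attractor of an affine, rational-preserving iterated function system $F=(f_1,\ldots,f_J)$. Then any vector in $C$ that admits an ultimately periodic address is in $\mathbb{Q}^d$. If moreover the iterated function system is unimodular, then the rational vectors in $C$ (elements of $C\cap\mathbb{Q}^d$) are precisely those vectors in $C$ that have an ultimately periodic address. Moreover, in this case, for every $\underline{p}/q\in\mathbb{Q}^d\cap C$ an ultimately periodic address can be chosen whose period length (including the preperiod) is $\ll_C\min\{q^D,q^d\}$, where $D=-\log J/\log\tau$, $\tau=\max_{1\leq j\leq J}\tau_j$, and the implied constant depends only on $C$ (the iterated function system).
   Context: $\mathbb{R}^d$ carries the supremum norm $\Vert\cdot\Vert$. An iterated function system (IFS) is a finite set of contractions $f_j:\mathbb{R}^d\to\mathbb{R}^d$, i.e. maps with $\Vert f_j(\underline{x})-f_j(\underline{y})\Vert\leq\tau_j\Vert\underline{x}-\underline{y}\Vert$ for some contraction rate $\tau_j\in(0,1)$; its attractor is the unique nonempty compact set $C$ with $\bigcup_{j}f_j(C)=C$. The IFS is affine if $f_j(\underline{y})=A_j\underline{y}+\underline{b}_j$ with $A_j\in\mathbb{R}^{d\times d}$, $\underline{b}_j\in\mathbb{R}^d$, and rational-preserving if $f_j(\mathbb{Q}^d)\subseteq\mathbb{Q}^d$ for all $j$. An affine, rational-preserving IFS is unimodular if $f_j(\underline{y})=A_j\underline{y}/q_j+\underline{b}_j/s_j$ with $A_j\in\mathbb{Z}^{d\times d}$, $\det(A_j)\in\{1,-1\}$, $\underline{b}_j\in\mathbb{Z}^d$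 and $q_j,s_j\in\mathbb{N}$. An address of $\underline{\xi}\in C$ is a sequence $(\omega_1,\omega_2,\ldots)\in\{1,\ldots,J\}^{\mathbb{N}}$ with $\underline{\xi}=\lim_{i\to\infty}f_{\omega_1}\circ\cdots\circ f_{\omega_i}(\underline{0})$; it is ultimately periodic if it consists of a finite (possibly empty) preperiod followed by a finite word repeated forever, and the period length including preperiod is the sum of the lengths of the preperiod and of the period word. Rational vectors are written $\underline{p}/q$ with $\underline{p}\in\mathbb{Z}^d$, $q\in\mathbb{N}$. -}

module Defs where

open import Data.Nat.Base as ℕ using (ℕ; zero; suc)
import Data.Nat.Properties as ℕ
open import Data.Integer.Base as ℤ using (ℤ; +_; 0ℤ; 1ℤ; -1ℤ)
import Data.Integer.Properties as ℤ
open import Data.Rational.Base as ℚ using (ℚ; 0ℚ; 1ℚ; ½)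
import Data.Rational.Properties as ℚ
import Data.Rational.Unnormalised.Base as ℚᵘ
import Data.Rational.Unnormalised.Properties as ℚᵘ
open import Data.Fin.Base using (Fin; zero; suc; punchIn)
open import Data.List.Base using (List)
open import Data.List.Relation.Unary.Any using (Any)
open import Data.Product.Base using (Σ; ∃; ∃₂; _×_; _,_; proj₁; proj₂)
open import Data.Sum.Base using (_⊎_; inj₁; inj₂; [_,_]′)
open import Data.Vec.Functional using (Vector; foldr)
open import Function.Base using (_∘_)
open import Function.Bundles using (_⇔_)
open import Level using (0ℓ)
open import Relation.Binary.PropositionalEquality
  using (_≡_; refl; sym; trans; cong; cong₂; subst; subst₂)
open import Relation.Nullary.Decidable.Core using (dec⇒maybe)
open import Relation.Unary using (Pred; _∈_)
open import Tactic.RingSolver using (solve-∀)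
open import Tactic.RingSolver.Core.AlmostCommutativeRing using (AlmostCommutativeRing; fromCommutativeRing)

IsCauchy : (ℕ → ℚ) → Set
IsCauchy s = ∀ ε → 0ℚ ℚ.< ε →
  ∃ λ N → ∀ m n → N ℕ.≤ m → N ℕ.≤ n → ℚ.∣ s m ℚ.- s n ∣ ℚ.≤ ε

-- x^k / k!
expTerm : ℚ → ℕ → ℚ
expTerm x zero    = 1ℚ
expTerm x (suc k) = expTerm x k ℚ.* (x ℚ.* (+ 1 ℚ./ suc k))

-- ∑_{k ≤ n} x^k / k!
expSum : ℚ → ℕ → ℚ
expSum x zero    = expTerm x zero
expSum x (suc n) = expSum x n ℚ.+ expTerm x (suc n)

module CauchyLemmas where
  private module ≤R = ℚ.≤-Reasoning

  Bounded : (ℕ → ℚ) → Set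
  Bounded s = ∃₂ λ N B → 0ℚ ℚ.< B × (∀ n → N ℕ.≤ n → ℚ.∣ s n ∣ ℚ.≤ B)

  ring : AlmostCommutativeRing 0ℓ 0ℓ
  ring = fromCommutativeRing ℚ.+-*-commutativeRing (λ p → dec⇒maybe (0ℚ ℚ.≟ p))

  neg-minus : ∀ p q → ℚ.- (p ℚ.- q) ≡ q ℚ.- p
  neg-minus = solve-∀ ring

  minus-neg : ∀ p q → q ℚ.- p ≡ (ℚ.- p) ℚ.- (ℚ.- q)
  minus-neg = solve-∀ ring

  add-minus : ∀ p q → q ℚ.+ (p ℚ.- q) ≡ p
  add-minus = solve-∀ ring

  minus-add : ∀ p q → p ℚ.- q ℚ.+ q ≡ p
  minus-add = solve-∀ ring

  cancel-minus : ∀ q r → q ℚ.+ r ℚ.- q ≡ r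
  cancel-minus = solve-∀ ring

  minus-+ : ∀ a b c d → (a ℚ.- b) ℚ.+ (c ℚ.- d) ≡ (a ℚ.+ c) ℚ.- (b ℚ.+ d)
  minus-+ = solve-∀ ring

  minus-* : ∀ a b c d → a ℚ.* b ℚ.- c ℚ.* d ≡ a ℚ.* (b ℚ.- d) ℚ.+ d ℚ.* (a ℚ.- c)
  minus-* = solve-∀ ring

  +-minus : ∀ e t r → e ℚ.+ t ℚ.- r ≡ (e ℚ.- r) ℚ.+ t
  +-minus = solve-∀ ring

  factor : ∀ u v x y d → u ℚ.* (x ℚ.* d) ℚ.- v ℚ.* (y ℚ.* d) ≡ d ℚ.* (u ℚ.* x ℚ.- v ℚ.* y)
  factor = solve-∀ ring

  regroup : ∀ b s d → b ℚ.* (s ℚ.* d) ≡ s ℚ.* b ℚ.* d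
  regroup = solve-∀ ring

  collect : ∀ d t e i → d ℚ.* (t ℚ.* e ℚ.+ (t ℚ.* i) ℚ.* e) ≡ t ℚ.* e ℚ.* ((1ℚ ℚ.+ i) ℚ.* d)
  collect = solve-∀ ring

  shuffle : ∀ s b c i → s ℚ.* (b ℚ.* c) ℚ.* i ≡ s ℚ.* b ℚ.* (i ℚ.* c)
  shuffle = solve-∀ ring

  twice : ∀ a t h → (a ℚ.+ a) ℚ.* (t ℚ.* h) ≡ a ℚ.* t ℚ.* (h ℚ.+ h)
  twice = solve-∀ ring

  split : ∀ x y z → x ℚ.- z ≡ (x ℚ.- y) ℚ.+ (y ℚ.- z)
  split = solve-∀ ring

  half+half : ∀ p → ½ ℚ.* p ℚ.+ ½ ℚ.* p ≡ p
  half+half p = trans (sym (ℚ.*-distribʳ-+ p ½ ½)) (ℚ.*-identityˡ p)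

  pos-½ : 0ℚ ℚ.< ½
  pos-½ = ℚ.positive⁻¹ ½

  0<1 : 0ℚ ℚ.< 1ℚ
  0<1 = ℚ.positive⁻¹ 1ℚ

  *-pos : ∀ {a b} → 0ℚ ℚ.< a → 0ℚ ℚ.< b → 0ℚ ℚ.< a ℚ.* b
  *-pos {a} {b} p q =
    ℚ.positive⁻¹ _ {{ℚ.pos*pos⇒pos a {{ℚ.positive p}} b {{ℚ.positive q}}}}

  *-nonNeg : ∀ {a b} → 0ℚ ℚ.≤ a → 0ℚ ℚ.≤ b → 0ℚ ℚ.≤ a ℚ.* b
  *-nonNeg {a} {b} p q =
    ℚ.nonNegative⁻¹ _ {{ℚ.nonNeg*nonNeg⇒nonNeg a {{ℚ.nonNegative p}} b {{ℚ.nonNegative q}}}}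

  *-monoˡ : ∀ {a b} c → 0ℚ ℚ.≤ c → a ℚ.≤ b → c ℚ.* a ℚ.≤ c ℚ.* b
  *-monoˡ c p = ℚ.*-monoˡ-≤-nonNeg c {{ℚ.nonNegative p}}

  *-monoʳ : ∀ {a b} c → 0ℚ ℚ.≤ c → a ℚ.≤ b → a ℚ.* c ℚ.≤ b ℚ.* c
  *-monoʳ c p = ℚ.*-monoʳ-≤-nonNeg c {{ℚ.nonNegative p}}

  *-mono : ∀ {a b c d} → 0ℚ ℚ.≤ b → 0ℚ ℚ.≤ c → a ℚ.≤ b → c ℚ.≤ d → a ℚ.* c ℚ.≤ b ℚ.* d
  *-mono p q r s = ℚ.≤-trans (*-monoʳ _ q r) (*-monoˡ _ p s)

  ∣∣-lub : ∀ {a c} → a ℚ.≤ c → ℚ.- a ℚ.≤ c → ℚ.∣ a ∣ ℚ.≤ c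
  ∣∣-lub {a} p q = [ (λ e → subst (ℚ._≤ _) (sym e) p) , (λ e → subst (ℚ._≤ _) (sym e) q) ]′
    (ℚ.∣p∣≡p∨∣p∣≡-p a)

  p≤∣p∣ : ∀ p → p ℚ.≤ ℚ.∣ p ∣
  p≤∣p∣ p = [ (λ 0≤p → ℚ.≤-reflexive (sym (ℚ.0≤p⇒∣p∣≡p 0≤p))) , (λ p≤0 → ℚ.≤-trans p≤0 (ℚ.0≤∣p∣ p)) ]′
    (ℚ.≤-total 0ℚ p)

  -p≤∣p∣ : ∀ p → ℚ.- p ℚ.≤ ℚ.∣ p ∣
  -p≤∣p∣ p = subst (ℚ.- p ℚ.≤_) (ℚ.∣-p∣≡∣p∣ p) (p≤∣p∣ (ℚ.- p))

  ∣∣-swap : ∀ p q → ℚ.∣ p ℚ.- q ∣ ≡ ℚ.∣ q ℚ.- p ∣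
  ∣∣-swap p q = trans (sym (ℚ.∣-p∣≡∣p∣ (p ℚ.- q)))
    (cong ℚ.∣_∣ (neg-minus p q))

  p≤q+∣p-q∣ : ∀ p q → p ℚ.≤ q ℚ.+ ℚ.∣ p ℚ.- q ∣
  p≤q+∣p-q∣ p q = begin
    p                          ≡⟨ sym (add-minus p q) ⟩
    q ℚ.+ (p ℚ.- q)            ≤⟨ ℚ.+-monoʳ-≤ q (p≤∣p∣ (p ℚ.- q)) ⟩
    q ℚ.+ ℚ.∣ p ℚ.- q ∣        ∎
    where open ≤R

  move : ∀ {p q r} → p ℚ.≤ q ℚ.+ r → p ℚ.- q ℚ.≤ r
  move {p} {q} {r} h = begin
    p ℚ.- q            ≤⟨ ℚ.+-monoˡ-≤ (ℚ.- q) h ⟩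
    q ℚ.+ r ℚ.- q      ≡⟨ cancel-minus q r ⟩
    r                  ∎
    where open ≤R

  ∣-∣-lub : ∀ {p q r} → p ℚ.≤ q ℚ.+ r → q ℚ.≤ p ℚ.+ r → ℚ.∣ p ℚ.- q ∣ ℚ.≤ r
  ∣-∣-lub {p} {q} h k = ∣∣-lub (move h)
    (subst (ℚ._≤ _) (sym (neg-minus p q)) (move k))

  m≤+ˡ : ∀ {p q} → 0ℚ ℚ.≤ q → p ℚ.≤ p ℚ.+ q
  m≤+ˡ {p} {q} h = subst (ℚ._≤ p ℚ.+ q) (ℚ.+-identityʳ p) (ℚ.+-monoʳ-≤ p h)

  m≤+ʳ : ∀ {p q} → 0ℚ ℚ.≤ p → q ℚ.≤ p ℚ.+ q
  m≤+ʳ {p} {q} h = subst (ℚ._≤ p ℚ.+ q) (ℚ.+-identityˡ q) (ℚ.+-monoˡ-≤ q h)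

  +-nonNeg : ∀ {a b} → 0ℚ ℚ.≤ a → 0ℚ ℚ.≤ b → 0ℚ ℚ.≤ a ℚ.+ b
  +-nonNeg p q = ℚ.≤-trans p (m≤+ˡ q)

  cauchy-scale : ∀ {s} A → 0ℚ ℚ.< A → IsCauchy s → ∀ ε → 0ℚ ℚ.< ε →
    ∃ λ N → ∀ m n → N ℕ.≤ m → N ℕ.≤ n → A ℚ.* ℚ.∣ s m ℚ.- s n ∣ ℚ.≤ ε
  cauchy-scale {s} A 0<A cs ε 0<ε = proj₁ M , λ m n p q → begin
      A ℚ.* ℚ.∣ s m ℚ.- s n ∣       ≤⟨ *-monoˡ A (ℚ.<⇒≤ 0<A) (proj₂ M m n p q) ⟩
      A ℚ.* (ℚ.1/ A ℚ.* ε)          ≡⟨ sym (ℚ.*-assoc A (ℚ.1/ A) ε) ⟩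
      A ℚ.* ℚ.1/ A ℚ.* ε            ≡⟨ cong (ℚ._* ε) (ℚ.*-inverseʳ A) ⟩
      1ℚ ℚ.* ε                      ≡⟨ ℚ.*-identityˡ ε ⟩
      ε                             ∎
    where
    open ≤R
    instance
      A-pos : ℚ.Positive A
      A-pos = ℚ.positive 0<A
      A-nz : ℚ.NonZero A
      A-nz = ℚ.pos⇒nonZero A
    M = cs (ℚ.1/ A ℚ.* ε) (*-pos {ℚ.1/ A} {ε} (ℚ.positive⁻¹ _ {{ℚ.1/pos⇒pos A}}) 0<ε)

  cauchy-by : ∀ {s r t} A B → 0ℚ ℚ.< A → 0ℚ ℚ.< B → IsCauchy s → IsCauchy r → ∀ N₀ →
    (∀ m n → N₀ ℕ.≤ m → N₀ ℕ.≤ n →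
      ℚ.∣ t m ℚ.- t n ∣ ℚ.≤ A ℚ.* ℚ.∣ s m ℚ.- s n ∣ ℚ.+ B ℚ.* ℚ.∣ r m ℚ.- r n ∣) →
    IsCauchy t
  cauchy-by {s} {r} {t} A B 0<A 0<B cs cr N₀ h ε 0<ε = N₀ ℕ.+ (N₁ ℕ.+ N₂) , λ m n p q → begin
      ℚ.∣ t m ℚ.- t n ∣
        ≤⟨ h m n (lt₀ p) (lt₀ q) ⟩
      A ℚ.* ℚ.∣ s m ℚ.- s n ∣ ℚ.+ B ℚ.* ℚ.∣ r m ℚ.- r n ∣
        ≤⟨ ℚ.+-mono-≤ (proj₂ S m n (lt₁ p) (lt₁ q)) (proj₂ R m n (lt₂ p) (lt₂ q)) ⟩
      ½ ℚ.* ε ℚ.+ ½ ℚ.* ε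
        ≡⟨ half+half ε ⟩
      ε ∎
    where
    open ≤R
    0<ε/2 = *-pos pos-½ 0<ε
    S = cauchy-scale {s} A 0<A cs (½ ℚ.* ε) 0<ε/2
    R = cauchy-scale {r} B 0<B cr (½ ℚ.* ε) 0<ε/2
    N₁ = proj₁ S
    N₂ = proj₁ R
    lt₀ : ∀ {m} → N₀ ℕ.+ (N₁ ℕ.+ N₂) ℕ.≤ m → N₀ ℕ.≤ m
    lt₀ = ℕ.m+n≤o⇒m≤o N₀
    lt₁ : ∀ {m} → N₀ ℕ.+ (N₁ ℕ.+ N₂) ℕ.≤ m → N₁ ℕ.≤ m
    lt₁ p = ℕ.m+n≤o⇒m≤o N₁ (ℕ.m+n≤o⇒n≤o N₀ p)
    lt₂ : ∀ {m} → N₀ ℕ.+ (N₁ ℕ.+ N₂) ℕ.≤ m → N₂ ℕ.≤ m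
    lt₂ p = ℕ.m+n≤o⇒n≤o N₁ (ℕ.m+n≤o⇒n≤o N₀ p)

  cauchy-by₁ : ∀ {s r t} → IsCauchy s → IsCauchy r →
    (∀ m n → ℚ.∣ t m ℚ.- t n ∣ ℚ.≤ ℚ.∣ s m ℚ.- s n ∣ ℚ.+ ℚ.∣ r m ℚ.- r n ∣) →
    IsCauchy t
  cauchy-by₁ {s} {r} {t} cs cr h = cauchy-by {s} {r} {t} 1ℚ 1ℚ 0<1 0<1 cs cr 0 λ m n _ _ →
    subst (ℚ.∣ t m ℚ.- t n ∣ ℚ.≤_)
      (sym (cong₂ ℚ._+_ (ℚ.*-identityˡ ℚ.∣ s m ℚ.- s n ∣) (ℚ.*-identityˡ ℚ.∣ r m ℚ.- r n ∣)))
      (h m n)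

  cauchy-bounded : ∀ {s} → IsCauchy s → Bounded s
  cauchy-bounded {s} cs = N , ℚ.∣ s N ∣ ℚ.+ 1ℚ ,
    ℚ.<-≤-trans 0<1 (m≤+ʳ (ℚ.0≤∣p∣ (s N))) , λ n p → begin
      ℚ.∣ s n ∣                               ≡⟨ cong ℚ.∣_∣ (sym (add-minus (s n) (s N))) ⟩
      ℚ.∣ s N ℚ.+ (s n ℚ.- s N) ∣             ≤⟨ ℚ.∣p+q∣≤∣p∣+∣q∣ (s N) (s n ℚ.- s N) ⟩
      ℚ.∣ s N ∣ ℚ.+ ℚ.∣ s n ℚ.- s N ∣         ≤⟨ ℚ.+-monoʳ-≤ ℚ.∣ s N ∣ (proj₂ C n N p ℕ.≤-refl) ⟩
      ℚ.∣ s N ∣ ℚ.+ 1ℚ                        ∎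
    where
    open ≤R
    C = cs 1ℚ 0<1
    N = proj₁ C

  abstract
    const-cauchy : ∀ q → IsCauchy (λ _ → q)
    const-cauchy q ε 0<ε = 0 , λ _ _ _ _ →
      subst (λ r → ℚ.∣ r ∣ ℚ.≤ ε) (sym (ℚ.+-inverseʳ q)) (ℚ.<⇒≤ 0<ε)

  abstract
    +-cauchy : ∀ {s r} → IsCauchy s → IsCauchy r → IsCauchy (λ n → s n ℚ.+ r n)
    +-cauchy {s} {r} cs cr = cauchy-by₁ {s} {r} {λ n → s n ℚ.+ r n} cs cr λ m n →
      subst (λ z → ℚ.∣ z ∣ ℚ.≤ ℚ.∣ s m ℚ.- s n ∣ ℚ.+ ℚ.∣ r m ℚ.- r n ∣)
        (minus-+ (s m) (s n) (r m) (r n))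
        (ℚ.∣p+q∣≤∣p∣+∣q∣ (s m ℚ.- s n) (r m ℚ.- r n))

  abstract
    neg-cauchy : ∀ {s} → IsCauchy s → IsCauchy (λ n → ℚ.- s n)
    neg-cauchy {s} cs ε 0<ε = proj₁ (cs ε 0<ε) , λ m n p q →
      subst (ℚ._≤ ε)
        (trans (∣∣-swap (s m) (s n))
          (cong ℚ.∣_∣ (minus-neg (s m) (s n))))
        (proj₂ (cs ε 0<ε) m n p q)

  abstract
    ∣∣-cauchy : ∀ {s} → IsCauchy s → IsCauchy (λ n → ℚ.∣ s n ∣)
    ∣∣-cauchy {s} cs ε 0<ε = proj₁ (cs ε 0<ε) , λ m n p q → ℚ.≤-trans
        (∣-∣-lub (tri (s m) (s n))
          (subst (λ z → ℚ.∣ s n ∣ ℚ.≤ ℚ.∣ s m ∣ ℚ.+ z) (∣∣-swap (s n) (s m)) (tri (s n) (s m))))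
        (proj₂ (cs ε 0<ε) m n p q)
      where
      tri : ∀ a b → ℚ.∣ a ∣ ℚ.≤ ℚ.∣ b ∣ ℚ.+ ℚ.∣ a ℚ.- b ∣
      tri a b = subst (λ z → ℚ.∣ z ∣ ℚ.≤ ℚ.∣ b ∣ ℚ.+ ℚ.∣ a ℚ.- b ∣)
        (add-minus a b) (ℚ.∣p+q∣≤∣p∣+∣q∣ b (a ℚ.- b))

  abstract
    ⊔-cauchy : ∀ {s r} → IsCauchy s → IsCauchy r → IsCauchy (λ n → s n ℚ.⊔ r n)
    ⊔-cauchy {s} {r} cs cr = cauchy-by₁ {s} {r} {λ n → s n ℚ.⊔ r n} cs cr λ m n →
      ∣-∣-lub (half (s m) (s n) (r m) (r n))
        (subst₂ (λ e f → s n ℚ.⊔ r n ℚ.≤ s m ℚ.⊔ r m ℚ.+ (e ℚ.+ f))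
          (∣∣-swap (s n) (s m)) (∣∣-swap (r n) (r m)) (half (s n) (s m) (r n) (r m)))
      where
      half : ∀ a b c d → a ℚ.⊔ c ℚ.≤ b ℚ.⊔ d ℚ.+ (ℚ.∣ a ℚ.- b ∣ ℚ.+ ℚ.∣ c ℚ.- d ∣)
      half a b c d = ℚ.⊔-lub
        (ℚ.≤-trans (p≤q+∣p-q∣ a b) (ℚ.+-mono-≤ (ℚ.p≤p⊔q b d) (m≤+ˡ (ℚ.0≤∣p∣ (c ℚ.- d)))))
        (ℚ.≤-trans (p≤q+∣p-q∣ c d) (ℚ.+-mono-≤ (ℚ.p≤q⊔p b d) (m≤+ʳ (ℚ.0≤∣p∣ (a ℚ.- b)))))

  abstract
    ⊓-cauchy : ∀ {s r} → IsCauchy s → IsCauchy r → IsCauchy (λ n → s n ℚ.⊓ r n)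
    ⊓-cauchy {s} {r} cs cr = cauchy-by₁ {s} {r} {λ n → s n ℚ.⊓ r n} cs cr λ m n →
      ∣-∣-lub (half (s m) (s n) (r m) (r n))
        (subst₂ (λ e f → s n ℚ.⊓ r n ℚ.≤ s m ℚ.⊓ r m ℚ.+ (e ℚ.+ f))
          (∣∣-swap (s n) (s m)) (∣∣-swap (r n) (r m)) (half (s n) (s m) (r n) (r m)))
      where
      open ≤R
      back : ∀ {p q e} → p ℚ.≤ q ℚ.+ e → p ℚ.- e ℚ.≤ q
      back {p} {q} {e} h = move (subst (p ℚ.≤_) (ℚ.+-comm q e) h)
      half : ∀ a b c d → a ℚ.⊓ c ℚ.≤ b ℚ.⊓ d ℚ.+ (ℚ.∣ a ℚ.- b ∣ ℚ.+ ℚ.∣ c ℚ.- d ∣)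
      half a b c d = begin
        a ℚ.⊓ c
          ≡⟨ sym (minus-add (a ℚ.⊓ c) e) ⟩
        a ℚ.⊓ c ℚ.- e ℚ.+ e
          ≤⟨ ℚ.+-monoˡ-≤ e (ℚ.⊓-glb {a ℚ.⊓ c ℚ.- e} {b} {d}
               (back {a ℚ.⊓ c} {b} {e} (ℚ.≤-trans (ℚ.p⊓q≤p a c) (ℚ.≤-trans (p≤q+∣p-q∣ a b) (ℚ.+-monoʳ-≤ b (m≤+ˡ (ℚ.0≤∣p∣ (c ℚ.- d)))))))
               (back {a ℚ.⊓ c} {d} {e} (ℚ.≤-trans (ℚ.p⊓q≤q a c) (ℚ.≤-trans (p≤q+∣p-q∣ c d) (ℚ.+-monoʳ-≤ d (m≤+ʳ (ℚ.0≤∣p∣ (a ℚ.- b)))))))) ⟩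
        b ℚ.⊓ d ℚ.+ e ∎
        where
        e : ℚ
        e = ℚ.∣ a ℚ.- b ∣ ℚ.+ ℚ.∣ c ℚ.- d ∣

  ∣*-*∣ : ∀ a b c d → ℚ.∣ a ℚ.* b ℚ.- c ℚ.* d ∣ ℚ.≤
    ℚ.∣ a ∣ ℚ.* ℚ.∣ b ℚ.- d ∣ ℚ.+ ℚ.∣ d ∣ ℚ.* ℚ.∣ a ℚ.- c ∣
  ∣*-*∣ a b c d = begin
    ℚ.∣ a ℚ.* b ℚ.- c ℚ.* d ∣
      ≡⟨ cong ℚ.∣_∣ (minus-* a b c d) ⟩
    ℚ.∣ a ℚ.* (b ℚ.- d) ℚ.+ d ℚ.* (a ℚ.- c) ∣
      ≤⟨ ℚ.∣p+q∣≤∣p∣+∣q∣ (a ℚ.* (b ℚ.- d)) (d ℚ.* (a ℚ.- c)) ⟩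
    ℚ.∣ a ℚ.* (b ℚ.- d) ∣ ℚ.+ ℚ.∣ d ℚ.* (a ℚ.- c) ∣
      ≡⟨ cong₂ ℚ._+_ (ℚ.∣p*q∣≡∣p∣*∣q∣ a (b ℚ.- d)) (ℚ.∣p*q∣≡∣p∣*∣q∣ d (a ℚ.- c)) ⟩
    ℚ.∣ a ∣ ℚ.* ℚ.∣ b ℚ.- d ∣ ℚ.+ ℚ.∣ d ∣ ℚ.* ℚ.∣ a ℚ.- c ∣ ∎
    where open ≤R

  abstract
    *-cauchy : ∀ {s r} → IsCauchy s → IsCauchy r → IsCauchy (λ n → s n ℚ.* r n)
    *-cauchy {s} {r} cs cr = go (cauchy-bounded {s} cs) (cauchy-bounded {r} cr)
      where
      go : Bounded s → Bounded r → IsCauchy (λ n → s n ℚ.* r n)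
      go (N₁ , A , 0<A , hA) (N₂ , B , 0<B , hB) =
        cauchy-by {r} {s} {λ n → s n ℚ.* r n} A B 0<A 0<B cr cs (N₁ ℕ.+ N₂) bound
        where
        bound : ∀ m n → N₁ ℕ.+ N₂ ℕ.≤ m → N₁ ℕ.+ N₂ ℕ.≤ n →
          ℚ.∣ s m ℚ.* r m ℚ.- s n ℚ.* r n ∣ ℚ.≤ A ℚ.* ℚ.∣ r m ℚ.- r n ∣ ℚ.+ B ℚ.* ℚ.∣ s m ℚ.- s n ∣
        bound m n p q = ℚ.≤-trans
          (∣*-*∣ (s m) (r m) (s n) (r n))
          (ℚ.+-mono-≤
            (*-monoʳ {ℚ.∣ s m ∣} {A} ℚ.∣ r m ℚ.- r n ∣ (ℚ.0≤∣p∣ (r m ℚ.- r n)) (hA m (ℕ.m+n≤o⇒m≤o N₁ p)))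
            (*-monoʳ {ℚ.∣ r n ∣} {B} ℚ.∣ s m ℚ.- s n ∣ (ℚ.0≤∣p∣ (s m ℚ.- s n)) (hB n (ℕ.m+n≤o⇒n≤o N₁ q))))

  ι : ℕ → ℚ
  ι k = + k ℚ./ 1

  c : ℕ → ℚ
  c k = + 1 ℚ./ suc k

  toℚᵘ-ι : ∀ k → ℚ.toℚᵘ (ι k) ℚᵘ.≃ ℚᵘ.mkℚᵘ (+ k) 0
  toℚᵘ-ι k = ℚ.toℚᵘ-fromℚᵘ (ℚᵘ.mkℚᵘ (+ k) 0)

  0<c : ∀ k → 0ℚ ℚ.< c k
  0<c k = ℚ.positive⁻¹ (c k) {{ℚ.normalize-pos 1 (suc k)}}

  0≤c : ∀ k → 0ℚ ℚ.≤ c k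
  0≤c k = ℚ.<⇒≤ (0<c k)

  0<ι-suc : ∀ k → 0ℚ ℚ.< ι (suc k)
  0<ι-suc k = ℚ.positive⁻¹ (ι (suc k)) {{ℚ.normalize-pos (suc k) 1}}

  ι-suc : ∀ k → ι (suc k) ≡ 1ℚ ℚ.+ ι k
  ι-suc k = ℚ.toℚᵘ-injective (begin
      ℚ.toℚᵘ (ι (suc k))                          ≈⟨ toℚᵘ-ι (suc k) ⟩
      ℚᵘ.mkℚᵘ (+ suc k) 0                         ≈⟨ ℚᵘ.*≡* (cong (λ z → (+ 1 ℤ.+ z) ℤ.* + 1) (sym (ℤ.*-identityʳ (+ k)))) ⟩
      ℚᵘ.mkℚᵘ (+ 1) 0 ℚᵘ.+ ℚᵘ.mkℚᵘ (+ k) 0        ≈⟨ ℚᵘ.+-cong (ℚᵘ.≃-refl {ℚᵘ.mkℚᵘ (+ 1) 0}) (ℚᵘ.≃-sym (toℚᵘ-ι k)) ⟩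
      ℚ.toℚᵘ 1ℚ ℚᵘ.+ ℚ.toℚᵘ (ι k)                 ≈⟨ ℚᵘ.≃-sym (ℚ.toℚᵘ-homo-+ 1ℚ (ι k)) ⟩
      ℚ.toℚᵘ (1ℚ ℚ.+ ι k)                         ∎)
    where open ℚᵘ.≃-Reasoning

  ι*c : ∀ k → ι (suc k) ℚ.* c k ≡ 1ℚ
  ι*c k = ℚ.toℚᵘ-injective (begin
      ℚ.toℚᵘ (ι (suc k) ℚ.* c k)                       ≈⟨ ℚ.toℚᵘ-homo-* (ι (suc k)) (c k) ⟩
      ℚ.toℚᵘ (ι (suc k)) ℚᵘ.* ℚ.toℚᵘ (c k)             ≈⟨ ℚᵘ.*-cong (toℚᵘ-ι (suc k)) (ℚ.toℚᵘ-fromℚᵘ (ℚᵘ.mkℚᵘ (+ 1) k)) ⟩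
      ℚᵘ.mkℚᵘ (+ suc k) 0 ℚᵘ.* ℚᵘ.mkℚᵘ (+ 1) k         ≈⟨ ℚᵘ.*≡* (trans (ℤ.*-identityʳ (+ suc k ℤ.* 1ℤ)) (trans (ℤ.*-identityʳ (+ suc k)) (sym (trans (ℤ.*-identityˡ _) (cong +_ (ℕ.*-identityˡ (suc k))))))) ⟩
      ℚᵘ.mkℚᵘ (+ 1) 0                                  ∎)
    where open ℚᵘ.≃-Reasoning

  ι-mono : ∀ {m n} → m ℕ.≤ n → ι m ℚ.≤ ι n
  ι-mono {m} {n} h = ℚ.toℚᵘ-cancel-≤ (ℚᵘ.≤-respˡ-≃ (ℚᵘ.≃-sym (toℚᵘ-ι m))
    (ℚᵘ.≤-respʳ-≃ (ℚᵘ.≃-sym (toℚᵘ-ι n)) (ℚᵘ.*≤* (ℤ.*-monoʳ-≤-nonNeg (+ 1) (ℤ.+≤+ h)))))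

  archimedean : ∀ p → ∃ λ n → p ℚ.≤ ι n
  archimedean p@(ℚ.mkℚ z d _) = ℤ.∣ z ∣ , ℚ.toℚᵘ-cancel-≤ (ℚᵘ.≤-respʳ-≃
    (ℚᵘ.≃-sym (toℚᵘ-ι ℤ.∣ z ∣)) (ℚᵘ.*≤* (ℤ.≤-trans
      (ℤ.≤-trans (ℤ.≤-reflexive (ℤ.*-identityʳ z)) (z≤∣z∣ z))
      (ℤ.≤-trans (ℤ.+≤+ (ℕ.m≤m*n ℤ.∣ z ∣ (suc d))) (ℤ.≤-reflexive (ℤ.pos-* ℤ.∣ z ∣ (suc d)))))))
    where
    z≤∣z∣ : ∀ z → z ℤ.≤ + ℤ.∣ z ∣
    z≤∣z∣ (+ n)        = ℤ.≤-refl
    z≤∣z∣ (ℤ.-[1+ n ]) = ℤ.-≤+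

  expTerm-nonNeg : ∀ {B} → 0ℚ ℚ.≤ B → ∀ k → 0ℚ ℚ.≤ expTerm B k
  expTerm-nonNeg {B} 0≤B zero    = ℚ.<⇒≤ 0<1
  expTerm-nonNeg {B} 0≤B (suc k) =
    *-nonNeg {expTerm B k} {B ℚ.* c k} (expTerm-nonNeg 0≤B k) (*-nonNeg {B} {c k} 0≤B (0≤c k))

  expSum-mono : ∀ {B} → 0ℚ ℚ.≤ B → ∀ i n → expSum B n ℚ.≤ expSum B (i ℕ.+ n)
  expSum-mono {B} 0≤B zero    n = ℚ.≤-refl
  expSum-mono {B} 0≤B (suc i) n =
    ℚ.≤-trans (expSum-mono 0≤B i n) (m≤+ˡ {expSum B (i ℕ.+ n)} {expTerm B (suc (i ℕ.+ n))} (expTerm-nonNeg 0≤B (suc (i ℕ.+ n))))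

  ∣expTerm∣ : ∀ {B x} → ℚ.∣ x ∣ ℚ.≤ B → ∀ k → ℚ.∣ expTerm x k ∣ ℚ.≤ expTerm B k
  ∣expTerm∣ {B} {x} h zero    = ℚ.≤-refl
  ∣expTerm∣ {B} {x} h (suc k) = begin
      ℚ.∣ expTerm x k ℚ.* (x ℚ.* c k) ∣
        ≡⟨ ℚ.∣p*q∣≡∣p∣*∣q∣ (expTerm x k) (x ℚ.* c k) ⟩
      ℚ.∣ expTerm x k ∣ ℚ.* ℚ.∣ x ℚ.* c k ∣
        ≡⟨ cong (ℚ.∣ expTerm x k ∣ ℚ.*_) (trans (ℚ.∣p*q∣≡∣p∣*∣q∣ x (c k)) (cong (ℚ.∣ x ∣ ℚ.*_) (ℚ.0≤p⇒∣p∣≡p (0≤c k)))) ⟩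
      ℚ.∣ expTerm x k ∣ ℚ.* (ℚ.∣ x ∣ ℚ.* c k)
        ≤⟨ *-mono {ℚ.∣ expTerm x k ∣} {expTerm B k} {ℚ.∣ x ∣ ℚ.* c k} {B ℚ.* c k}
             (expTerm-nonNeg 0≤B k) (*-nonNeg {ℚ.∣ x ∣} {c k} (ℚ.0≤∣p∣ x) (0≤c k))
             (∣expTerm∣ h k) (*-monoʳ {ℚ.∣ x ∣} {B} (c k) (0≤c k) h) ⟩
      expTerm B k ℚ.* (B ℚ.* c k) ∎
    where
    open ≤R
    0≤B = ℚ.≤-trans (ℚ.0≤∣p∣ x) h

  expSum-tail : ∀ {B x} → ℚ.∣ x ∣ ℚ.≤ B → ∀ i n →
    ℚ.∣ expSum x (i ℕ.+ n) ℚ.- expSum x n ∣ ℚ.≤ expSum B (i ℕ.+ n) ℚ.- expSum B n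
  expSum-tail {B} {x} h zero    n = ℚ.≤-reflexive
    (trans (cong ℚ.∣_∣ (ℚ.+-inverseʳ (expSum x n))) (sym (ℚ.+-inverseʳ (expSum B n))))
  expSum-tail {B} {x} h (suc i) n = begin
      ℚ.∣ e ℚ.+ t ℚ.- e₀ ∣              ≡⟨ cong ℚ.∣_∣ (+-minus e t e₀) ⟩
      ℚ.∣ (e ℚ.- e₀) ℚ.+ t ∣            ≤⟨ ℚ.∣p+q∣≤∣p∣+∣q∣ (e ℚ.- e₀) t ⟩
      ℚ.∣ e ℚ.- e₀ ∣ ℚ.+ ℚ.∣ t ∣        ≤⟨ ℚ.+-mono-≤ (expSum-tail h i n) (∣expTerm∣ h (suc (i ℕ.+ n))) ⟩
      (E ℚ.- E₀) ℚ.+ T                  ≡⟨ sym (+-minus E T E₀) ⟩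
      E ℚ.+ T ℚ.- E₀                    ∎
    where
    open ≤R
    e  = expSum x (i ℕ.+ n)
    e₀ = expSum x n
    t  = expTerm x (suc (i ℕ.+ n))
    E  = expSum B (i ℕ.+ n)
    E₀ = expSum B n
    T  = expTerm B (suc (i ℕ.+ n))

  expSum-diff : ∀ {B x} → ℚ.∣ x ∣ ℚ.≤ B → ∀ m n →
    ℚ.∣ expSum x m ℚ.- expSum x n ∣ ℚ.≤ ℚ.∣ expSum B m ℚ.- expSum B n ∣
  expSum-diff {B} {x} h m n = [ down , up ]′ (ℕ.≤-total n m)
    where
    ordered : ∀ a b → b ℕ.≤ a → ℚ.∣ expSum x a ℚ.- expSum x b ∣ ℚ.≤ ℚ.∣ expSum B a ℚ.- expSum B b ∣
    ordered a b b≤a = subst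
      (λ a → ℚ.∣ expSum x a ℚ.- expSum x b ∣ ℚ.≤ ℚ.∣ expSum B a ℚ.- expSum B b ∣) (ℕ.m∸n+n≡m b≤a)
      (ℚ.≤-trans (expSum-tail {B} {x} h (a ℕ.∸ b) b) (p≤∣p∣ (expSum B (a ℕ.∸ b ℕ.+ b) ℚ.- expSum B b)))
    down : n ℕ.≤ m → ℚ.∣ expSum x m ℚ.- expSum x n ∣ ℚ.≤ ℚ.∣ expSum B m ℚ.- expSum B n ∣
    down = ordered m n
    up : m ℕ.≤ n → ℚ.∣ expSum x m ℚ.- expSum x n ∣ ℚ.≤ ℚ.∣ expSum B m ℚ.- expSum B n ∣
    up m≤n = subst₂ ℚ._≤_ (∣∣-swap (expSum x n) (expSum x m)) (∣∣-swap (expSum B n) (expSum B m))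
      (ordered n m m≤n)

  expTerm-lipschitz : ∀ {B x y} → ℚ.∣ x ∣ ℚ.≤ B → ℚ.∣ y ∣ ℚ.≤ B → ∀ k →
    ℚ.∣ expTerm x (suc k) ℚ.- expTerm y (suc k) ∣ ℚ.≤ expTerm B k ℚ.* ℚ.∣ x ℚ.- y ∣
  expTerm-lipschitz {B} {x} {y} hx hy zero = ℚ.≤-reflexive (trans
    (cong₂ (λ a b → ℚ.∣ a ℚ.- b ∣) (1*[p*1] x) (1*[p*1] y)) (sym (ℚ.*-identityˡ ℚ.∣ x ℚ.- y ∣)))
    where
    1*[p*1] : ∀ p → 1ℚ ℚ.* (p ℚ.* 1ℚ) ≡ p
    1*[p*1] p = trans (ℚ.*-identityˡ (p ℚ.* 1ℚ)) (ℚ.*-identityʳ p)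
  expTerm-lipschitz {B} {x} {y} hx hy (suc j) = begin
      ℚ.∣ u ℚ.* (x ℚ.* d) ℚ.- v ℚ.* (y ℚ.* d) ∣
        ≡⟨ cong ℚ.∣_∣ (factor u v x y d) ⟩
      ℚ.∣ d ℚ.* (u ℚ.* x ℚ.- v ℚ.* y) ∣
        ≡⟨ ℚ.∣p*q∣≡∣p∣*∣q∣ d (u ℚ.* x ℚ.- v ℚ.* y) ⟩
      ℚ.∣ d ∣ ℚ.* ℚ.∣ u ℚ.* x ℚ.- v ℚ.* y ∣
        ≡⟨ cong (ℚ._* ℚ.∣ u ℚ.* x ℚ.- v ℚ.* y ∣) (ℚ.0≤p⇒∣p∣≡p (0≤c (suc j))) ⟩
      d ℚ.* ℚ.∣ u ℚ.* x ℚ.- v ℚ.* y ∣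
        ≤⟨ *-monoˡ {ℚ.∣ u ℚ.* x ℚ.- v ℚ.* y ∣} {T ℚ.* δ ℚ.+ B ℚ.* (S ℚ.* δ)} d (0≤c (suc j)) (ℚ.≤-trans (∣*-*∣ u x v y) (ℚ.+-mono-≤
             (*-monoʳ {ℚ.∣ u ∣} {T} δ (ℚ.0≤∣p∣ (x ℚ.- y)) (∣expTerm∣ {B} {x} hx (suc j)))
             (*-mono {ℚ.∣ y ∣} {B} {ℚ.∣ u ℚ.- v ∣} {S ℚ.* δ} (ℚ.≤-trans (ℚ.0≤∣p∣ y) hy)
               (ℚ.0≤∣p∣ (u ℚ.- v)) hy (expTerm-lipschitz {B} {x} {y} hx hy j)))) ⟩
      d ℚ.* (T ℚ.* δ ℚ.+ B ℚ.* (S ℚ.* δ))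
        ≡⟨ cong (λ z → d ℚ.* (T ℚ.* δ ℚ.+ z)) (trans (regroup B S δ) (cong (ℚ._* δ) (sym S*B))) ⟩
      d ℚ.* (T ℚ.* δ ℚ.+ (T ℚ.* i) ℚ.* δ)
        ≡⟨ collect d T δ i ⟩
      T ℚ.* δ ℚ.* ((1ℚ ℚ.+ i) ℚ.* d)
        ≡⟨ cong (T ℚ.* δ ℚ.*_) (trans (cong (ℚ._* d) (sym (ι-suc (suc j)))) (ι*c (suc j))) ⟩
      T ℚ.* δ ℚ.* 1ℚ
        ≡⟨ ℚ.*-identityʳ (T ℚ.* δ) ⟩
      T ℚ.* δ ∎
    where
    open ≤R
    u = expTerm x (suc j)
    v = expTerm y (suc j)
    T = expTerm B (suc j)
    S = expTerm B j
    d = c (suc j)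
    i = ι (suc j)
    δ = ℚ.∣ x ℚ.- y ∣
    S*B : T ℚ.* i ≡ S ℚ.* B
    S*B = trans (shuffle S B (c j) i) (trans (cong (S ℚ.* B ℚ.*_) (ι*c j)) (ℚ.*-identityʳ (S ℚ.* B)))

  expSum-lipschitz : ∀ {B x y} → ℚ.∣ x ∣ ℚ.≤ B → ℚ.∣ y ∣ ℚ.≤ B → ∀ n →
    ℚ.∣ expSum x n ℚ.- expSum y n ∣ ℚ.≤ expSum B n ℚ.* ℚ.∣ x ℚ.- y ∣
  expSum-lipschitz {B} {x} {y} hx hy n = ℚ.≤-trans (go n)
      (*-monoʳ {expSum′ n} {expSum B n} ℚ.∣ x ℚ.- y ∣ (ℚ.0≤∣p∣ (x ℚ.- y)) (shift n))
    where
    0≤B = ℚ.≤-trans (ℚ.0≤∣p∣ x) hx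
    expSum′ : ℕ → ℚ
    expSum′ zero    = 0ℚ
    expSum′ (suc n) = expSum′ n ℚ.+ expTerm B n
    shift : ∀ n → expSum′ n ℚ.≤ expSum B n
    shift zero    = ℚ.<⇒≤ 0<1
    shift (suc n) = ℚ.≤-trans (ℚ.≤-reflexive (expSum′-suc n)) (m≤+ˡ {expSum B n} {expTerm B (suc n)} (expTerm-nonNeg 0≤B (suc n)))
      where
      expSum′-suc : ∀ n → expSum′ (suc n) ≡ expSum B n
      expSum′-suc zero    = ℚ.+-identityˡ 1ℚ
      expSum′-suc (suc n) = cong (ℚ._+ expTerm B (suc n)) (expSum′-suc n)
    go : ∀ n → ℚ.∣ expSum x n ℚ.- expSum y n ∣ ℚ.≤ expSum′ n ℚ.* ℚ.∣ x ℚ.- y ∣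
    go zero    = ℚ.≤-reflexive (sym (ℚ.*-zeroˡ ℚ.∣ x ℚ.- y ∣))
    go (suc n) = begin
        ℚ.∣ (expSum x n ℚ.+ expTerm x (suc n)) ℚ.- (expSum y n ℚ.+ expTerm y (suc n)) ∣
          ≡⟨ cong ℚ.∣_∣ (sym (minus-+ (expSum x n) (expSum y n) (expTerm x (suc n)) (expTerm y (suc n)))) ⟩
        ℚ.∣ (expSum x n ℚ.- expSum y n) ℚ.+ (expTerm x (suc n) ℚ.- expTerm y (suc n)) ∣
          ≤⟨ ℚ.∣p+q∣≤∣p∣+∣q∣ (expSum x n ℚ.- expSum y n) (expTerm x (suc n) ℚ.- expTerm y (suc n)) ⟩
        ℚ.∣ expSum x n ℚ.- expSum y n ∣ ℚ.+ ℚ.∣ expTerm x (suc n) ℚ.- expTerm y (suc n) ∣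
          ≤⟨ ℚ.+-mono-≤ (go n) (expTerm-lipschitz {B} {x} {y} hx hy n) ⟩
        expSum′ n ℚ.* ℚ.∣ x ℚ.- y ∣ ℚ.+ expTerm B n ℚ.* ℚ.∣ x ℚ.- y ∣
          ≡⟨ sym (ℚ.*-distribʳ-+ ℚ.∣ x ℚ.- y ∣ (expSum′ n) (expTerm B n)) ⟩
        (expSum′ n ℚ.+ expTerm B n) ℚ.* ℚ.∣ x ℚ.- y ∣ ∎
      where open ≤R

  expSum-cauchy : ∀ {B} → 0ℚ ℚ.≤ B → IsCauchy (expSum B)
  expSum-cauchy {B} 0≤B ε 0<ε = n₀ , λ m n p q → ∣-∣-lub (close m n p q) (close n m q p)
    where
    open ≤R
    N = proj₁ (archimedean (B ℚ.+ B))
    B≤ : B ℚ.≤ ½ ℚ.* ι N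
    B≤ = begin
      B                             ≡⟨ sym (half+half B) ⟩
      ½ ℚ.* B ℚ.+ ½ ℚ.* B           ≡⟨ sym (ℚ.*-distribˡ-+ ½ B B) ⟩
      ½ ℚ.* (B ℚ.+ B)               ≤⟨ *-monoˡ {B ℚ.+ B} {ι N} ½ (ℚ.<⇒≤ pos-½) (proj₂ (archimedean (B ℚ.+ B))) ⟩
      ½ ℚ.* ι N                     ∎
    halve : ∀ n → N ℕ.≤ n → expTerm B (suc n) ℚ.≤ expTerm B n ℚ.* ½
    halve n N≤n = *-monoˡ {B ℚ.* c n} {½} (expTerm B n) (expTerm-nonNeg 0≤B n) (begin
      B ℚ.* c n                        ≤⟨ *-monoʳ {B} {½ ℚ.* ι (suc n)} (c n) (0≤c n) (ℚ.≤-trans B≤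
                                            (*-monoˡ {ι N} {ι (suc n)} ½ (ℚ.<⇒≤ pos-½) (ι-mono (ℕ.m≤n⇒m≤1+n N≤n)))) ⟩
      ½ ℚ.* ι (suc n) ℚ.* c n          ≡⟨ ℚ.*-assoc ½ (ι (suc n)) (c n) ⟩
      ½ ℚ.* (ι (suc n) ℚ.* c n)        ≡⟨ cong (½ ℚ.*_) (ι*c n) ⟩
      ½ ℚ.* 1ℚ                         ≡⟨ ℚ.*-identityʳ ½ ⟩
      ½                                ∎)
    decay : ∀ j → ι (suc j) ℚ.* expTerm B (j ℕ.+ N) ℚ.≤ expTerm B N
    decay zero    = ℚ.≤-reflexive (ℚ.*-identityˡ (expTerm B N))
    decay (suc j) = begin
      ι (suc (suc j)) ℚ.* expTerm B (suc (j ℕ.+ N))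
        ≤⟨ *-mono {ι (suc (suc j))} {ι (suc j) ℚ.+ ι (suc j)} {expTerm B (suc (j ℕ.+ N))} {t ℚ.* ½}
             (+-nonNeg {ι (suc j)} {ι (suc j)} 0≤ι 0≤ι) (expTerm-nonNeg 0≤B (suc (j ℕ.+ N)))
             (subst (ℚ._≤ ι (suc j) ℚ.+ ι (suc j)) (sym (ι-suc (suc j)))
               (ℚ.+-monoˡ-≤ (ι (suc j)) (ι-mono {1} {suc j} (ℕ.s≤s ℕ.z≤n))))
             (halve (j ℕ.+ N) (ℕ.m≤n+m N j)) ⟩
      (ι (suc j) ℚ.+ ι (suc j)) ℚ.* (t ℚ.* ½)
        ≡⟨ twice (ι (suc j)) t ½ ⟩
      ι (suc j) ℚ.* t ℚ.* (½ ℚ.+ ½)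
        ≡⟨ ℚ.*-identityʳ (ι (suc j) ℚ.* t) ⟩
      ι (suc j) ℚ.* t
        ≤⟨ decay j ⟩
      expTerm B N ∎
      where
      t = expTerm B (j ℕ.+ N)
      0≤ι = ℚ.<⇒≤ (0<ι-suc j)
    instance
      ε-pos : ℚ.Positive ε
      ε-pos = ℚ.positive 0<ε
      ε-nz : ℚ.NonZero ε
      ε-nz = ℚ.pos⇒nonZero ε
    A = archimedean (expTerm B N ℚ.* ℚ.1/ ε)
    j = proj₁ A
    n₀ = j ℕ.+ N
    small : expTerm B n₀ ℚ.≤ ε
    small = ℚ.*-cancelˡ-≤-pos (ι (suc j)) {{ℚ.positive (0<ι-suc j)}} (begin
      ι (suc j) ℚ.* expTerm B n₀            ≤⟨ decay j ⟩
      expTerm B N                           ≡⟨ sym (ℚ.*-identityʳ (expTerm B N)) ⟩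
      expTerm B N ℚ.* 1ℚ                    ≡⟨ cong (expTerm B N ℚ.*_) (sym (ℚ.*-inverseˡ ε)) ⟩
      expTerm B N ℚ.* (ℚ.1/ ε ℚ.* ε)        ≡⟨ sym (ℚ.*-assoc (expTerm B N) (ℚ.1/ ε) ε) ⟩
      expTerm B N ℚ.* ℚ.1/ ε ℚ.* ε          ≤⟨ *-monoʳ {expTerm B N ℚ.* ℚ.1/ ε} {ι (suc j)} ε (ℚ.<⇒≤ 0<ε)
                                                 (ℚ.≤-trans (proj₂ A) (ι-mono (ℕ.n≤1+n j))) ⟩
      ι (suc j) ℚ.* ε                       ∎)
    below : ∀ i → expSum B (i ℕ.+ n₀) ℚ.+ expTerm B (i ℕ.+ n₀) ℚ.≤ expSum B n₀ ℚ.+ expTerm B n₀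
    below zero    = ℚ.≤-refl
    below (suc i) = begin
      e ℚ.+ t′ ℚ.+ t′               ≡⟨ ℚ.+-assoc e t′ t′ ⟩
      e ℚ.+ (t′ ℚ.+ t′)             ≤⟨ ℚ.+-monoʳ-≤ e (ℚ.+-mono-≤ h h) ⟩
      e ℚ.+ (t ℚ.* ½ ℚ.+ t ℚ.* ½)   ≡⟨ cong (e ℚ.+_) (trans (sym (ℚ.*-distribˡ-+ t ½ ½)) (ℚ.*-identityʳ t)) ⟩
      e ℚ.+ t                       ≤⟨ below i ⟩
      expSum B n₀ ℚ.+ expTerm B n₀  ∎
      where
      e  = expSum B (i ℕ.+ n₀)
      t  = expTerm B (i ℕ.+ n₀)
      t′ = expTerm B (suc (i ℕ.+ n₀))
      h : t′ ℚ.≤ t ℚ.* ½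
      h = halve (i ℕ.+ n₀) (ℕ.≤-trans (ℕ.m≤n+m N j) (ℕ.m≤n+m n₀ i))
    close : ∀ m n → n₀ ℕ.≤ m → n₀ ℕ.≤ n → expSum B m ℚ.≤ expSum B n ℚ.+ ε
    close m n p q = begin
      expSum B m                                                ≡⟨ cong (expSum B) (sym (ℕ.m∸n+n≡m p)) ⟩
      expSum B (m ℕ.∸ n₀ ℕ.+ n₀)
        ≤⟨ m≤+ˡ {expSum B (m ℕ.∸ n₀ ℕ.+ n₀)} {expTerm B (m ℕ.∸ n₀ ℕ.+ n₀)} (expTerm-nonNeg 0≤B (m ℕ.∸ n₀ ℕ.+ n₀)) ⟩
      expSum B (m ℕ.∸ n₀ ℕ.+ n₀) ℚ.+ expTerm B (m ℕ.∸ n₀ ℕ.+ n₀)  ≤⟨ below (m ℕ.∸ n₀) ⟩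
      expSum B n₀ ℚ.+ expTerm B n₀                              ≤⟨ ℚ.+-mono-≤ (expSum-mono 0≤B (n ℕ.∸ n₀) n₀) small ⟩
      expSum B (n ℕ.∸ n₀ ℕ.+ n₀) ℚ.+ ε                          ≡⟨ cong (λ k → expSum B k ℚ.+ ε) (ℕ.m∸n+n≡m q) ⟩
      expSum B n ℚ.+ ε                                          ∎

  abstract
    exp-cauchy : ∀ {s} → IsCauchy s → IsCauchy (λ n → expSum (s n) n)
    exp-cauchy {s} cs = go (cauchy-bounded {s} cs)
      where
      go : Bounded s → IsCauchy (λ n → expSum (s n) n)
      go (N₁ , B , 0<B , hB) = go′ (cauchy-bounded {expSum B} cE)
        where
        cE : IsCauchy (expSum B)
        cE = expSum-cauchy {B} (ℚ.<⇒≤ 0<B)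
        go′ : Bounded (expSum B) → IsCauchy (λ n → expSum (s n) n)
        go′ (N₂ , M , 0<M , hM) =
          cauchy-by {s} {expSum B} {λ n → expSum (s n) n} M 1ℚ 0<M 0<1 cs cE (N₁ ℕ.+ N₂) bound
          where
          open ≤R
          bound : ∀ m n → N₁ ℕ.+ N₂ ℕ.≤ m → N₁ ℕ.+ N₂ ℕ.≤ n →
            ℚ.∣ expSum (s m) m ℚ.- expSum (s n) n ∣ ℚ.≤
            M ℚ.* ℚ.∣ s m ℚ.- s n ∣ ℚ.+ 1ℚ ℚ.* ℚ.∣ expSum B m ℚ.- expSum B n ∣
          bound m n p q = begin
            ℚ.∣ x ℚ.- z ∣
              ≡⟨ cong ℚ.∣_∣ (split x y z) ⟩
            ℚ.∣ (x ℚ.- y) ℚ.+ (y ℚ.- z) ∣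
              ≤⟨ ℚ.∣p+q∣≤∣p∣+∣q∣ (x ℚ.- y) (y ℚ.- z) ⟩
            ℚ.∣ x ℚ.- y ∣ ℚ.+ ℚ.∣ y ℚ.- z ∣
              ≤⟨ ℚ.+-mono-≤
                   (ℚ.≤-trans
                     (expSum-lipschitz {B} {s m} {s n} (hB m (ℕ.m+n≤o⇒m≤o N₁ p)) (hB n (ℕ.m+n≤o⇒m≤o N₁ q)) m)
                     (*-monoʳ {expSum B m} {M} ℚ.∣ s m ℚ.- s n ∣ (ℚ.0≤∣p∣ (s m ℚ.- s n))
                       (ℚ.≤-trans (p≤∣p∣ (expSum B m)) (hM m (ℕ.m+n≤o⇒n≤o N₁ p)))))
                   (ℚ.≤-trans (expSum-diff {B} {s n} (hB n (ℕ.m+n≤o⇒m≤o N₁ q)) m n)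
                     (ℚ.≤-reflexive (sym (ℚ.*-identityˡ ℚ.∣ expSum B m ℚ.- expSum B n ∣)))) ⟩
            M ℚ.* ℚ.∣ s m ℚ.- s n ∣ ℚ.+ 1ℚ ℚ.* ℚ.∣ expSum B m ℚ.- expSum B n ∣ ∎
            where
            x y z : ℚ
            x = expSum (s m) m
            y = expSum (s n) m
            z = expSum (s n) n

open CauchyLemmas

-- ℝ is the setoid of Cauchy sequences of rationals (with explicit moduli),
-- equality being _≈_.  Arithmetic is termwise.

record ℝ : Set where
  constructor mkℝ
  field
    seq    : ℕ → ℚ
    cauchy : IsCauchy seq

open ℝ public

infix  4 _≈_ _<_ _≤_
infix  8 -_
infixl 7 _*_ _⊓_
infixl 6 _+_ _-_ _⊔_

record _≈_ (x y : ℝ) : Set where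
  constructor mk≈
  field
    ≈-eventually : ∀ ε → 0ℚ ℚ.< ε → ∃ λ N → ∀ n → N ℕ.≤ n → ℚ.∣ seq x n ℚ.- seq y n ∣ ℚ.≤ ε

record _≤_ (x y : ℝ) : Set where
  constructor mk≤
  field
    ≤-eventually : ∀ ε → 0ℚ ℚ.< ε → ∃ λ N → ∀ n → N ℕ.≤ n → seq x n ℚ.≤ seq y n ℚ.+ ε

record _<_ (x y : ℝ) : Set where
  constructor mk<
  field
    gap     : ℚ
    0<gap   : 0ℚ ℚ.< gap
    from    : ℕ
    <-apart : ∀ n → from ℕ.≤ n → seq x n ℚ.+ gap ℚ.≤ seq y n

fromℚ : ℚ → ℝ
fromℚ q = mkℝ (λ _ → q) (const-cauchy q)

fromℕ : ℕ → ℝ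
fromℕ n = fromℚ (+ n ℚ./ 1)

fromℤ : ℤ → ℝ
fromℤ z = fromℚ (z ℚ./ 1)

0ℝ 1ℝ : ℝ
0ℝ = fromℚ 0ℚ
1ℝ = fromℚ 1ℚ

_+_ _*_ _⊔_ _⊓_ : ℝ → ℝ → ℝ
x + y = mkℝ (λ n → seq x n ℚ.+ seq y n) (+-cauchy {seq x} {seq y} (cauchy x) (cauchy y))
x * y = mkℝ (λ n → seq x n ℚ.* seq y n) (*-cauchy {seq x} {seq y} (cauchy x) (cauchy y))
x ⊔ y = mkℝ (λ n → seq x n ℚ.⊔ seq y n) (⊔-cauchy {seq x} {seq y} (cauchy x) (cauchy y))
x ⊓ y = mkℝ (λ n → seq x n ℚ.⊓ seq y n) (⊓-cauchy {seq x} {seq y} (cauchy x) (cauchy y))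

-_ ∣_∣ : ℝ → ℝ
- x   = mkℝ (λ n → ℚ.- seq x n) (neg-cauchy {seq x} (cauchy x))
∣ x ∣ = mkℝ (λ n → ℚ.∣ seq x n ∣) (∣∣-cauchy {seq x} (cauchy x))

_-_ : ℝ → ℝ → ℝ
x - y = x + (- y)

-- The n-th term evaluates the n-th Taylor polynomial of the exponential
-- at the n-th approximation of x.
exp : ℝ → ℝ
exp x = mkℝ (λ n → expSum (seq x n) n) (exp-cauchy {seq x} (cauchy x))

-- l = log x.  The logarithm is kept as a relation: l is determined by x up
-- to ≈, and exists for every x > 0.
IsLog : ℝ → ℝ → Set
IsLog x l = exp l ≈ x

ℝ^_ : ℕ → Set
ℝ^ d = Vector ℝ d

Matrix : Set → ℕ → Set
Matrix A d = Fin d → Fin d → A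

module _ {d : ℕ} where

  infix  4 _≋_ _⟶_
  infixl 6 _+ᵥ_ _-ᵥ_
  infixl 7 _·ᵥ_ _⊛ᵥ_

  _≋_ : ℝ^ d → ℝ^ d → Set
  x ≋ y = ∀ i → x i ≈ y i

  0ᵥ : ℝ^ d
  0ᵥ _ = 0ℝ

  _+ᵥ_ _-ᵥ_ : ℝ^ d → ℝ^ d → ℝ^ d
  (x +ᵥ y) i = x i + y i
  (x -ᵥ y) i = x i - y i

  _⊛ᵥ_ : ℝ → ℝ^ d → ℝ^ d
  (a ⊛ᵥ x) i = a * x i

  _·ᵥ_ : Matrix ℝ d → ℝ^ d → ℝ^ d
  (A ·ᵥ x) i = foldr _+_ 0ℝ (λ j → A i j * x j)

  ‖_‖ : ℝ^ d → ℝ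
  ‖ x ‖ = foldr _⊔_ 0ℝ (λ i → ∣ x i ∣)

  _⟶_ : (ℕ → ℝ^ d) → ℝ^ d → Set
  s ⟶ x = ∀ ε → 0ℝ < ε → ∃ λ N → ∀ n → N ℕ.≤ n → ‖ s n -ᵥ x ‖ < ε

  Open : Pred (ℝ^ d) 0ℓ → Set
  Open U = ∀ x → x ∈ U → ∃ λ ε → 0ℝ < ε × (∀ y → ‖ y -ᵥ x ‖ < ε → y ∈ U)

  Compact : Pred (ℝ^ d) 0ℓ → Set₁
  Compact C = (I : Set) (U : I → Pred (ℝ^ d) 0ℓ) → (∀ i → Open (U i)) →
    (∀ x → x ∈ C → ∃ λ i → x ∈ U i) →
    ∃ λ (is : List I) → ∀ x → x ∈ C → Any (λ i → x ∈ U i) is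

  fromℚᵥ : Vector ℚ d → ℝ^ d
  fromℚᵥ r i = fromℚ (r i)

  ratio : Vector ℤ d → (q : ℕ) .{{_ : ℕ.NonZero q}} → ℝ^ d
  ratio p q i = fromℚ (p i ℚ./ q)

  Rational : Pred (ℝ^ d) 0ℓ
  Rational x = ∃ λ (r : Vector ℚ d) → x ≋ fromℚᵥ r

sign : ∀ {n} → Fin n → ℤ
sign zero    = 1ℤ
sign (suc j) = ℤ.- sign j

det : ∀ {d} → Matrix ℤ d → ℤ
det {zero}  A = 1ℤ
det {suc d} A = foldr ℤ._+_ 0ℤ
  (λ j → sign j ℤ.* A zero j ℤ.* det (λ i k → A (suc i) (punchIn j k)))

record IFS (d J : ℕ) : Set where
  field
    map         : Fin J → ℝ^ d → ℝ^ d
    rate        : Fin J → ℝ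
    0<rate      : ∀ j → 0ℝ < rate j
    rate<1      : ∀ j → rate j < 1ℝ
    contraction : ∀ j x y → ‖ map j x -ᵥ map j y ‖ ≤ rate j * ‖ x -ᵥ y ‖

module _ {d J : ℕ} (F : IFS d J) where
  open IFS F

  record IsAttractor (C : Pred (ℝ^ d) 0ℓ) : Set₁ where
    field
      nonempty  : ∃ λ x → x ∈ C
      compact   : Compact C
      invariant : ∀ y → y ∈ C ⇔ (∃₂ λ j x → x ∈ C × y ≋ map j x)

  Affine : Set
  Affine = ∀ j → ∃₂ λ (A : Matrix ℝ d) (b : ℝ^ d) → ∀ y → map j y ≋ A ·ᵥ y +ᵥ b

  RationalPreserving : Set
  RationalPreserving = ∀ j (r : Vector ℚ d) → Rational (map j (fromℚᵥ r))

  record UnimodularMap (f : ℝ^ d → ℝ^ d) : Set where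
    field
      A       : Matrix ℤ d
      b       : Vector ℤ d
      q s     : ℕ
      {{q≢0}} : ℕ.NonZero q
      {{s≢0}} : ℕ.NonZero s
      det-±1  : det A ≡ 1ℤ ⊎ det A ≡ -1ℤ
      formula : ∀ y → f y ≋ fromℚ (1ℤ ℚ./ q) ⊛ᵥ ((λ i j → fromℤ (A i j)) ·ᵥ y) +ᵥ ratio b s

  Unimodular : Set
  Unimodular = ∀ j → UnimodularMap (map j)

  -- compose ω i = f_{ω 0} ∘ ⋯ ∘ f_{ω (i - 1)}
  compose : (ℕ → Fin J) → ℕ → ℝ^ d → ℝ^ d
  compose ω zero    x = x
  compose ω (suc i) x = map (ω 0) (compose (ω ∘ suc) i x)

  IsAddress : ℝ^ d → (ℕ → Fin J) → Set
  IsAddress ξ ω = (λ i → compose ω i 0ᵥ) ⟶ ξ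

  record UltimatelyPeriodicAddress (ξ : ℝ^ d) : Set where
    field
      ω          : ℕ → Fin J
      isAddress  : IsAddress ξ ω
      preperiod  : ℕ
      period     : ℕ
      {{period≢0}} : ℕ.NonZero period
      periodic   : ∀ i → preperiod ℕ.≤ i → ω (i ℕ.+ period) ≡ ω i

    totalLength : ℕ
    totalLength = preperiod ℕ.+ period

  -- The rates are positive, so starting the fold at 0 does not affect the maximum.
  maxRate : ℝ
  maxRate = foldr _⊔_ 0ℝ rate

  -- D = - log J / log τ with τ the largest rate; log τ < 0 makes D unique.
  IsExponent : ℝ → Set
  IsExponent D = ∃₂ λ logJ logτ →
    IsLog (fromℕ J) logJ × IsLog maxRate logτ × D * logτ ≈ - logJ

module Submission where

-- The composition along the period of an ultimately periodic address is an affine rational contraction.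
-- Over ℚ the vectors g(0) and e_j - (g(e_j) - g(0)) are d + 1 vectors in dimension d, and a linear relation
-- between them yields a rational fixed point of g; the preperiod maps it to the given point.
--
-- Conversely let x = p/q lie in C and let x = x₀, x₁, … be successive preimages in C under the maps.  Integer
-- matrices of determinant ±1 have integral inverses, so all x_i have denominator Q = q ∏ s_j.  A repetition
-- x_a = x_b (a < b) makes the address ultimately periodic of total length b.  By the pigeonhole principle a
-- repetition occurs among the first O(Q^d) points, as C is bounded, and also among the first J^n + 1 points once
-- the cylinders of level n have diameter below 1/Q; the least such n has τ^n ≫ 1/q, that is J^n ≪ q^D.

open import Defs
open import Algebra.Bundles using (CommutativeRing)
import Algebra.Properties.Group
import Algebra.Properties.Semiring.Sum
open import Data.Fin.Base as Fin using (Fin; zero; suc; punchIn; punchOut; inject₁; toℕ)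
import Data.Fin.Properties as Fin
open import Data.Integer.Base as ℤ using (ℤ; +_; 0ℤ; 1ℤ; -1ℤ)
import Data.Integer.Properties as ℤ
open import Data.Integer.Tactic.RingSolver using () renaming (solve-∀ to ℤ-solve-∀)
open import Data.List.Base as List using (List)
open import Data.List.Relation.Unary.Any using (Any; here; there)
open import Data.Maybe.Base using () renaming (map to mapᴹ)
open import Data.Nat.Base as ℕ using (ℕ; zero; suc; NonZero; _^_)
open import Data.Nat.Divisibility as ∣ using (_∣_; divides)
import Data.Nat.ListAction as ListAction
import Data.Nat.Properties as ℕ
open import Data.Product.Base using (∃; ∃₂; Σ; _×_; _,_; proj₁; proj₂; map₂)
open import Data.Rational.Base as ℚ using (ℚ; 0ℚ; 1ℚ; ½)
import Data.Rational.Properties as ℚ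
import Data.Rational.Unnormalised.Base as ℚᵘ
import Data.Rational.Unnormalised.Properties as ℚᵘ
open import Data.Sum.Base using (_⊎_; inj₁; inj₂; [_,_]′)
open import Data.Vec.Functional using (Vector; foldr; updateAt; _∷_)
import Data.Vec.Functional.Properties as Vec
open import Function.Base using (_∘_; const)
open import Function.Bundles using (_⇔_; Equivalence; mk⇔)
open import Level using (0ℓ)
open import Relation.Binary.Bundles using (Poset)
open import Relation.Binary.Definitions using (tri<; tri≈; tri>)
open import Relation.Binary.PropositionalEquality as ≡ using (_≡_; _≢_; refl; cong; cong₂; subst; subst₂)
open import Relation.Binary.Structures using (IsEquivalence)
open import Relation.Nullary using (Dec; ¬_; yes; no; contradiction; ¬?)
open import Relation.Nullary.Decidable using (decidable-stable; dec⇒maybe)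
open import Relation.Unary using (Pred; _∈_)
open import Tactic.RingSolver using (solve-∀)

-- The order of the reals is not decidable, and this shapes the quantitative part. `separate`
-- replaces trichotomy by a comparison with two rationals, so the search for the least n works with
-- the pair of thresholds ¼ and ½, and the lost factor goes into the constant. For the same reason
-- one address has to meet both bounds at once: it is chosen by comparing the natural numbers
-- `J ^ n` and `boxes`, because q^D and q^d cannot be compared. Equality of points is not decided
-- either; the pigeonhole principle runs on codes in a finite type, and equal codes force equal
-- integer numerators. The logarithm is a relation and q^D is exp (D log q). The estimate for J^n
-- therefore comes from taking logarithms in ρ^m ≤ q ρ^n, with m independent of q. This needs `exp`
-- to be additive and to reflect the order, which is proved with Cauchy products. Multiplying the
-- resulting inequality by D preserves it because D ≥ 0, a consequence of J ≥ 1 and ρ < 1.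
-- Compactness enters as boundedness, which limits both the box of numerators and the diameters of
-- cylinders.

module Q = CauchyLemmas

-- Order and ring structure of the reals.

Eventually : (ℕ → Set) → Set
Eventually P = ∃ λ N → ∀ n → N ℕ.≤ n → P n

always : ∀ {P} → (∀ n → P n) → Eventually P
always h = 0 , λ n _ → h n

eventually-map : ∀ {P R} → (∀ n → P n → R n) → Eventually P → Eventually R
eventually-map f (N , h) = N , λ n p → f n (h n p)

eventually-zip : ∀ {P R S} → (∀ n → P n → R n → S n) → Eventually P → Eventually R → Eventually S
eventually-zip f (M , h) (N , k) = M ℕ.⊔ N , λ n p →
  f n (h n (ℕ.m⊔n≤o⇒m≤o M N p)) (k n (ℕ.m⊔n≤o⇒n≤o M N p))

0<½* : ∀ {ε} → 0ℚ ℚ.< ε → 0ℚ ℚ.< ½ ℚ.* ε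
0<½* {ε} = Q.*-pos {½} {ε} Q.pos-½

≤-termwise : ∀ {x y} → (∀ n → seq x n ℚ.≤ seq y n) → x ≤ y
≤-termwise {x} {y} h = mk≤ λ ε 0<ε → always λ n → ℚ.≤-trans (h n) (Q.m≤+ˡ {seq y n} {ε} (ℚ.<⇒≤ 0<ε))

≤-trans : ∀ {x y z} → x ≤ y → y ≤ z → x ≤ z
≤-trans {x} {y} {z} (mk≤ h) (mk≤ k) = mk≤ λ ε 0<ε → eventually-zip
  (λ n p q → ℚ.≤-trans p (ℚ.≤-trans (ℚ.+-monoˡ-≤ (½ ℚ.* ε) q) (ℚ.≤-reflexive
    (≡.trans (ℚ.+-assoc (seq z n) (½ ℚ.* ε) (½ ℚ.* ε)) (cong (seq z n ℚ.+_) (Q.half+half ε))))))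
  (h (½ ℚ.* ε) (0<½* {ε} 0<ε)) (k (½ ℚ.* ε) (0<½* {ε} 0<ε))

-- Transitivity of `_≈_` and its compatibility with sums and negation are glued by this lemma from
-- two monotonicity facts each.
≤-antisym : ∀ {x y} → x ≤ y → y ≤ x → x ≈ y
≤-antisym {x} {y} (mk≤ h) (mk≤ k) = mk≈ λ ε 0<ε →
  eventually-zip (λ n → Q.∣-∣-lub {seq x n} {seq y n} {ε}) (h ε 0<ε) (k ε 0<ε)

≈⇒≤ : ∀ {x y} → x ≈ y → x ≤ y
≈⇒≤ {x} {y} (mk≈ h) = mk≤ λ ε 0<ε → eventually-map
  (λ n p → ℚ.≤-trans (Q.p≤q+∣p-q∣ (seq x n) (seq y n)) (ℚ.+-monoʳ-≤ (seq y n) p)) (h ε 0<ε)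

≈-sym : ∀ {x y} → x ≈ y → y ≈ x
≈-sym {x} {y} (mk≈ h) = mk≈ λ ε 0<ε → eventually-map
  (λ n → subst (ℚ._≤ ε) (Q.∣∣-swap (seq x n) (seq y n))) (h ε 0<ε)

≈⇒≥ : ∀ {x y} → x ≈ y → y ≤ x
≈⇒≥ p = ≈⇒≤ (≈-sym p)

≈-trans : ∀ {x y z} → x ≈ y → y ≈ z → x ≈ z
≈-trans p q = ≤-antisym (≤-trans (≈⇒≤ p) (≈⇒≤ q)) (≤-trans (≈⇒≥ q) (≈⇒≥ p))

≈-termwise : ∀ {x y} → (∀ n → seq x n ≡ seq y n) → x ≈ y
≈-termwise h = ≤-antisym (≤-termwise λ n → ℚ.≤-reflexive (h n)) (≤-termwise λ n → ℚ.≤-reflexive (≡.sym (h n)))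

≈-refl : ∀ {x} → x ≈ x
≈-refl = ≈-termwise λ _ → refl

≈-reflexive : ∀ {x y} → x ≡ y → x ≈ y
≈-reflexive refl = ≈-refl

≤-refl : ∀ {x} → x ≤ x
≤-refl = ≈⇒≤ ≈-refl

≈-isEquivalence : IsEquivalence _≈_
≈-isEquivalence = record { refl = ≈-refl ; sym = ≈-sym ; trans = ≈-trans }

≤-poset : Poset 0ℓ 0ℓ 0ℓ
≤-poset = record
  { Carrier = ℝ ; _≈_ = _≈_ ; _≤_ = _≤_
  ; isPartialOrder = record
    { isPreorder = record { isEquivalence = ≈-isEquivalence ; reflexive = ≈⇒≤ ; trans = ≤-trans }
    ; antisym = ≤-antisym } }

module ≤-Reasoning where
  open import Relation.Binary.Reasoning.PartialOrder ≤-poset public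

+-mono-≤ : ∀ {x y u v} → x ≤ y → u ≤ v → x + u ≤ y + v
+-mono-≤ {x} {y} {u} {v} (mk≤ h) (mk≤ k) = mk≤ λ ε 0<ε → eventually-zip
  (λ n p q → ℚ.≤-trans (ℚ.+-mono-≤ p q) (ℚ.≤-reflexive (≡.trans (rearrange (seq y n) (½ ℚ.* ε) (seq v n) (½ ℚ.* ε))
    (cong ((seq y n ℚ.+ seq v n) ℚ.+_) (Q.half+half ε)))))
  (h (½ ℚ.* ε) (0<½* {ε} 0<ε)) (k (½ ℚ.* ε) (0<½* {ε} 0<ε))
  where
  rearrange : ∀ a b c d → (a ℚ.+ b) ℚ.+ (c ℚ.+ d) ≡ (a ℚ.+ c) ℚ.+ (b ℚ.+ d)
  rearrange = solve-∀ Q.ring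

+-cong : ∀ {x y u v} → x ≈ y → u ≈ v → x + u ≈ y + v
+-cong p q = ≤-antisym (+-mono-≤ (≈⇒≤ p) (≈⇒≤ q)) (+-mono-≤ (≈⇒≥ p) (≈⇒≥ q))

neg-mono-≤ : ∀ {x y} → x ≤ y → - y ≤ - x
neg-mono-≤ {x} {y} (mk≤ h) = mk≤ λ ε 0<ε → eventually-map
  (λ n p → subst₂ ℚ._≤_ (cancel₁ (seq x n) (seq y n)) (cancel₂ (seq x n) (seq y n) ε)
    (ℚ.+-monoˡ-≤ (ℚ.- seq x n ℚ.- seq y n) p)) (h ε 0<ε)
  where
  cancel₁ : ∀ a b → a ℚ.+ (ℚ.- a ℚ.- b) ≡ ℚ.- b
  cancel₁ = solve-∀ Q.ring
  cancel₂ : ∀ a b e → b ℚ.+ e ℚ.+ (ℚ.- a ℚ.- b) ≡ ℚ.- a ℚ.+ e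
  cancel₂ = solve-∀ Q.ring

neg-cong : ∀ {x y} → x ≈ y → - x ≈ - y
neg-cong p = ≤-antisym (neg-mono-≤ (≈⇒≥ p)) (neg-mono-≤ (≈⇒≤ p))

≈-scale : ∀ {x y} A → 0ℚ ℚ.< A → x ≈ y → ∀ ε → 0ℚ ℚ.< ε →
  Eventually λ n → A ℚ.* ℚ.∣ seq x n ℚ.- seq y n ∣ ℚ.≤ ε
≈-scale {x} {y} A 0<A (mk≈ h) ε 0<ε = eventually-map
  (λ n p → ℚ.≤-trans (Q.*-monoˡ {ℚ.∣ seq x n ℚ.- seq y n ∣} {ℚ.1/ A ℚ.* ε} A (ℚ.<⇒≤ 0<A) p) (ℚ.≤-reflexive
    (≡.trans (≡.sym (ℚ.*-assoc A (ℚ.1/ A) ε)) (≡.trans (cong (ℚ._* ε) (ℚ.*-inverseʳ A)) (ℚ.*-identityˡ ε)))))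
  (h (ℚ.1/ A ℚ.* ε) (Q.*-pos {ℚ.1/ A} {ε} (ℚ.positive⁻¹ _ {{ℚ.1/pos⇒pos A}}) 0<ε))
  where
  instance
    _ = ℚ.positive 0<A
    _ = ℚ.pos⇒nonZero A

*-cong : ∀ {x y u v} → x ≈ y → u ≈ v → x * u ≈ y * v
*-cong {x} {y} {u} {v} p q = mk≈ λ ε 0<ε → eventually-zip
  (λ n (h , k) (e , f) → ℚ.≤-trans (Q.∣*-*∣ (seq x n) (seq u n) (seq y n) (seq v n))
    (ℚ.≤-trans (ℚ.+-mono-≤
      (ℚ.≤-trans (Q.*-monoʳ {ℚ.∣ seq x n ∣} {A} ℚ.∣ seq u n ℚ.- seq v n ∣ (ℚ.0≤∣p∣ (seq u n ℚ.- seq v n)) h) e)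
      (ℚ.≤-trans (Q.*-monoʳ {ℚ.∣ seq v n ∣} {B} ℚ.∣ seq x n ℚ.- seq y n ∣ (ℚ.0≤∣p∣ (seq x n ℚ.- seq y n)) k) f))
      (ℚ.≤-reflexive (Q.half+half ε))))
  (eventually-zip (λ _ → _,_) (N₁ , hA) (N₂ , hB))
  (eventually-zip (λ _ → _,_) (≈-scale A 0<A q (½ ℚ.* ε) (0<½* {ε} 0<ε)) (≈-scale B 0<B p (½ ℚ.* ε) (0<½* {ε} 0<ε)))
  where
  bx = Q.cauchy-bounded {seq x} (cauchy x)
  bv = Q.cauchy-bounded {seq v} (cauchy v)
  N₁ = proj₁ bx
  A = proj₁ (proj₂ bx)
  0<A = proj₁ (proj₂ (proj₂ bx))
  hA = proj₂ (proj₂ (proj₂ bx))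
  N₂ = proj₁ bv
  B = proj₁ (proj₂ bv)
  0<B = proj₁ (proj₂ (proj₂ bv))
  hB = proj₂ (proj₂ (proj₂ bv))

ℝ-commutativeRing : CommutativeRing 0ℓ 0ℓ
ℝ-commutativeRing = record
  { Carrier = ℝ ; _≈_ = _≈_ ; _+_ = _+_ ; _*_ = _*_ ; -_ = -_ ; 0# = 0ℝ ; 1# = 1ℝ
  ; isCommutativeRing = record
    { isRing = record
      { +-isAbelianGroup = record
        { isGroup = record
          { isMonoid = record
            { isSemigroup = record
              { isMagma = record { isEquivalence = ≈-isEquivalence ; ∙-cong = +-cong }
              ; assoc = λ x y z → ≈-termwise λ n → ℚ.+-assoc (seq x n) (seq y n) (seq z n) }
            ; identity = (λ x → ≈-termwise λ n → ℚ.+-identityˡ (seq x n)) , (λ x → ≈-termwise λ n → ℚ.+-identityʳ (seq x n)) }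
          ; inverse = (λ x → ≈-termwise λ n → ℚ.+-inverseˡ (seq x n)) , (λ x → ≈-termwise λ n → ℚ.+-inverseʳ (seq x n))
          ; ⁻¹-cong = neg-cong }
        ; comm = λ x y → ≈-termwise λ n → ℚ.+-comm (seq x n) (seq y n) }
      ; *-cong = *-cong
      ; *-assoc = λ x y z → ≈-termwise λ n → ℚ.*-assoc (seq x n) (seq y n) (seq z n)
      ; *-identity = (λ x → ≈-termwise λ n → ℚ.*-identityˡ (seq x n)) , (λ x → ≈-termwise λ n → ℚ.*-identityʳ (seq x n))
      ; distrib = (λ x y z → ≈-termwise λ n → ℚ.*-distribˡ-+ (seq x n) (seq y n) (seq z n))
                , (λ x y z → ≈-termwise λ n → ℚ.*-distribʳ-+ (seq x n) (seq y n) (seq z n)) }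
    ; *-comm = λ x y → ≈-termwise λ n → ℚ.*-comm (seq x n) (seq y n) } }

module R = CommutativeRing ℝ-commutativeRing

-- Rationals serve as coefficients, embedded by `fromℚ`. Identities may then contain constants such
-- as ½, and coefficients are compared decidably in ℚ although `_≈_` is undecidable.
module RingSolver where
  open import Algebra.Solver.Ring.AlmostCommutativeRing
  private
    real-ring : AlmostCommutativeRing 0ℓ 0ℓ
    real-ring = fromCommutativeRing ℝ-commutativeRing
    rational-coefficients : CommutativeRing.rawRing ℚ.+-*-commutativeRing -Raw-AlmostCommutative⟶ real-ring
    rational-coefficients = record
      { ⟦_⟧ = fromℚ
      ; +-homo = λ p q → ≈-termwise λ _ → refl ; *-homo = λ p q → ≈-termwise λ _ → refl
      ; -‿homo = λ p → ≈-termwise λ _ → refl ; 0-homo = ≈-refl ; 1-homo = ≈-refl }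
  open import Algebra.Solver.Ring (CommutativeRing.rawRing ℚ.+-*-commutativeRing) real-ring rational-coefficients
    (λ p q → mapᴹ (λ e → subst (λ r → fromℚ p ≈ fromℚ r) e ≈-refl) (dec⇒maybe (p ℚ.≟ q))) public

open RingSolver using (solve; _:=_; _:+_; _:-_; _:*_; :-_; con)

x≤y⇒0≤y-x : ∀ {x y} → x ≤ y → 0ℝ ≤ y - x
x≤y⇒0≤y-x {x} {y} p = ≤-trans (≈⇒≥ (R.-‿inverseʳ x)) (+-mono-≤ p (≤-refl { - x}))

0≤y-x⇒x≤y : ∀ {x y} → 0ℝ ≤ y - x → x ≤ y
0≤y-x⇒x≤y {x} {y} p = ≤-trans (≈⇒≥ (R.+-identityˡ x)) (≤-trans (+-mono-≤ p (≤-refl {x}))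
  (≈⇒≤ (solve 2 (λ x y → y :- x :+ x := y) ≈-refl x y)))

fromℚ-mono-≤ : ∀ {p q} → p ℚ.≤ q → fromℚ p ≤ fromℚ q
fromℚ-mono-≤ h = ≤-termwise λ _ → h

-- The order of ℚ is decidable, so only p > q has to be refuted, by allowing `_≤_` the error (p - q)
-- / 2.
fromℚ-cancel-≤ : ∀ {p q} → fromℚ p ≤ fromℚ q → p ℚ.≤ q
fromℚ-cancel-≤ {p} {q} (mk≤ h) with p ℚ.≤? q
... | yes p≤q = p≤q
... | no p≰q = contradiction (ℚ.≤-<-trans p≤mid mid<p) (ℚ.<-irrefl refl)
  where
  q<p = ℚ.≰⇒> p≰q
  d = p ℚ.- q
  0<d : 0ℚ ℚ.< d
  0<d = subst (ℚ._< d) (ℚ.+-inverseʳ q) (ℚ.+-monoˡ-< (ℚ.- q) q<p)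
  p≤mid : p ℚ.≤ q ℚ.+ ½ ℚ.* d
  p≤mid = let N , k = h (½ ℚ.* d) (0<½* {d} 0<d) in k N ℕ.≤-refl
  mid<p : q ℚ.+ ½ ℚ.* d ℚ.< p
  mid<p = subst (q ℚ.+ ½ ℚ.* d ℚ.<_) (≡.trans (ℚ.+-assoc q (½ ℚ.* d) (½ ℚ.* d)) (≡.trans (cong (q ℚ.+_) (Q.half+half d)) (Q.add-minus p q)))
    (subst (ℚ._< q ℚ.+ ½ ℚ.* d ℚ.+ ½ ℚ.* d) (ℚ.+-identityʳ (q ℚ.+ ½ ℚ.* d)) (ℚ.+-monoʳ-< (q ℚ.+ ½ ℚ.* d) (0<½* {d} 0<d)))

fromℚ-injective : ∀ {p q} → fromℚ p ≈ fromℚ q → p ≡ q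
fromℚ-injective e = ℚ.≤-antisym (fromℚ-cancel-≤ (≈⇒≤ e)) (fromℚ-cancel-≤ (≈⇒≥ e))

fromℚ-cong : ∀ {p q} → p ≡ q → fromℚ p ≈ fromℚ q
fromℚ-cong e = ≈-termwise λ _ → e

fromℚ-+ : ∀ p q → fromℚ (p ℚ.+ q) ≈ fromℚ p + fromℚ q
fromℚ-+ p q = ≈-termwise λ _ → refl

fromℚ-* : ∀ p q → fromℚ (p ℚ.* q) ≈ fromℚ p * fromℚ q
fromℚ-* p q = ≈-termwise λ _ → refl

fromℕ-suc : ∀ n → fromℕ (suc n) ≈ 1ℝ + fromℕ n
fromℕ-suc n = ≈-trans (fromℚ-cong (Q.ι-suc n)) (fromℚ-+ 1ℚ (Q.ι n))

fromℚ-mono-< : ∀ {p q} → p ℚ.< q → fromℚ p < fromℚ q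
fromℚ-mono-< {p} {q} h = mk< (q ℚ.- p)
  (subst (ℚ._< q ℚ.- p) (ℚ.+-inverseʳ p) (ℚ.+-monoˡ-< (ℚ.- p) h)) 0
  λ _ _ → ℚ.≤-reflexive (Q.add-minus q p)

0≤1 : 0ℝ ≤ 1ℝ
0≤1 = fromℚ-mono-≤ (ℚ.<⇒≤ Q.0<1)

0≤fromℕ : ∀ n → 0ℝ ≤ fromℕ n
0≤fromℕ n = fromℚ-mono-≤ (Q.ι-mono {0} {n} ℕ.z≤n)

<⇒gap : ∀ {x y} → x < y → ∃ λ g → 0ℚ ℚ.< g × x + fromℚ g ≤ y
<⇒gap {x} {y} (mk< g 0<g N h) = g , 0<g , mk≤ λ ε 0<ε → N , λ n p →
  ℚ.≤-trans (h n p) (Q.m≤+ˡ {seq y n} {ε} (ℚ.<⇒≤ 0<ε))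

<⇒≤ : ∀ {x y} → x < y → x ≤ y
<⇒≤ {x} {y} h = let g , 0<g , k = <⇒gap h in
  ≤-trans (≈⇒≥ (R.+-identityʳ x)) (≤-trans (+-mono-≤ (≤-refl {x}) (fromℚ-mono-≤ (ℚ.<⇒≤ 0<g))) k)

-- `_≤_` tolerates a small error at each index, while `_<_` asks for a termwise gap; half of g pays
-- for the error and the other half remains as the gap.
gap⇒< : ∀ {x y} g → 0ℚ ℚ.< g → x + fromℚ g ≤ y → x < y
gap⇒< {x} {y} g 0<g (mk≤ h) = let N , k = h (½ ℚ.* g) (0<½* {g} 0<g) in
  mk< (½ ℚ.* g) (0<½* {g} 0<g) N λ n p → ℚ.≤-trans
    (ℚ.≤-reflexive (shift (seq x n)))
    (ℚ.≤-trans (ℚ.+-monoˡ-≤ (ℚ.- (½ ℚ.* g)) (k n p)) (ℚ.≤-reflexive (cancel (seq y n) (½ ℚ.* g))))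
  where
  cancel : ∀ a b → a ℚ.+ b ℚ.- b ≡ a
  cancel = solve-∀ Q.ring
  shift : ∀ a → a ℚ.+ ½ ℚ.* g ≡ a ℚ.+ g ℚ.- ½ ℚ.* g
  shift a = ≡.trans (≡.sym (cancel (a ℚ.+ ½ ℚ.* g) (½ ℚ.* g)))
    (cong (ℚ._- ½ ℚ.* g) (≡.trans (ℚ.+-assoc a (½ ℚ.* g) (½ ℚ.* g)) (cong (a ℚ.+_) (Q.half+half g))))

<-≤-trans : ∀ {x y z} → x < y → y ≤ z → x < z
<-≤-trans h k = let g , 0<g , l = <⇒gap h in gap⇒< g 0<g (≤-trans l k)

≤-<-trans : ∀ {x y z} → x ≤ y → y < z → x < z
≤-<-trans h k = let g , 0<g , l = <⇒gap k in gap⇒< g 0<g (≤-trans (+-mono-≤ h ≤-refl) l)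

<-irrefl : ∀ {x} → ¬ x < x
<-irrefl {x} h = let g , 0<g , k = <⇒gap h in ℚ.<-irrefl refl (ℚ.<-≤-trans 0<g (fromℚ-cancel-≤ (≤-trans
  (≈⇒≤ (solve 2 (λ x g → g := :- x :+ (x :+ g)) ≈-refl x (fromℚ g)))
  (≤-trans (+-mono-≤ (≤-refl { - x}) k) (≈⇒≤ (R.-‿inverseˡ x))))))

≤⇒≯ : ∀ {x y} → x ≤ y → ¬ y < x
≤⇒≯ h k = <-irrefl (≤-<-trans h k)

ℚ-+-cancelʳ-≤ : ∀ r p q → p ℚ.+ r ℚ.≤ q ℚ.+ r → p ℚ.≤ q
ℚ-+-cancelʳ-≤ r p q h = subst₂ ℚ._≤_ (cancel p r) (cancel q r) (ℚ.+-monoˡ-≤ (ℚ.- r) h)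
  where
  cancel : ∀ a b → a ℚ.+ b ℚ.- b ≡ a
  cancel = solve-∀ Q.ring

-- The constructive substitute for trichotomy. With δ = (q - p) / 4, all terms of x from `N` on lie
-- within δ of term `N`, and that rational term is compared with the midpoint `m` of p and q; either
-- outcome leaves room for the error δ.
separate : ∀ x {p q} → p ℚ.< q → x ≤ fromℚ q ⊎ fromℚ p < x
separate x {p} {q} p<q with seq x N ℚ.≤? m
  module Separate where
  e = q ℚ.- p
  0<e : 0ℚ ℚ.< e
  0<e = subst (ℚ._< e) (ℚ.+-inverseʳ p) (ℚ.+-monoˡ-< (ℚ.- p) p<q)
  δ = ½ ℚ.* (½ ℚ.* e)
  0<δ : 0ℚ ℚ.< δ
  0<δ = 0<½* {½ ℚ.* e} (0<½* {e} 0<e)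
  m = p ℚ.+ (δ ℚ.+ δ)
  N = proj₁ (cauchy x δ 0<δ)
  near : ∀ n → N ℕ.≤ n → ℚ.∣ seq x n ℚ.- seq x N ∣ ℚ.≤ δ
  near n k = proj₂ (cauchy x δ 0<δ) n N k ℕ.≤-refl
  m+2δ : m ℚ.+ (δ ℚ.+ δ) ≡ q
  m+2δ = ≡.trans (ℚ.+-assoc p (δ ℚ.+ δ) (δ ℚ.+ δ)) (≡.trans
    (cong (p ℚ.+_) (≡.trans (cong₂ ℚ._+_ (Q.half+half (½ ℚ.* e)) (Q.half+half (½ ℚ.* e))) (Q.half+half e)))
    (Q.add-minus q p))
... | yes x≤m = inj₁ (mk≤ λ ε 0<ε → N , λ n k → ℚ.≤-trans (Q.p≤q+∣p-q∣ (seq x n) (seq x N))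
      (ℚ.≤-trans (ℚ.+-mono-≤ x≤m (ℚ.≤-trans (near n k) (Q.m≤+ˡ {δ} {δ} (ℚ.<⇒≤ 0<δ))))
      (ℚ.≤-trans (ℚ.≤-reflexive m+2δ) (Q.m≤+ˡ {q} {ε} (ℚ.<⇒≤ 0<ε)))))
      where open Separate x p<q
... | no x≰m = inj₂ (mk< δ 0<δ N λ n k → ℚ-+-cancelʳ-≤ δ (p ℚ.+ δ) (seq x n) (ℚ.≤-trans
      (ℚ.≤-reflexive (ℚ.+-assoc p δ δ)) (ℚ.≤-trans (ℚ.<⇒≤ (ℚ.≰⇒> x≰m))
      (ℚ.≤-trans (Q.p≤q+∣p-q∣ (seq x N) (seq x n))
        (ℚ.+-monoʳ-≤ (seq x n) (subst (ℚ._≤ δ) (Q.∣∣-swap (seq x n) (seq x N)) (near n k)))))))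
      where open Separate x p<q

≤-limit : ∀ {x y} → (∀ ε → 0ℚ ℚ.< ε → x ≤ y + fromℚ ε) → x ≤ y
≤-limit {x} {y} h = mk≤ λ ε 0<ε → eventually-map (λ n p → ℚ.≤-trans p (ℚ.≤-reflexive
    (≡.trans (ℚ.+-assoc (seq y n) (½ ℚ.* ε) (½ ℚ.* ε)) (cong (seq y n ℚ.+_) (Q.half+half ε)))))
  (_≤_.≤-eventually (h (½ ℚ.* ε) (0<½* {ε} 0<ε)) (½ ℚ.* ε) (0<½* {ε} 0<ε))

-- For every ε, `separate` either bounds x - y by ε or makes it positive, and the latter is
-- excluded.
≮⇒≥ : ∀ {x y} → ¬ y < x → x ≤ y
≮⇒≥ {x} {y} h = ≤-limit λ ε 0<ε → [ (λ k → ≤-trans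
    (≈⇒≤ (solve 2 (λ x y → x := y :+ (x :- y)) ≈-refl x y)) (+-mono-≤ (≤-refl {y}) k)) ,
  (λ k → contradiction (pos k) h) ]′ (separate (x - y) 0<ε)
  where
  pos : 0ℝ < x - y → y < x
  pos k = let g , 0<g , l = <⇒gap k in gap⇒< g 0<g (≤-trans (+-mono-≤ (≤-refl {y})
    (≤-trans (≈⇒≥ (R.+-identityˡ (fromℚ g))) l)) (≈⇒≤ (solve 2 (λ x y → y :+ (x :- y) := x) ≈-refl x y)))

⊔-lub : ∀ {x y z} → x ≤ z → y ≤ z → x ⊔ y ≤ z
⊔-lub {x} {y} {z} (mk≤ h) (mk≤ k) = mk≤ λ ε 0<ε → eventually-zip (λ n → ℚ.⊔-lub) (h ε 0<ε) (k ε 0<ε)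

x≤x⊔y : ∀ x y → x ≤ x ⊔ y
x≤x⊔y x y = ≤-termwise λ n → ℚ.p≤p⊔q (seq x n) (seq y n)

y≤x⊔y : ∀ x y → y ≤ x ⊔ y
y≤x⊔y x y = ≤-termwise λ n → ℚ.p≤q⊔p (seq x n) (seq y n)

⊓-glb : ∀ {x y z} → z ≤ x → z ≤ y → z ≤ x ⊓ y
⊓-glb {x} {y} {z} (mk≤ h) (mk≤ k) = mk≤ λ ε 0<ε → eventually-zip
  (λ n p q → subst (seq z n ℚ.≤_) (≡.sym (ℚ.mono-≤-distrib-⊓ (ℚ.+-monoˡ-≤ ε) (seq x n) (seq y n))) (ℚ.⊓-glb p q))
  (h ε 0<ε) (k ε 0<ε)

x≤∣x∣ : ∀ x → x ≤ ∣ x ∣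
x≤∣x∣ x = ≤-termwise λ n → Q.p≤∣p∣ (seq x n)

-x≤∣x∣ : ∀ x → - x ≤ ∣ x ∣
-x≤∣x∣ x = ≤-termwise λ n → Q.-p≤∣p∣ (seq x n)

0≤∣x∣ : ∀ x → 0ℝ ≤ ∣ x ∣
0≤∣x∣ x = ≤-termwise λ n → ℚ.0≤∣p∣ (seq x n)

∣∣-lub : ∀ {x b} → x ≤ b → - x ≤ b → ∣ x ∣ ≤ b
∣∣-lub {x} {b} (mk≤ h) (mk≤ k) = mk≤ λ ε 0<ε → eventually-zip
  (λ n → Q.∣∣-lub {seq x n} {seq b n ℚ.+ ε}) (h ε 0<ε) (k ε 0<ε)

∣∣-cong : ∀ {x y} → x ≈ y → ∣ x ∣ ≈ ∣ y ∣
∣∣-cong {x} {y} e = ≤-antisym (half e) (half (≈-sym e))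
  where
  half : ∀ {x y} → x ≈ y → ∣ x ∣ ≤ ∣ y ∣
  half {x} {y} e = ∣∣-lub (≤-trans (≈⇒≤ e) (x≤∣x∣ y)) (≤-trans (≈⇒≤ (neg-cong e)) (-x≤∣x∣ y))

∣x+y∣≤∣x∣+∣y∣ : ∀ x y → ∣ x + y ∣ ≤ ∣ x ∣ + ∣ y ∣
∣x+y∣≤∣x∣+∣y∣ x y = ≤-termwise λ n → ℚ.∣p+q∣≤∣p∣+∣q∣ (seq x n) (seq y n)

∣-x∣≈∣x∣ : ∀ x → ∣ - x ∣ ≈ ∣ x ∣
∣-x∣≈∣x∣ x = ≈-termwise λ n → ℚ.∣-p∣≡∣p∣ (seq x n)

∣x-y∣≈∣y-x∣ : ∀ x y → ∣ x - y ∣ ≈ ∣ y - x ∣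
∣x-y∣≈∣y-x∣ x y = ≈-termwise λ n → Q.∣∣-swap (seq x n) (seq y n)

-0≈0 : - 0ℝ ≈ 0ℝ
-0≈0 = ≈-termwise λ _ → refl

∣x-y∣≤0⇒x≈y : ∀ {x y} → ∣ x - y ∣ ≤ 0ℝ → x ≈ y
∣x-y∣≤0⇒x≈y {x} {y} h = ≤-antisym
  (subtract (≤-trans (x≤∣x∣ (x - y)) h))
  (subtract (≤-trans (x≤∣x∣ (y - x)) (≤-trans (≈⇒≤ (∣x-y∣≈∣y-x∣ y x)) h)))
  where
  subtract : ∀ {x y} → x - y ≤ 0ℝ → x ≤ y
  subtract {x} {y} k = ≤-trans (≈⇒≤ (solve 2 (λ x y → x := x :- y :+ y) ≈-refl x y))
    (≤-trans (+-mono-≤ k (≤-refl {y})) (≈⇒≤ (R.+-identityˡ y)))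

≈∣∣ : ∀ {x} → 0ℝ ≤ x → x ≈ ∣ x ∣
≈∣∣ {x} h = ≤-antisym (x≤∣x∣ x) (∣∣-lub ≤-refl (≤-trans (neg-mono-≤ h) (≤-trans (≈⇒≤ -0≈0) h)))

-- A nonnegative real may have negative terms, so both factors are first replaced by their absolute
-- values, whose terms are nonnegative.
*-nonNeg : ∀ {x y} → 0ℝ ≤ x → 0ℝ ≤ y → 0ℝ ≤ x * y
*-nonNeg {x} {y} h k = ≤-trans
  (≤-termwise {0ℝ} {∣ x ∣ * ∣ y ∣} λ n → Q.*-nonNeg {ℚ.∣ seq x n ∣} {ℚ.∣ seq y n ∣} (ℚ.0≤∣p∣ (seq x n)) (ℚ.0≤∣p∣ (seq y n)))
  (≈⇒≥ (*-cong (≈∣∣ h) (≈∣∣ k)))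

*-monoˡ-≤ : ∀ {x y} z → 0ℝ ≤ z → x ≤ y → z * x ≤ z * y
*-monoˡ-≤ {x} {y} z 0≤z h = 0≤y-x⇒x≤y (≤-trans (*-nonNeg 0≤z (x≤y⇒0≤y-x h))
  (≈⇒≤ (solve 3 (λ x y z → z :* (y :- x) := z :* y :- z :* x) ≈-refl x y z)))

*-monoʳ-≤ : ∀ {x y} z → 0ℝ ≤ z → x ≤ y → x * z ≤ y * z
*-monoʳ-≤ {x} {y} z 0≤z h = ≤-trans (≈⇒≤ (R.*-comm x z)) (≤-trans (*-monoˡ-≤ z 0≤z h) (≈⇒≤ (R.*-comm z y)))

*-mono-≤ : ∀ {x y u v} → 0ℝ ≤ x → 0ℝ ≤ v → x ≤ y → u ≤ v → x * u ≤ y * v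
*-mono-≤ {x} {y} {u} {v} 0≤x 0≤v h k = ≤-trans (*-monoˡ-≤ x 0≤x k) (*-monoʳ-≤ v 0≤v h)

*-pos : ∀ {x y} → 0ℝ < x → 0ℝ < y → 0ℝ < x * y
*-pos {x} {y} h k =
  let g , 0<g , p = <⇒gap h ; e , 0<e , q = <⇒gap k in
  gap⇒< (g ℚ.* e) (Q.*-pos {g} {e} 0<g 0<e) (≤-trans (≈⇒≤ (R.+-identityˡ (fromℚ (g ℚ.* e))))
    (≤-trans (≈⇒≤ (fromℚ-* g e)) (*-mono-≤ {fromℚ g} {x} {fromℚ e} {y} (fromℚ-mono-≤ (ℚ.<⇒≤ 0<g)) (<⇒≤ k)
      (≤-trans (≈⇒≥ (R.+-identityˡ (fromℚ g))) p) (≤-trans (≈⇒≥ (R.+-identityˡ (fromℚ e))) q))))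

0≤x*x : ∀ x → 0ℝ ≤ x * x
0≤x*x x = ≤-trans (*-nonNeg (0≤∣x∣ x) (0≤∣x∣ x)) (≤-termwise λ n → ℚ.≤-reflexive (square (seq x n)))
  where
  square : ∀ p → ℚ.∣ p ∣ ℚ.* ℚ.∣ p ∣ ≡ p ℚ.* p
  square p with ℚ.∣p∣≡p∨∣p∣≡-p p
  ... | inj₁ e = cong₂ ℚ._*_ e e
  ... | inj₂ e = ≡.trans (cong₂ ℚ._*_ e e) (neg² p)
    where
    neg² : ∀ p → (ℚ.- p) ℚ.* (ℚ.- p) ≡ p ℚ.* p
    neg² = solve-∀ Q.ring

-- Powers, geometric decay and finite maxima.

infixr 8 _^ᴿ_
_^ᴿ_ : ℝ → ℕ → ℝ
x ^ᴿ zero  = 1ℝ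
x ^ᴿ suc n = x * x ^ᴿ n

^ᴿ-nonNeg : ∀ {x} → 0ℝ ≤ x → ∀ n → 0ℝ ≤ x ^ᴿ n
^ᴿ-nonNeg h zero    = 0≤1
^ᴿ-nonNeg h (suc n) = *-nonNeg h (^ᴿ-nonNeg h n)

^ᴿ-mono-≤ : ∀ {x y} → 0ℝ ≤ x → x ≤ y → ∀ n → x ^ᴿ n ≤ y ^ᴿ n
^ᴿ-mono-≤ h k zero    = ≤-refl
^ᴿ-mono-≤ h k (suc n) = *-mono-≤ h (^ᴿ-nonNeg (≤-trans h k) n) k (^ᴿ-mono-≤ h k n)

^ᴿ-cong : ∀ {x y} → x ≈ y → ∀ n → x ^ᴿ n ≈ y ^ᴿ n
^ᴿ-cong e zero    = ≈-refl
^ᴿ-cong e (suc n) = *-cong e (^ᴿ-cong e n)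

x^n≤1 : ∀ {x} → 0ℝ ≤ x → x ≤ 1ℝ → ∀ n → x ^ᴿ n ≤ 1ℝ
x^n≤1 h k zero    = ≤-refl
x^n≤1 {x} h k (suc n) = ≤-trans (*-mono-≤ h 0≤1 k (x^n≤1 h k n)) (≈⇒≤ (R.*-identityˡ 1ℝ))

+-nonNeg : ∀ {x y} → 0ℝ ≤ x → 0ℝ ≤ y → 0ℝ ≤ x + y
+-nonNeg h k = ≤-trans (≈⇒≥ (R.+-identityˡ 0ℝ)) (+-mono-≤ h k)

-- Bernoulli's inequality for x ≤ 1 - g, free of division. The induction step holds because (1 + n
-- g) - x (1 + (n + 1) g) equals (1 - x - g) (1 + (n + 1) g) + (n + 1) g², a sum of nonnegative
-- terms.
bernoulli : ∀ {x g} → 0ℝ ≤ x → 0ℚ ℚ.≤ g → x + fromℚ g ≤ 1ℝ → ∀ n → x ^ᴿ n * (1ℝ + fromℕ n * fromℚ g) ≤ 1ℝ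
bernoulli {x} {g} 0≤x 0≤g h zero = ≤-termwise λ _ → ℚ.≤-reflexive
  (≡.trans (ℚ.*-identityˡ _) (≡.trans (cong (1ℚ ℚ.+_) (ℚ.*-zeroˡ g)) (ℚ.+-identityʳ 1ℚ)))
bernoulli {x} {g} 0≤x 0≤g h (suc n) = begin
  x * x ^ᴿ n * (1ℝ + fromℕ (suc n) * G)
    ≈⟨ *-cong (≈-refl {x * x ^ᴿ n}) (+-cong (≈-refl {1ℝ}) (*-cong (fromℕ-suc n) (≈-refl {G}))) ⟩
  x * x ^ᴿ n * (1ℝ + (1ℝ + fromℕ n) * G)
    ≤⟨ 0≤y-x⇒x≤y (≤-trans (*-nonNeg (^ᴿ-nonNeg 0≤x n) (+-nonNeg (*-nonNeg (x≤y⇒0≤y-x h) (+-nonNeg 0≤1 0≤[1+n]G)) (*-nonNeg 0≤[1+n]G 0≤G)))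
         (≈⇒≤ (identity x (x ^ᴿ n) (fromℕ n) G))) ⟩
  x ^ᴿ n * (1ℝ + fromℕ n * G)
    ≤⟨ bernoulli 0≤x 0≤g h n ⟩
  1ℝ ∎
  where
  open ≤-Reasoning
  G = fromℚ g
  0≤G = fromℚ-mono-≤ 0≤g
  0≤[1+n]G : 0ℝ ≤ (1ℝ + fromℕ n) * G
  0≤[1+n]G = *-nonNeg (+-nonNeg 0≤1 (0≤fromℕ n)) 0≤G
  identity : ∀ x p n g → p * ((1ℝ - (x + g)) * (1ℝ + (1ℝ + n) * g) + (1ℝ + n) * g * g)
    ≈ p * (1ℝ + n * g) - x * p * (1ℝ + (1ℝ + n) * g)
  identity = solve 4 (λ x p n g → p :* ((con 1ℚ :- (x :+ g)) :* (con 1ℚ :+ (con 1ℚ :+ n) :* g) :+ (con 1ℚ :+ n) :* g :* g)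
    := p :* (con 1ℚ :+ n :* g) :- x :* p :* (con 1ℚ :+ (con 1ℚ :+ n) :* g)) ≈-refl

-- By the Archimedean property B ≤ n g for large n, where g is a gap between x and 1; then
-- `bernoulli` applies.
pow-vanishes : ∀ {x} → 0ℝ ≤ x → x < 1ℝ → ∀ B → Eventually λ n → x ^ᴿ n * fromℚ B ≤ 1ℝ
pow-vanishes {x} 0≤x x<1 B = N , λ n N≤n → ≤-trans
  (*-monoˡ-≤ (x ^ᴿ n) (^ᴿ-nonNeg 0≤x n) (≤-trans (fromℚ-mono-≤ (B≤ n N≤n))
    (≤-termwise {fromℚ (Q.ι n ℚ.* g)} {1ℝ + fromℕ n * fromℚ g} λ _ → Q.m≤+ʳ {1ℚ} {Q.ι n ℚ.* g} (ℚ.<⇒≤ Q.0<1))))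
  (bernoulli 0≤x (ℚ.<⇒≤ 0<g) x+g≤1 n)
  where
  gap = <⇒gap x<1
  g = proj₁ gap
  0<g = proj₁ (proj₂ gap)
  x+g≤1 = proj₂ (proj₂ gap)
  instance
    _ = ℚ.positive 0<g
    _ = ℚ.pos⇒nonZero g
  N = proj₁ (Q.archimedean (B ℚ.* ℚ.1/ g))
  B≤ : ∀ n → N ℕ.≤ n → B ℚ.≤ Q.ι n ℚ.* g
  B≤ n N≤n = ℚ.≤-trans (ℚ.≤-reflexive (≡.sym (≡.trans (ℚ.*-assoc B (ℚ.1/ g) g)
      (≡.trans (cong (B ℚ.*_) (ℚ.*-inverseˡ g)) (ℚ.*-identityʳ B)))))
    (Q.*-monoʳ {B ℚ.* ℚ.1/ g} {Q.ι n} g (ℚ.<⇒≤ 0<g)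
      (ℚ.≤-trans (proj₂ (Q.archimedean (B ℚ.* ℚ.1/ g))) (Q.ι-mono N≤n)))

⨆-lub : ∀ {n} (v : Vector ℝ n) {b} → 0ℝ ≤ b → (∀ i → v i ≤ b) → foldr _⊔_ 0ℝ v ≤ b
⨆-lub {zero}  v 0≤b h = 0≤b
⨆-lub {suc n} v 0≤b h = ⊔-lub (h zero) (⨆-lub (v ∘ suc) 0≤b (h ∘ suc))

≤⨆ : ∀ {n} (v : Vector ℝ n) i → v i ≤ foldr _⊔_ 0ℝ v
≤⨆ v zero    = x≤x⊔y (v zero) _
≤⨆ v (suc i) = ≤-trans (≤⨆ (v ∘ suc) i) (y≤x⊔y (v zero) _)

-- A strict inequality carries a rational gap, and the smaller of two gaps serves both entries. This
-- makes the largest rate strictly less than 1.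
⨆-< : ∀ {n} (v : Vector ℝ n) {b} → 0ℝ < b → (∀ i → v i < b) → foldr _⊔_ 0ℝ v < b
⨆-< {zero}  v 0<b h = 0<b
⨆-< {suc n} v {b} 0<b h = ⊔-< (h zero) (⨆-< (v ∘ suc) 0<b (h ∘ suc))
  where
  ⊔-< : ∀ {x y} → x < b → y < b → x ⊔ y < b
  ⊔-< {x} {y} p q =
    let g , 0<g , k = <⇒gap p ; e , 0<e , l = <⇒gap q ; m , 0<m , m≤g , m≤e = smaller 0<g 0<e in
    gap⇒< m 0<m (≤-trans (+-mono-≤ (⊔-lub (below k m≤g) (below l m≤e)) (≤-refl {fromℚ m}))
      (≈⇒≤ (solve 2 (λ b m → b :- m :+ m := b) ≈-refl b (fromℚ m))))
    where
    smaller : ∀ {g e} → 0ℚ ℚ.< g → 0ℚ ℚ.< e → ∃ λ m → 0ℚ ℚ.< m × m ℚ.≤ g × m ℚ.≤ e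
    smaller {g} {e} 0<g 0<e = [ (λ g≤e → g , 0<g , ℚ.≤-refl , g≤e) , (λ e≤g → e , 0<e , e≤g , ℚ.≤-refl) ]′ (ℚ.≤-total g e)
    below : ∀ {z g m} → z + fromℚ g ≤ b → m ℚ.≤ g → z ≤ b - fromℚ m
    below {z} {g} {m} k m≤g = ≤-trans (≈⇒≤ (solve 2 (λ z m → z := z :+ m :- m) ≈-refl z (fromℚ m)))
      (+-mono-≤ (≤-trans (+-mono-≤ (≤-refl {z}) (fromℚ-mono-≤ m≤g)) k) (≤-refl { - fromℚ m}))

*-cancel-≤0 : ∀ {x g} → 0ℚ ℚ.< g → x * fromℚ g ≤ 0ℝ → x ≤ 0ℝ
*-cancel-≤0 {x} {g} 0<g h = begin
  x                             ≈⟨ ≈-sym (R.*-identityʳ x) ⟩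
  x * 1ℝ                        ≈⟨ *-cong (≈-refl {x}) (≈-trans (fromℚ-cong (≡.sym (ℚ.*-inverseʳ g))) (fromℚ-* g (ℚ.1/ g))) ⟩
  x * (fromℚ g * fromℚ (ℚ.1/ g)) ≈⟨ ≈-sym (R.*-assoc x (fromℚ g) (fromℚ (ℚ.1/ g))) ⟩
  x * fromℚ g * fromℚ (ℚ.1/ g)  ≤⟨ *-monoʳ-≤ (fromℚ (ℚ.1/ g)) (fromℚ-mono-≤ (ℚ.<⇒≤ (ℚ.positive⁻¹ _ {{ℚ.1/pos⇒pos g}}))) h ⟩
  0ℝ * fromℚ (ℚ.1/ g)           ≈⟨ R.zeroˡ (fromℚ (ℚ.1/ g)) ⟩
  0ℝ                            ∎
  where
  open ≤-Reasoning
  instance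
    _ = ℚ.positive 0<g
    _ = ℚ.pos⇒nonZero g

bounded-above : ∀ x → ∃ λ n → x ≤ fromℕ n
bounded-above x =
  let N , B , 0<B , h = Q.cauchy-bounded {seq x} (cauchy x) ; n , B≤n = Q.archimedean B in
  n , mk≤ λ ε 0<ε → N , λ k N≤k → ℚ.≤-trans (Q.p≤∣p∣ (seq x k)) (ℚ.≤-trans (h k N≤k)
    (ℚ.≤-trans B≤n (Q.m≤+ˡ {Q.ι n} {ε} (ℚ.<⇒≤ 0<ε))))

≈-limit : ∀ {x y} → (∀ ε → 0ℚ ℚ.< ε → ∣ x - y ∣ ≤ fromℚ ε) → x ≈ y
≈-limit h = ∣x-y∣≤0⇒x≈y (≤-limit λ ε 0<ε → ≤-trans (h ε 0<ε) (≈⇒≥ (R.+-identityˡ (fromℚ ε))))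

pow-small : ∀ {x} → 0ℝ ≤ x → x < 1ℝ → ∀ B ε → 0ℚ ℚ.< ε → Eventually λ n → x ^ᴿ n * fromℚ B ≤ fromℚ ε
pow-small {x} 0≤x x<1 B ε 0<ε = eventually-map
  (λ n h → ≤-trans (≈⇒≤ (rescale (x ^ᴿ n))) (≤-trans (*-monoʳ-≤ (fromℚ ε) (fromℚ-mono-≤ (ℚ.<⇒≤ 0<ε)) h) (≈⇒≤ (R.*-identityˡ (fromℚ ε)))))
  (pow-vanishes 0≤x x<1 (B ℚ.* ℚ.1/ ε))
  where
  instance
    _ = ℚ.positive 0<ε
    _ = ℚ.pos⇒nonZero ε
  rescale : ∀ y → y * fromℚ B ≈ y * fromℚ (B ℚ.* ℚ.1/ ε) * fromℚ ε
  rescale y = ≈-trans (*-cong (≈-refl {y}) (≈-trans (fromℚ-cong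
      (≡.sym (≡.trans (ℚ.*-assoc B (ℚ.1/ ε) ε) (≡.trans (cong (B ℚ.*_) (ℚ.*-inverseˡ ε)) (ℚ.*-identityʳ B)))))
      (fromℚ-* (B ℚ.* ℚ.1/ ε) ε)))
    (≈-sym (R.*-assoc y (fromℚ (B ℚ.* ℚ.1/ ε)) (fromℚ ε)))

-- The exponential function through Cauchy products.

conv : (ℕ → ℚ) → (ℕ → ℚ) → ℕ → ℚ
conv f g zero    = f 0 ℚ.* g 0
conv f g (suc n) = f 0 ℚ.* g (suc n) ℚ.+ conv (f ∘ suc) g n

-- Partial sums that recurse at index 0, in step with `conv`, so that both peel off the same term.
frontSum : (ℕ → ℚ) → ℕ → ℚ
frontSum f zero    = f 0
frontSum f (suc n) = f 0 ℚ.+ frontSum (f ∘ suc) n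

∂ : (ℕ → ℚ) → ℕ → ℚ
∂ f k = Q.ι (suc k) ℚ.* f (suc k)

conv-cong : ∀ {f f′ g g′} → (∀ k → f k ≡ f′ k) → (∀ k → g k ≡ g′ k) → ∀ n → conv f g n ≡ conv f′ g′ n
conv-cong p q zero    = cong₂ ℚ._*_ (p 0) (q 0)
conv-cong p q (suc n) = cong₂ ℚ._+_ (cong₂ ℚ._*_ (p 0) (q (suc n))) (conv-cong (p ∘ suc) q n)

conv-+ˡ : ∀ f f′ g n → conv (λ k → f k ℚ.+ f′ k) g n ≡ conv f g n ℚ.+ conv f′ g n
conv-+ˡ f f′ g zero    = ℚ.*-distribʳ-+ (g 0) (f 0) (f′ 0)
conv-+ˡ f f′ g (suc n) = ≡.trans (cong ((f 0 ℚ.+ f′ 0) ℚ.* g (suc n) ℚ.+_) (conv-+ˡ (f ∘ suc) (f′ ∘ suc) g n))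
  (shuffle (f 0) (f′ 0) (g (suc n)) (conv (f ∘ suc) g n) (conv (f′ ∘ suc) g n))
  where
  shuffle : ∀ a b c d e → (a ℚ.+ b) ℚ.* c ℚ.+ (d ℚ.+ e) ≡ (a ℚ.* c ℚ.+ d) ℚ.+ (b ℚ.* c ℚ.+ e)
  shuffle = solve-∀ Q.ring

conv-*ˡ : ∀ a f g n → conv (λ k → a ℚ.* f k) g n ≡ a ℚ.* conv f g n
conv-*ˡ a f g zero    = ℚ.*-assoc a (f 0) (g 0)
conv-*ˡ a f g (suc n) = ≡.trans (cong (a ℚ.* f 0 ℚ.* g (suc n) ℚ.+_) (conv-*ˡ a (f ∘ suc) g n))
  (shuffle a (f 0) (g (suc n)) (conv (f ∘ suc) g n))
  where
  shuffle : ∀ a b c d → a ℚ.* b ℚ.* c ℚ.+ a ℚ.* d ≡ a ℚ.* (b ℚ.* c ℚ.+ d)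
  shuffle = solve-∀ Q.ring

conv-*ʳ : ∀ a f g n → conv f (λ k → a ℚ.* g k) n ≡ a ℚ.* conv f g n
conv-*ʳ a f g zero    = swap a (f 0) (g 0)
  where
  swap : ∀ a b c → b ℚ.* (a ℚ.* c) ≡ a ℚ.* (b ℚ.* c)
  swap = solve-∀ Q.ring
conv-*ʳ a f g (suc n) = ≡.trans (cong (f 0 ℚ.* (a ℚ.* g (suc n)) ℚ.+_) (conv-*ʳ a (f ∘ suc) g n))
  (shuffle a (f 0) (g (suc n)) (conv (f ∘ suc) g n))
  where
  shuffle : ∀ a b c d → b ℚ.* (a ℚ.* c) ℚ.+ a ℚ.* d ≡ a ℚ.* (b ℚ.* c ℚ.+ d)
  shuffle = solve-∀ Q.ring

-- `conv` is the Cauchy product and `∂` the formal derivative of a power series given by its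
-- coefficients; this is the product rule in degree n. In the induction the shift `f ∘ suc` lowers
-- each index factor by one, and `∂-suc` restores it.
leibniz : ∀ f g n → Q.ι (suc n) ℚ.* conv f g (suc n) ≡ conv (∂ f) g n ℚ.+ conv f (∂ g) n
leibniz f g zero = shuffle (f 0) (f 1) (g 0) (g 1)
  where
  shuffle : ∀ a b c d → 1ℚ ℚ.* (a ℚ.* d ℚ.+ b ℚ.* c) ≡ 1ℚ ℚ.* b ℚ.* c ℚ.+ a ℚ.* (1ℚ ℚ.* d)
  shuffle = solve-∀ Q.ring
leibniz f g (suc m) = begin
  i ℚ.* (f 0 ℚ.* g (2 ℕ.+ m) ℚ.+ conv (f ∘ suc) g (suc m))
    ≡⟨ distribute i (f 0) (g (2 ℕ.+ m)) (conv (f ∘ suc) g (suc m)) ⟩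
  f 0 ℚ.* ∂ g (suc m) ℚ.+ i ℚ.* conv (f ∘ suc) g (suc m)
    ≡⟨ cong (λ z → f 0 ℚ.* ∂ g (suc m) ℚ.+ z ℚ.* conv (f ∘ suc) g (suc m)) (Q.ι-suc (suc m)) ⟩
  f 0 ℚ.* ∂ g (suc m) ℚ.+ (1ℚ ℚ.+ Q.ι (suc m)) ℚ.* conv (f ∘ suc) g (suc m)
    ≡⟨ split-one (f 0 ℚ.* ∂ g (suc m)) (Q.ι (suc m)) (conv (f ∘ suc) g (suc m)) ⟩
  f 0 ℚ.* ∂ g (suc m) ℚ.+ (conv (f ∘ suc) g (suc m) ℚ.+ Q.ι (suc m) ℚ.* conv (f ∘ suc) g (suc m))
    ≡⟨ cong (λ z → f 0 ℚ.* ∂ g (suc m) ℚ.+ (conv (f ∘ suc) g (suc m) ℚ.+ z)) (leibniz (f ∘ suc) g m) ⟩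
  f 0 ℚ.* ∂ g (suc m) ℚ.+ ((f 1 ℚ.* g (suc m) ℚ.+ conv (f ∘ (2 ℕ.+_)) g m) ℚ.+ (conv (∂ (f ∘ suc)) g m ℚ.+ conv (f ∘ suc) (∂ g) m))
    ≡⟨ collect (f 0 ℚ.* ∂ g (suc m)) (f 1) (g (suc m)) (conv (f ∘ (2 ℕ.+_)) g m) (conv (∂ (f ∘ suc)) g m) (conv (f ∘ suc) (∂ g) m) ⟩
  (∂ f 0 ℚ.* g (suc m) ℚ.+ (conv (f ∘ (2 ℕ.+_)) g m ℚ.+ conv (∂ (f ∘ suc)) g m)) ℚ.+ (f 0 ℚ.* ∂ g (suc m) ℚ.+ conv (f ∘ suc) (∂ g) m)
    ≡⟨ cong (λ z → (∂ f 0 ℚ.* g (suc m) ℚ.+ z) ℚ.+ (f 0 ℚ.* ∂ g (suc m) ℚ.+ conv (f ∘ suc) (∂ g) m))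
         (≡.trans (≡.sym (conv-+ˡ (f ∘ (2 ℕ.+_)) (∂ (f ∘ suc)) g m)) (conv-cong ∂-suc (λ _ → refl) m)) ⟩
  (∂ f 0 ℚ.* g (suc m) ℚ.+ conv (∂ f ∘ suc) g m) ℚ.+ (f 0 ℚ.* ∂ g (suc m) ℚ.+ conv (f ∘ suc) (∂ g) m) ∎
  where
  open ≡.≡-Reasoning
  i = Q.ι (2 ℕ.+ m)
  distribute : ∀ i a b c → i ℚ.* (a ℚ.* b ℚ.+ c) ≡ a ℚ.* (i ℚ.* b) ℚ.+ i ℚ.* c
  distribute = solve-∀ Q.ring
  split-one : ∀ a i c → a ℚ.+ (1ℚ ℚ.+ i) ℚ.* c ≡ a ℚ.+ (c ℚ.+ i ℚ.* c)
  split-one = solve-∀ Q.ring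
  collect : ∀ u a b p q r → u ℚ.+ ((a ℚ.* b ℚ.+ p) ℚ.+ (q ℚ.+ r)) ≡ (1ℚ ℚ.* a ℚ.* b ℚ.+ (p ℚ.+ q)) ℚ.+ (u ℚ.+ r)
  collect = solve-∀ Q.ring
  ∂-suc : ∀ k → f (2 ℕ.+ k) ℚ.+ ∂ (f ∘ suc) k ≡ ∂ f (suc k)
  ∂-suc k = ≡.trans (merge (Q.ι (suc k)) (f (2 ℕ.+ k))) (cong (ℚ._* f (2 ℕ.+ k)) (≡.sym (Q.ι-suc (suc k))))
    where
    merge : ∀ i a → a ℚ.+ i ℚ.* a ≡ (1ℚ ℚ.+ i) ℚ.* a
    merge = solve-∀ Q.ring

∂-expTerm : ∀ x k → ∂ (expTerm x) k ≡ x ℚ.* expTerm x k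
∂-expTerm x k = ≡.trans (shuffle (Q.ι (suc k)) (expTerm x k) x (Q.c k)) (≡.trans
  (cong (ℚ._* (x ℚ.* expTerm x k)) (Q.ι*c k)) (ℚ.*-identityˡ (x ℚ.* expTerm x k)))
  where
  shuffle : ∀ i t x c → i ℚ.* (t ℚ.* (x ℚ.* c)) ≡ i ℚ.* c ℚ.* (x ℚ.* t)
  shuffle = solve-∀ Q.ring

ι-cancelˡ : ∀ n {p q} → Q.ι (suc n) ℚ.* p ≡ Q.ι (suc n) ℚ.* q → p ≡ q
ι-cancelˡ n {p} {q} e = ≡.trans (≡.sym (undo p)) (≡.trans (cong (Q.c n ℚ.*_) e) (undo q))
  where
  undo : ∀ r → Q.c n ℚ.* (Q.ι (suc n) ℚ.* r) ≡ r
  undo r = ≡.trans (≡.sym (ℚ.*-assoc (Q.c n) (Q.ι (suc n)) r))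
    (≡.trans (cong (ℚ._* r) (≡.trans (ℚ.*-comm (Q.c n) (Q.ι (suc n))) (Q.ι*c n))) (ℚ.*-identityˡ r))

-- The binomial theorem without binomial coefficients: by the product rule both sides satisfy the
-- recursion (n + 1) t (n + 1) = (x + y) t n.
expTerm-+ : ∀ x y n → conv (expTerm x) (expTerm y) n ≡ expTerm (x ℚ.+ y) n
expTerm-+ x y zero    = refl
expTerm-+ x y (suc n) = ι-cancelˡ n (begin
  Q.ι (suc n) ℚ.* conv s t (suc n)
    ≡⟨ leibniz s t n ⟩
  conv (∂ s) t n ℚ.+ conv s (∂ t) n
    ≡⟨ cong₂ ℚ._+_ (≡.trans (conv-cong (∂-expTerm x) (λ _ → refl) n) (conv-*ˡ x s t n))
                   (≡.trans (conv-cong (λ _ → refl) (∂-expTerm y) n) (conv-*ʳ y s t n)) ⟩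
  x ℚ.* conv s t n ℚ.+ y ℚ.* conv s t n
    ≡⟨ ≡.sym (ℚ.*-distribʳ-+ (conv s t n) x y) ⟩
  (x ℚ.+ y) ℚ.* conv s t n
    ≡⟨ cong ((x ℚ.+ y) ℚ.*_) (expTerm-+ x y n) ⟩
  (x ℚ.+ y) ℚ.* expTerm (x ℚ.+ y) n
    ≡⟨ ≡.sym (∂-expTerm (x ℚ.+ y) n) ⟩
  Q.ι (suc n) ℚ.* expTerm (x ℚ.+ y) (suc n) ∎)
  where
  open ≡.≡-Reasoning
  s = expTerm x
  t = expTerm y

conv-expSum : ∀ f y n → conv f (expSum y) (suc n) ≡ conv f (expSum y) n ℚ.+ conv f (expTerm y) (suc n)
conv-expSum f y zero = shuffle (f 0) (f 1) (expTerm y 1)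
  where
  shuffle : ∀ a b t → a ℚ.* (1ℚ ℚ.+ t) ℚ.+ b ℚ.* 1ℚ ≡ a ℚ.* 1ℚ ℚ.+ (a ℚ.* t ℚ.+ b ℚ.* 1ℚ)
  shuffle = solve-∀ Q.ring
conv-expSum f y (suc n) = ≡.trans
  (cong (f 0 ℚ.* (expSum y (suc n) ℚ.+ expTerm y (2 ℕ.+ n)) ℚ.+_) (conv-expSum (f ∘ suc) y n))
  (shuffle (f 0) (expSum y (suc n)) (expTerm y (2 ℕ.+ n)) (conv (f ∘ suc) (expSum y) n) (conv (f ∘ suc) (expTerm y) (suc n)))
  where
  shuffle : ∀ a s t p q → a ℚ.* (s ℚ.+ t) ℚ.+ (p ℚ.+ q) ≡ (a ℚ.* s ℚ.+ p) ℚ.+ (a ℚ.* t ℚ.+ q)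
  shuffle = solve-∀ Q.ring

-- Multiplying the k-th term for x by the partial sum of order n - k for y collects the triangle of
-- all index pairs with sum at most n, whose diagonals are the terms for x + y.
expSum-+ : ∀ x y n → conv (expTerm x) (expSum y) n ≡ expSum (x ℚ.+ y) n
expSum-+ x y zero    = refl
expSum-+ x y (suc n) = ≡.trans (conv-expSum (expTerm x) y n) (cong₂ ℚ._+_ (expSum-+ x y n) (expTerm-+ x y (suc n)))

frontSum-suc : ∀ f n → frontSum f (suc n) ≡ frontSum f n ℚ.+ f (suc n)
frontSum-suc f zero    = refl
frontSum-suc f (suc n) = ≡.trans (cong (f 0 ℚ.+_) (frontSum-suc (f ∘ suc) n)) (≡.sym (ℚ.+-assoc (f 0) (frontSum (f ∘ suc) n) (f (2 ℕ.+ n))))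

frontSum-expTerm : ∀ x n → frontSum (expTerm x) n ≡ expSum x n
frontSum-expTerm x zero    = refl
frontSum-expTerm x (suc n) = ≡.trans (frontSum-suc (expTerm x) n) (cong (ℚ._+ expTerm x (suc n)) (frontSum-expTerm x n))

conv-nonNeg : ∀ {f g} → (∀ k → 0ℚ ℚ.≤ f k) → (∀ k → 0ℚ ℚ.≤ g k) → ∀ n → 0ℚ ℚ.≤ conv f g n
conv-nonNeg {f} {g} p q zero    = Q.*-nonNeg {f 0} {g 0} (p 0) (q 0)
conv-nonNeg {f} {g} p q (suc n) = Q.+-nonNeg {f 0 ℚ.* g (suc n)} {conv (f ∘ suc) g n}
  (Q.*-nonNeg {f 0} {g (suc n)} (p 0) (q (suc n))) (conv-nonNeg {f ∘ suc} {g} (p ∘ suc) q n)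

module _ {g G : ℕ → ℚ} (G-bound : ∀ i n → ℚ.∣ g (i ℕ.+ n) ℚ.- g n ∣ ℚ.≤ G (i ℕ.+ n) ℚ.- G n) where

  private
    term : ∀ {a A} → ℚ.∣ a ∣ ℚ.≤ A → ∀ i n →
      ℚ.∣ a ℚ.* (g (i ℕ.+ n) ℚ.- g n) ∣ ℚ.≤ A ℚ.* (G (i ℕ.+ n) ℚ.- G n)
    term {a} {A} h i n = ℚ.≤-trans (ℚ.≤-reflexive (ℚ.∣p*q∣≡∣p∣*∣q∣ a (g (i ℕ.+ n) ℚ.- g n)))
      (Q.*-mono {ℚ.∣ a ∣} {A} {ℚ.∣ g (i ℕ.+ n) ℚ.- g n ∣} {G (i ℕ.+ n) ℚ.- G n}
        (ℚ.≤-trans (ℚ.0≤∣p∣ a) h) (ℚ.0≤∣p∣ (g (i ℕ.+ n) ℚ.- g n)) h (G-bound i n))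

    factor-out : ∀ a b c → a ℚ.* b ℚ.- a ℚ.* c ≡ a ℚ.* (b ℚ.- c)
    factor-out = solve-∀ Q.ring

    peel : ∀ a s b c d → (a ℚ.+ s) ℚ.* b ℚ.- (a ℚ.* c ℚ.+ d) ≡ a ℚ.* (b ℚ.- c) ℚ.+ (s ℚ.* b ℚ.- d)
    peel = solve-∀ Q.ring

  -- The left side is the sum of f k (g (i + n) - g (n - k)) over k ≤ n, and each summand is
  -- majorized by the one for `F` and `G`. The offset i is there because peeling a term lowers n
  -- while the top index i + n stays fixed.
  conv-error : ∀ {f F} → (∀ k → ℚ.∣ f k ∣ ℚ.≤ F k) → ∀ n i →
    ℚ.∣ frontSum f n ℚ.* g (i ℕ.+ n) ℚ.- conv f g n ∣ ℚ.≤ frontSum F n ℚ.* G (i ℕ.+ n) ℚ.- conv F G n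
  conv-error {f} {F} h zero i = subst₂ (λ p q → ℚ.∣ p ∣ ℚ.≤ q)
    (≡.sym (factor-out (f 0) (g (i ℕ.+ 0)) (g 0))) (≡.sym (factor-out (F 0) (G (i ℕ.+ 0)) (G 0))) (term {f 0} {F 0} (h 0) i 0)
  conv-error {f} {F} h (suc n) i = subst₂ (λ p q → ℚ.∣ p ∣ ℚ.≤ q)
    (≡.sym (peel (f 0) (frontSum (f ∘ suc) n) (g (i ℕ.+ suc n)) (g (suc n)) (conv (f ∘ suc) g n)))
    (≡.sym (peel (F 0) (frontSum (F ∘ suc) n) (G (i ℕ.+ suc n)) (G (suc n)) (conv (F ∘ suc) G n)))
    (ℚ.≤-trans (ℚ.∣p+q∣≤∣p∣+∣q∣ (f 0 ℚ.* (g (i ℕ.+ suc n) ℚ.- g (suc n))) (frontSum (f ∘ suc) n ℚ.* g (i ℕ.+ suc n) ℚ.- conv (f ∘ suc) g n))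
      (ℚ.+-mono-≤ (term {f 0} {F 0} (h 0) i (suc n))
        (subst (λ m → ℚ.∣ frontSum (f ∘ suc) n ℚ.* g m ℚ.- conv (f ∘ suc) g n ∣ ℚ.≤ frontSum (F ∘ suc) n ℚ.* G m ℚ.- conv (F ∘ suc) G n)
          (≡.sym (ℕ.+-suc i n)) (conv-error {f ∘ suc} {F ∘ suc} (h ∘ suc) n (suc i)))))

-- For k ≤ n the index n + m - k is at least m, so monotonicity bounds f k times g m by a summand of
-- the Cauchy product; the summands left over are nonnegative.
frontSum*≤conv : ∀ {f g} → (∀ k → 0ℚ ℚ.≤ f k) → (∀ k → 0ℚ ℚ.≤ g k) → (∀ i n → g n ℚ.≤ g (i ℕ.+ n)) →
  ∀ n m → frontSum f n ℚ.* g m ℚ.≤ conv f g (n ℕ.+ m)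
frontSum*≤conv {f} {g} p q mono zero zero    = ℚ.≤-refl
frontSum*≤conv {f} {g} p q mono zero (suc m) = Q.m≤+ˡ {f 0 ℚ.* g (suc m)} {conv (f ∘ suc) g m} (conv-nonNeg {f ∘ suc} {g} (p ∘ suc) q m)
frontSum*≤conv {f} {g} p q mono (suc n) m = ℚ.≤-trans
  (ℚ.≤-reflexive (ℚ.*-distribʳ-+ (g m) (f 0) (frontSum (f ∘ suc) n)))
  (ℚ.+-mono-≤ (Q.*-monoˡ {g m} {g (suc n ℕ.+ m)} (f 0) (p 0) (mono (suc n) m)) (frontSum*≤conv {f ∘ suc} {g} (p ∘ suc) q mono n m))

expSum-nonNeg : ∀ {B} → 0ℚ ℚ.≤ B → ∀ k → 0ℚ ℚ.≤ expSum B k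
expSum-nonNeg {B} 0≤B zero    = ℚ.<⇒≤ Q.0<1
expSum-nonNeg {B} 0≤B (suc k) = Q.+-nonNeg {expSum B k} {expTerm B (suc k)} (expSum-nonNeg 0≤B k) (Q.expTerm-nonNeg 0≤B (suc k))

-- The product of the partial sums runs over a square of index pairs, the partial sum for x + y over
-- the triangle inside it. With x and y replaced by B, the square lies in the triangle of order 2n,
-- so the error is at most the part of the series for 2B between n and 2n.
expSum-+-error : ∀ {B x y} → ℚ.∣ x ∣ ℚ.≤ B → ℚ.∣ y ∣ ℚ.≤ B → ∀ n →
  ℚ.∣ expSum (x ℚ.+ y) n ℚ.- expSum x n ℚ.* expSum y n ∣ ℚ.≤ expSum (B ℚ.+ B) (n ℕ.+ n) ℚ.- expSum (B ℚ.+ B) n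
expSum-+-error {B} {x} {y} hx hy n = begin
  ℚ.∣ expSum (x ℚ.+ y) n ℚ.- expSum x n ℚ.* expSum y n ∣
    ≡⟨ Q.∣∣-swap (expSum (x ℚ.+ y) n) (expSum x n ℚ.* expSum y n) ⟩
  ℚ.∣ expSum x n ℚ.* expSum y n ℚ.- expSum (x ℚ.+ y) n ∣
    ≡⟨ ≡.sym (cong₂ (λ p q → ℚ.∣ p ℚ.* expSum y n ℚ.- q ∣) (frontSum-expTerm x n) (expSum-+ x y n)) ⟩
  ℚ.∣ frontSum (expTerm x) n ℚ.* expSum y n ℚ.- conv (expTerm x) (expSum y) n ∣
    ≤⟨ conv-error {expSum y} {expSum B} (Q.expSum-tail {B} {y} hy) {expTerm x} {expTerm B} (Q.∣expTerm∣ {B} {x} hx) n 0 ⟩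
  frontSum (expTerm B) n ℚ.* expSum B n ℚ.- conv (expTerm B) (expSum B) n
    ≤⟨ ℚ.+-monoˡ-≤ (ℚ.- conv (expTerm B) (expSum B) n)
         (frontSum*≤conv {expTerm B} {expSum B} (Q.expTerm-nonNeg 0≤B) (expSum-nonNeg 0≤B) (Q.expSum-mono 0≤B) n n) ⟩
  conv (expTerm B) (expSum B) (n ℕ.+ n) ℚ.- conv (expTerm B) (expSum B) n
    ≡⟨ cong₂ ℚ._-_ (expSum-+ B B (n ℕ.+ n)) (expSum-+ B B n) ⟩
  expSum (B ℚ.+ B) (n ℕ.+ n) ℚ.- expSum (B ℚ.+ B) n ∎
  where
  open ℚ.≤-Reasoning
  0≤B = ℚ.≤-trans (ℚ.0≤∣p∣ x) hx

module _ (x y : ℝ) where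
  private
    bx = Q.cauchy-bounded {seq x} (cauchy x)
    by = Q.cauchy-bounded {seq y} (cauchy y)

  common-bound : ∃ λ B → 0ℚ ℚ.≤ B × Eventually λ n → ℚ.∣ seq x n ∣ ℚ.≤ B × ℚ.∣ seq y n ∣ ℚ.≤ B
  common-bound =
    let N₁ , A , 0<A , hA = bx ; N₂ , B , 0<B , hB = by in
    A ℚ.+ B , Q.+-nonNeg {A} {B} (ℚ.<⇒≤ 0<A) (ℚ.<⇒≤ 0<B) , eventually-zip
      (λ n p q → ℚ.≤-trans p (Q.m≤+ˡ {A} {B} (ℚ.<⇒≤ 0<B)) , ℚ.≤-trans q (Q.m≤+ʳ {A} {B} (ℚ.<⇒≤ 0<A))) (N₁ , hA) (N₂ , hB)

  exp-+ : exp (x + y) ≈ exp x * exp y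
  exp-+ = let B , 0≤B , h = common-bound in mk≈ λ ε 0<ε →
    let N , k = Q.expSum-cauchy {B ℚ.+ B} (Q.+-nonNeg {B} {B} 0≤B 0≤B) ε 0<ε in
    eventually-zip (λ n (p , q) r → ℚ.≤-trans (expSum-+-error {B} {seq x n} {seq y n} p q n)
        (ℚ.≤-trans (Q.p≤∣p∣ (expSum (B ℚ.+ B) (n ℕ.+ n) ℚ.- expSum (B ℚ.+ B) n)) r))
      h (N , λ n N≤n → k (n ℕ.+ n) n (ℕ.≤-trans N≤n (ℕ.m≤m+n n n)) N≤n)

exp-cong : ∀ {x y} → x ≈ y → exp x ≈ exp y
exp-cong {x} {y} e =
  let B , 0≤B , h = common-bound x y
      N , M , 0<M , k = Q.cauchy-bounded {expSum B} (Q.expSum-cauchy {B} 0≤B) in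
  mk≈ λ ε 0<ε → eventually-zip (λ n ((p , q) , r) s → ℚ.≤-trans (Q.expSum-lipschitz {B} {seq x n} {seq y n} p q n)
      (ℚ.≤-trans (Q.*-monoʳ {expSum B n} {M} ℚ.∣ seq x n ℚ.- seq y n ∣ (ℚ.0≤∣p∣ (seq x n ℚ.- seq y n))
        (ℚ.≤-trans (Q.p≤∣p∣ (expSum B n)) r)) s))
    (eventually-zip (λ _ → _,_) h (N , k)) (≈-scale M 0<M e ε 0<ε)

exp-0 : exp 0ℝ ≈ 1ℝ
exp-0 = ≈-termwise sum
  where
  term : ∀ k → expTerm 0ℚ (suc k) ≡ 0ℚ
  term k = ≡.trans (cong (expTerm 0ℚ k ℚ.*_) (ℚ.*-zeroˡ (Q.c k))) (ℚ.*-zeroʳ (expTerm 0ℚ k))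
  sum : ∀ n → expSum 0ℚ n ≡ 1ℚ
  sum zero    = refl
  sum (suc n) = ≡.trans (cong₂ ℚ._+_ (sum n) (term n)) (ℚ.+-identityʳ 1ℚ)

-- Taylor polynomials dominate 1 + p for p ≥ 0 but not for every negative p, and terms of x may be
-- negative; hence the passage to the absolute value.
1+x≤exp : ∀ {x} → 0ℝ ≤ x → 1ℝ + x ≤ exp x
1+x≤exp {x} h = ≤-trans (+-mono-≤ (≤-refl {1ℝ}) (x≤∣x∣ x)) (≤-trans abs (≈⇒≥ (exp-cong (≈∣∣ h))))
  where
  bound : ∀ {p} → 0ℚ ℚ.≤ p → ∀ n → 1ℚ ℚ.+ p ℚ.≤ expSum p (suc n)
  bound {p} 0≤p zero    = ℚ.≤-reflexive (cong (1ℚ ℚ.+_) (≡.sym (≡.trans (ℚ.*-identityˡ (p ℚ.* 1ℚ)) (ℚ.*-identityʳ p))))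
  bound {p} 0≤p (suc n) = ℚ.≤-trans (bound 0≤p n) (Q.m≤+ˡ {expSum p (suc n)} {expTerm p (2 ℕ.+ n)} (Q.expTerm-nonNeg 0≤p (2 ℕ.+ n)))
  abs : 1ℝ + ∣ x ∣ ≤ exp ∣ x ∣
  abs = mk≤ λ { ε 0<ε → 1 , λ { (suc n) _ → ℚ.≤-trans (bound (ℚ.0≤∣p∣ (seq x (suc n))) n) (Q.m≤+ˡ {expSum ℚ.∣ seq x (suc n) ∣ (suc n)} {ε} (ℚ.<⇒≤ 0<ε)) } }

-- Taylor polynomials can be negative, but exp x is the square of exp (x / 2).
0≤exp : ∀ x → 0ℝ ≤ exp x
0≤exp x = ≤-trans (0≤x*x (exp (fromℚ ½ * x))) (≈⇒≤ (≈-trans (≈-sym (exp-+ (fromℚ ½ * x) (fromℚ ½ * x)))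
  (exp-cong (solve 1 (λ x → con ½ :* x :+ con ½ :* x := x) ≈-refl x))))

exp-shift : ∀ x y → exp y ≈ exp x * exp (y - x)
exp-shift x y = ≈-trans (exp-cong (solve 2 (λ x y → y := x :+ (y :- x)) ≈-refl x y)) (exp-+ x (y - x))

exp-mono-≤ : ∀ {x y} → x ≤ y → exp x ≤ exp y
exp-mono-≤ {x} {y} h = begin
  exp x                 ≈⟨ ≈-sym (R.*-identityʳ (exp x)) ⟩
  exp x * 1ℝ            ≤⟨ *-monoˡ-≤ (exp x) (0≤exp x) (≤-trans (≈⇒≥ (R.+-identityʳ 1ℝ)) (≤-trans (+-mono-≤ (≤-refl {1ℝ}) (x≤y⇒0≤y-x h)) (1+x≤exp (x≤y⇒0≤y-x h)))) ⟩
  exp x * exp (y - x)   ≈⟨ ≈-sym (exp-shift x y) ⟩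
  exp y                 ∎
  where open ≤-Reasoning

0<exp : ∀ x → ¬ exp x ≤ 0ℝ
0<exp x h = ≤⇒≯ (≤-trans (≈⇒≤ (≈-trans (≈-sym exp-0) (≈-trans (exp-cong (≈-sym (R.-‿inverseʳ x))) (exp-+ x (- x)))))
    (≤-trans (*-monoʳ-≤ (exp (- x)) (0≤exp (- x)) h) (≈⇒≤ (R.zeroˡ (exp (- x))))))
  (fromℚ-mono-< Q.0<1)

-- Takes the place of a monotone logarithm: inequalities between logarithms are obtained by
-- reflecting them through `exp`.
exp-cancel-≤ : ∀ {x y} → exp x ≤ exp y → x ≤ y
exp-cancel-≤ {x} {y} h = ≮⇒≥ λ y<x → let g , 0<g , k = <⇒gap y<x in 0<exp y (nonpositive g 0<g k)
  where
  -- exp y (1 + g) ≤ exp x ≤ exp y whenever y + g ≤ x.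
  nonpositive : ∀ g → 0ℚ ℚ.< g → y + fromℚ g ≤ x → exp y ≤ 0ℝ
  nonpositive g 0<g k = *-cancel-≤0 0<g small
    where
    open ≤-Reasoning
    G≤ : fromℚ g ≤ x - y
    G≤ = ≤-trans (≈⇒≤ (solve 2 (λ y g → g := y :+ g :- y) ≈-refl y (fromℚ g))) (+-mono-≤ k (≤-refl { - y}))
    small : exp y * fromℚ g ≤ 0ℝ
    small = begin
      exp y * fromℚ g                 ≈⟨ solve 2 (λ e g → e :* g := e :* (con 1ℚ :+ g) :- e) ≈-refl (exp y) (fromℚ g) ⟩
      exp y * (1ℝ + fromℚ g) - exp y  ≤⟨ +-mono-≤ (*-monoˡ-≤ (exp y) (0≤exp y)
                                           (≤-trans (+-mono-≤ (≤-refl {1ℝ}) G≤) (1+x≤exp (≤-trans (fromℚ-mono-≤ (ℚ.<⇒≤ 0<g)) G≤)))) (≤-refl { - exp y}) ⟩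
      exp y * exp (x - y) - exp y     ≈⟨ +-cong (≈-sym (exp-shift y x)) (≈-refl { - exp y}) ⟩
      exp x - exp y                   ≤⟨ +-mono-≤ h (≤-refl { - exp y}) ⟩
      exp y - exp y                   ≈⟨ R.-‿inverseʳ (exp y) ⟩
      0ℝ                              ∎

exp-^ : ∀ x n → exp (fromℕ n * x) ≈ exp x ^ᴿ n
exp-^ x zero    = ≈-trans (exp-cong (R.zeroˡ x)) exp-0
exp-^ x (suc n) = ≈-trans (exp-cong (≈-trans (*-cong (fromℕ-suc n) (≈-refl {x}))
    (solve 2 (λ n x → (con 1ℚ :+ n) :* x := x :+ n :* x) ≈-refl (fromℕ n) x)))
  (≈-trans (exp-+ x (fromℕ n * x)) (*-cong (≈-refl {exp x}) (exp-^ x n)))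

-- Linear forms and kernels of rational matrices.

module ∑ℚ = Algebra.Properties.Semiring.Sum (CommutativeRing.semiring ℚ.+-*-commutativeRing)
module ∑ℤ = Algebra.Properties.Semiring.Sum (CommutativeRing.semiring ℤ.+-*-commutativeRing)

module LinearForms {c ℓ} (K : CommutativeRing c ℓ) where
  private module K = CommutativeRing K
  open K using (Carrier)
  open Algebra.Properties.Semiring.Sum K.semiring using (sum; sum-cong-≋)
  open import Relation.Binary.Reasoning.Setoid K.setoid
  import Algebra.Properties.Ring K.ring as Ring

  basis : ∀ {n} → Fin n → Vector Carrier n
  basis zero    zero    = K.1#
  basis zero    (suc i) = K.0#
  basis (suc j) zero    = K.0#
  basis (suc j) (suc i) = basis j i

  record IsLinear {n} (L : Vector Carrier n → Carrier) : Set (c Level.⊔ ℓ) where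
    field
      respects : ∀ {u v} → (∀ i → u i K.≈ v i) → L u K.≈ L v
      linear   : ∀ c u v → L (λ i → u i K.+ c K.* v i) K.≈ L u K.+ c K.* L v

  expand : ∀ {n} {L : Vector Carrier n → Carrier} → IsLinear L → ∀ w → L w K.≈ sum (λ j → L (basis j) K.* w j)
  -- `IsLinear` has no law for the zero vector; in dimension 0 all vectors agree, so linearity with
  -- coefficient 1 gives L w = L w + L w.
  expand {zero} {L} lin w = Ring.x+x≈x⇒x≈0 (L w) (K.sym (begin
    L w                     ≈⟨ IsLinear.respects lin (λ ()) ⟩
    L (λ i → w i K.+ K.1# K.* w i)  ≈⟨ IsLinear.linear lin K.1# w w ⟩
    L w K.+ K.1# K.* L w    ≈⟨ K.+-congˡ (K.*-identityˡ (L w)) ⟩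
    L w K.+ L w             ∎))
  expand {suc n} {L} lin w = begin
    L w
      ≈⟨ IsLinear.respects lin decompose ⟩
    L (λ i → (K.0# ∷ (w ∘ suc)) i K.+ w zero K.* basis zero i)
      ≈⟨ IsLinear.linear lin (w zero) (K.0# ∷ (w ∘ suc)) (basis zero) ⟩
    L (K.0# ∷ (w ∘ suc)) K.+ w zero K.* L (basis zero)
      ≈⟨ K.trans (K.+-comm _ _) (K.+-congʳ (K.*-comm _ _)) ⟩
    L (basis zero) K.* w zero K.+ L (K.0# ∷ (w ∘ suc))
      ≈⟨ K.+-congˡ (expand tail-linear (w ∘ suc)) ⟩
    L (basis zero) K.* w zero K.+ sum (λ j → L (K.0# ∷ basis j) K.* w (suc j))
      ≈⟨ K.+-congˡ (sum-cong-≋ λ j → K.*-congʳ (IsLinear.respects lin (basis-suc j))) ⟩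
    L (basis zero) K.* w zero K.+ sum (λ j → L (basis (suc j)) K.* w (suc j)) ∎
    where
    decompose : ∀ i → w i K.≈ (K.0# ∷ (w ∘ suc)) i K.+ w zero K.* basis zero i
    decompose zero    = K.sym (K.trans (K.+-identityˡ _) (K.*-identityʳ _))
    decompose (suc i) = K.sym (K.trans (K.+-congˡ (K.zeroʳ _)) (K.+-identityʳ _))
    basis-suc : ∀ j i → (K.0# ∷ basis j) i K.≈ basis (suc j) i
    basis-suc j zero    = K.refl
    basis-suc j (suc i) = K.refl
    tail-linear : IsLinear (λ v → L (K.0# ∷ v))
    tail-linear = record
      { respects = λ e → IsLinear.respects lin λ { zero → K.refl ; (suc i) → e i }
      ; linear = λ c u v → K.trans
          (IsLinear.respects lin λ { zero → K.sym (K.trans (K.+-identityˡ _) (K.zeroʳ c)) ; (suc i) → K.refl })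
          (IsLinear.linear lin c (K.0# ∷ u) (K.0# ∷ v)) }

sum-eliminate : ∀ {n} (a b v : Vector ℚ n) c →
  ∑ℚ.sum (λ k → (a k ℚ.- c ℚ.* b k) ℚ.* v k) ≡ ∑ℚ.sum (λ k → a k ℚ.* v k) ℚ.- c ℚ.* ∑ℚ.sum (λ k → b k ℚ.* v k)
sum-eliminate {zero}  a b v c = empty c
  where
  empty : ∀ c → 0ℚ ≡ 0ℚ ℚ.- c ℚ.* 0ℚ
  empty = solve-∀ Q.ring
sum-eliminate {suc n} a b v c = ≡.trans
  (cong ((a zero ℚ.- c ℚ.* b zero) ℚ.* v zero ℚ.+_) (sum-eliminate (a ∘ suc) (b ∘ suc) (v ∘ suc) c))
  (shuffle (a zero) (b zero) (v zero) c (∑ℚ.sum (λ k → a (suc k) ℚ.* v (suc k))) (∑ℚ.sum (λ k → b (suc k) ℚ.* v (suc k))))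
  where
  shuffle : ∀ a b v c s t → (a ℚ.- c ℚ.* b) ℚ.* v ℚ.+ (s ℚ.- c ℚ.* t) ≡ (a ℚ.* v ℚ.+ s) ℚ.- c ℚ.* (b ℚ.* v ℚ.+ t)
  shuffle = solve-∀ Q.ring

-- Gaussian elimination. If the first column vanishes, the first unit vector is a solution;
-- otherwise a pivot row removes the first unknown from the other rows, and the smaller system is
-- solved recursively.
kernel : ∀ {m} (M : Fin m → Fin (suc m) → ℚ) →
  ∃ λ (v : Vector ℚ (suc m)) → (∃ λ k → v k ≢ 0ℚ) × (∀ i → ∑ℚ.sum (λ k → M i k ℚ.* v k) ≡ 0ℚ)
kernel {zero}  M = const 1ℚ , (zero , λ ()) , λ ()
kernel {suc m} M with Fin.any? (λ i → ¬? (M i zero ℚ.≟ 0ℚ))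
... | no none = (1ℚ ∷ const 0ℚ) , (zero , λ ()) , λ i → ≡.trans
    (cong₂ ℚ._+_ (≡.trans (ℚ.*-identityʳ (M i zero)) (decidable-stable (M i zero ℚ.≟ 0ℚ) λ ≢0 → none (i , ≢0)))
      (≡.trans (∑ℚ.sum-cong-≗ {suc m} {x = λ k → M i (suc k) ℚ.* 0ℚ} (λ k → ℚ.*-zeroʳ (M i (suc k)))) (∑ℚ.sum-replicate-zero (suc m))))
    (ℚ.+-identityʳ 0ℚ)
... | yes (p , M≢0) = (v₀ ∷ v) , (suc k , vk≢0) , solves
  where
  instance
    _ = ℚ.≢-nonZero M≢0
  a⁻¹ = ℚ.1/ M p zero
  reduced : Fin m → Fin (suc m) → ℚ
  reduced r k = M (punchIn p r) (suc k) ℚ.- M (punchIn p r) zero ℚ.* a⁻¹ ℚ.* M p (suc k)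
  rec = kernel reduced
  v = proj₁ rec
  k = proj₁ (proj₁ (proj₂ rec))
  vk≢0 = proj₂ (proj₁ (proj₂ rec))
  S = λ i → ∑ℚ.sum (λ k → M i (suc k) ℚ.* v k)
  -- The value forced by the pivot row.
  v₀ = ℚ.- (a⁻¹ ℚ.* S p)
  solves : ∀ i → M i zero ℚ.* v₀ ℚ.+ S i ≡ 0ℚ
  solves i with i Fin.≟ p
  ... | yes refl = ≡.trans (shuffle (M p zero) a⁻¹ (S p)) (≡.trans
      (cong (λ z → (1ℚ ℚ.- z) ℚ.* S p) (ℚ.*-inverseʳ (M p zero))) (ℚ.*-zeroˡ (S p)))
    where
    shuffle : ∀ a b s → a ℚ.* ℚ.- (b ℚ.* s) ℚ.+ s ≡ (1ℚ ℚ.- a ℚ.* b) ℚ.* s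
    shuffle = solve-∀ Q.ring
  ... | no i≢p = subst (λ i → M i zero ℚ.* v₀ ℚ.+ S i ≡ 0ℚ) (Fin.punchIn-punchOut (i≢p ∘ ≡.sym)) (begin
      M j zero ℚ.* v₀ ℚ.+ S j                        ≡⟨ shuffle (M j zero) a⁻¹ (S p) (S j) ⟩
      S j ℚ.- M j zero ℚ.* a⁻¹ ℚ.* S p               ≡⟨ ≡.sym (sum-eliminate (M j ∘ suc) (M p ∘ suc) v (M j zero ℚ.* a⁻¹)) ⟩
      ∑ℚ.sum (λ k → reduced r k ℚ.* v k)             ≡⟨ proj₂ (proj₂ rec) r ⟩
      0ℚ                                             ∎)
    where
    open ≡.≡-Reasoning
    r = punchOut (i≢p ∘ ≡.sym)
    j = punchIn p r
    shuffle : ∀ b a s t → b ℚ.* ℚ.- (a ℚ.* s) ℚ.+ t ≡ t ℚ.- b ℚ.* a ℚ.* s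
    shuffle = solve-∀ Q.ring

-- Determinants of integer matrices and Cramer's rule.

minor : ∀ {n} → Matrix ℤ (suc n) → Fin (suc n) → Matrix ℤ n
minor A j i k = A (suc i) (punchIn j k)

laplaceTerm : ∀ {n} → Matrix ℤ (suc n) → Fin (suc n) → ℤ
laplaceTerm A j = sign j ℤ.* A zero j ℤ.* det (minor A j)

det-cong : ∀ {n} {A B : Matrix ℤ n} → (∀ i j → A i j ≡ B i j) → det A ≡ det B
det-cong {zero}  e = refl
det-cong {suc n} {A} {B} e = ∑ℤ.sum-cong-≗ {x = laplaceTerm A} {laplaceTerm B} λ j →
  cong₂ ℤ._*_ (cong (sign j ℤ.*_) (e zero j)) (det-cong λ i k → e (suc i) (punchIn j k))

-- In the expansion along the first row, the minor at j = k does not meet column k and the entry is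
-- linear; for j other than k the entry is fixed and the minor is linear in the column that k
-- becomes after deleting j.
det-linear : ∀ {n} k c {A U V : Matrix ℤ n} →
  (∀ i → A i k ≡ U i k ℤ.+ c ℤ.* V i k) → (∀ i l → l ≢ k → A i l ≡ U i l) → (∀ i l → l ≢ k → A i l ≡ V i l) →
  det A ≡ det U ℤ.+ c ℤ.* det V
det-linear {suc n} k c {A} {U} {V} at-k onU onV = ≡.trans (∑ℤ.sum-cong-≗ {x = laplaceTerm A} term) (combine (laplaceTerm U) (laplaceTerm V))
  where
  combine : ∀ {n} (u v : Vector ℤ n) → ∑ℤ.sum (λ j → u j ℤ.+ c ℤ.* v j) ≡ ∑ℤ.sum u ℤ.+ c ℤ.* ∑ℤ.sum v
  combine u v = ≡.trans (∑ℤ.∑-distrib-+ u (λ j → c ℤ.* v j)) (cong (λ z → ∑ℤ.sum u ℤ.+ z) (≡.sym (∑ℤ.*-distribˡ-sum c v)))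
  distribute : ∀ s u c v m → s ℤ.* (u ℤ.+ c ℤ.* v) ℤ.* m ≡ s ℤ.* u ℤ.* m ℤ.+ c ℤ.* (s ℤ.* v ℤ.* m)
  distribute = ℤ-solve-∀
  distribute′ : ∀ s a c m n → s ℤ.* a ℤ.* (m ℤ.+ c ℤ.* n) ≡ s ℤ.* a ℤ.* m ℤ.+ c ℤ.* (s ℤ.* a ℤ.* n)
  distribute′ = ℤ-solve-∀
  term : ∀ j → laplaceTerm A j ≡ laplaceTerm U j ℤ.+ c ℤ.* laplaceTerm V j
  term j with j Fin.≟ k
  ... | yes refl = ≡.trans (cong (λ a → sign j ℤ.* a ℤ.* det (minor A j)) (at-k zero)) (≡.trans
      (distribute (sign j) (U zero j) c (V zero j) (det (minor A j)))
      (cong₂ (λ m n → sign j ℤ.* U zero j ℤ.* m ℤ.+ c ℤ.* (sign j ℤ.* V zero j ℤ.* n))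
        (det-cong λ i l → onU (suc i) (punchIn j l) (Fin.punchInᵢ≢i j l))
        (det-cong λ i l → onV (suc i) (punchIn j l) (Fin.punchInᵢ≢i j l))))
  ... | no j≢k = ≡.trans (cong (sign j ℤ.* A zero j ℤ.*_) minors) (≡.trans
      (distribute′ (sign j) (A zero j) c (det (minor U j)) (det (minor V j)))
      (cong₂ (λ a b → sign j ℤ.* a ℤ.* det (minor U j) ℤ.+ c ℤ.* (sign j ℤ.* b ℤ.* det (minor V j)))
        (onU zero j j≢k) (onV zero j j≢k)))
    where
    k≡ = Fin.punchIn-punchOut j≢k
    minors : det (minor A j) ≡ det (minor U j) ℤ.+ c ℤ.* det (minor V j)
    minors = det-linear (punchOut j≢k) c
      (λ i → subst (λ k → A (suc i) k ≡ U (suc i) k ℤ.+ c ℤ.* V (suc i) k) (≡.sym k≡) (at-k (suc i)))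
      (λ i l l≢ → onU (suc i) (punchIn j l) λ e → l≢ (Fin.punchIn-injective j l _ (≡.trans e (≡.sym k≡))))
      (λ i l l≢ → onV (suc i) (punchIn j l) λ e → l≢ (Fin.punchIn-injective j l _ (≡.trans e (≡.sym k≡))))

-- The transposition of the neighbouring positions `inject₁ k` and `suc k`; neighbours suffice
-- because distant columns are brought together step by step.
swap : ∀ {n} → Fin n → Fin (suc n) → Fin (suc n)
swap zero    zero          = suc zero
swap zero    (suc zero)    = zero
swap zero    (suc (suc l)) = suc (suc l)
swap (suc k) zero          = zero
swap (suc k) (suc l)       = suc (swap k l)

swap-inject₁ : ∀ {n} (k : Fin n) → swap k (inject₁ k) ≡ suc k
swap-inject₁ zero    = refl
swap-inject₁ (suc k) = cong suc (swap-inject₁ k)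

swap-suc : ∀ {n} (k : Fin n) → swap k (suc k) ≡ inject₁ k
swap-suc zero    = refl
swap-suc (suc k) = cong suc (swap-suc k)

swap-punchIn-inject₁ : ∀ {n} (k : Fin n) m → swap k (punchIn (inject₁ k) m) ≡ punchIn (suc k) m
swap-punchIn-inject₁ zero    zero    = refl
swap-punchIn-inject₁ zero    (suc m) = refl
swap-punchIn-inject₁ (suc k) zero    = refl
swap-punchIn-inject₁ (suc k) (suc m) = cong suc (swap-punchIn-inject₁ k m)

swap-punchIn-suc : ∀ {n} (k : Fin n) m → swap k (punchIn (suc k) m) ≡ punchIn (inject₁ k) m
swap-punchIn-suc zero    zero    = refl
swap-punchIn-suc zero    (suc m) = refl
swap-punchIn-suc (suc k) zero    = refl
swap-punchIn-suc (suc k) (suc m) = cong suc (swap-punchIn-suc k m)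

-- How the transposition meets the deletion of column l: for an unmoved l the remaining columns are
-- exchanged by the transposition at `k′`.
data SwapView {n} (k : Fin (suc n)) (l : Fin (2 ℕ.+ n)) : Set where
  lower : l ≡ inject₁ k → SwapView k l
  upper : l ≡ suc k → SwapView k l
  unmoved : swap k l ≡ l → ∀ k′ → (∀ m → swap k (punchIn l m) ≡ punchIn l (swap k′ m)) → SwapView k l

swapView : ∀ {n} (k : Fin (suc n)) l → SwapView k l
swapView zero zero = lower refl
swapView zero (suc zero) = upper refl
swapView {suc n} zero (suc (suc l)) = unmoved refl zero λ { zero → refl ; (suc zero) → refl ; (suc (suc m)) → refl }
swapView {suc n} (suc k) zero = unmoved refl k λ _ → refl
swapView {suc n} (suc k) (suc l) with swapView k l
... | lower e = lower (cong suc e)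
... | upper e = upper (cong suc e)
... | unmoved e k′ h = unmoved (cong suc e) (suc k′) λ { zero → refl ; (suc m) → cong suc (h m) }

sum-swap : ∀ {n} (k : Fin n) (f : Vector ℤ (suc n)) → ∑ℤ.sum (f ∘ swap k) ≡ ∑ℤ.sum f
sum-swap zero    f = exchange (f zero) (f (suc zero)) (∑ℤ.sum (λ l → f (suc (suc l))))
  where
  exchange : ∀ a b s → b ℤ.+ (a ℤ.+ s) ≡ a ℤ.+ (b ℤ.+ s)
  exchange = ℤ-solve-∀
sum-swap (suc k) f = cong (λ z → f zero ℤ.+ z) (sum-swap k (f ∘ suc))

sign-inject₁ : ∀ {n} (k : Fin n) → sign (inject₁ k) ≡ sign k
sign-inject₁ zero    = refl
sign-inject₁ (suc k) = cong ℤ.-_ (sign-inject₁ k)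

sum-neg : ∀ {n} (f : Vector ℤ n) → ∑ℤ.sum (λ i → ℤ.- f i) ≡ ℤ.- ∑ℤ.sum f
sum-neg {zero}  f = refl
sum-neg {suc n} f = ≡.trans (cong (λ z → ℤ.- f zero ℤ.+ z) (sum-neg (f ∘ suc))) (≡.sym (ℤ.neg-distrib-+ (f zero) (∑ℤ.sum (f ∘ suc))))

-- Compared term by term along the first row: the terms of the two exchanged columns trade places
-- with equal minors and opposite signs, and every other term changes sign by induction on its
-- minor.
det-swap : ∀ {n} (k : Fin n) (A : Matrix ℤ (suc n)) → det (λ i l → A i (swap k l)) ≡ ℤ.- det A
det-swap {suc n} k A = ≡.trans (∑ℤ.sum-cong-≗ {x = laplaceTerm A′} term)
  (≡.trans (sum-neg (laplaceTerm A ∘ swap k)) (cong ℤ.-_ (sum-swap k (laplaceTerm A))))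
  where
  A′ : Matrix ℤ _
  A′ i l = A i (swap k l)
  sign-flip : ∀ s a m → s ℤ.* a ℤ.* m ≡ ℤ.- (ℤ.- s ℤ.* a ℤ.* m)
  sign-flip = ℤ-solve-∀
  sign-flip′ : ∀ s a m → ℤ.- s ℤ.* a ℤ.* m ≡ ℤ.- (s ℤ.* a ℤ.* m)
  sign-flip′ = ℤ-solve-∀
  neg-out : ∀ s a m → s ℤ.* a ℤ.* ℤ.- m ≡ ℤ.- (s ℤ.* a ℤ.* m)
  neg-out = ℤ-solve-∀
  term : ∀ l → laplaceTerm A′ l ≡ ℤ.- laplaceTerm A (swap k l)
  term l with swapView k l
  ... | lower refl rewrite swap-inject₁ k | sign-inject₁ k = ≡.trans
        (cong (sign k ℤ.* A zero (suc k) ℤ.*_) (det-cong λ i m → cong (A (suc i)) (swap-punchIn-inject₁ k m)))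
        (sign-flip (sign k) (A zero (suc k)) (det (minor A (suc k))))
  ... | upper refl rewrite swap-suc k | sign-inject₁ k = ≡.trans
        (cong (ℤ.- sign k ℤ.* A zero (inject₁ k) ℤ.*_) (det-cong λ i m → cong (A (suc i)) (swap-punchIn-suc k m)))
        (sign-flip′ (sign k) (A zero (inject₁ k)) (det (minor A (inject₁ k))))
  ... | unmoved e k′ h rewrite e = ≡.trans
        (cong (sign l ℤ.* A zero l ℤ.*_) (≡.trans (det-cong λ i m → cong (A (suc i)) (h m)) (det-swap k′ (minor A l))))
        (neg-out (sign l) (A zero l) (det (minor A l)))

x≡-x⇒x≡0 : ∀ {x} → x ≡ ℤ.- x → x ≡ 0ℤ
x≡-x⇒x≡0 {+ zero}    e = refl
x≡-x⇒x≡0 {+ suc n}   ()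
x≡-x⇒x≡0 {ℤ.-[1+ n ]} ()

swap-fixes : ∀ {n} (k : Fin n) {p : Fin (suc n)} → p Fin.< inject₁ k → swap k p ≡ p
swap-fixes zero    {p}     p<k = contradiction p<k ℕ.n≮0
swap-fixes (suc k) {zero}  p<k = refl
swap-fixes (suc k) {suc p} p<k = cong suc (swap-fixes k (ℕ.s<s⁻¹ p<k))

-- The right copy is moved left by neighbour swaps, with its position m as the measure. Once the
-- copies are adjacent, their swap fixes the matrix but negates the determinant.
det-repeated-< : ∀ m {n} (A : Matrix ℤ n) {p q : Fin n} → toℕ q ≡ m → p Fin.< q → (∀ i → A i p ≡ A i q) → det A ≡ 0ℤ
det-repeated-< zero    A q≡m p<q e = contradiction (ℕ.<-≤-trans p<q (ℕ.≤-reflexive q≡m)) ℕ.n≮0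
det-repeated-< (suc m) {suc n} A {p} {suc k} q≡m p<q e with p Fin.≟ inject₁ k
... | yes refl = x≡-x⇒x≡0 (≡.trans (det-cong same) (det-swap k A))
  where
  same : ∀ i l → A i l ≡ A i (swap k l)
  same i l with l Fin.≟ inject₁ k | l Fin.≟ suc k
  ... | yes refl | _ = ≡.trans (e i) (cong (A i) (≡.sym (swap-inject₁ k)))
  ... | no _ | yes refl = ≡.trans (≡.sym (e i)) (cong (A i) (≡.sym (swap-suc k)))
  ... | no ≢l | no ≢u = cong (A i) (≡.sym (swap-other k l ≢l ≢u))
    where
    swap-other : ∀ {n} (k : Fin n) l → l ≢ inject₁ k → l ≢ suc k → swap k l ≡ l
    swap-other zero    zero          p q = contradiction refl p
    swap-other zero    (suc zero)    p q = contradiction refl q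
    swap-other zero    (suc (suc l)) p q = refl
    swap-other (suc k) zero          p q = refl
    swap-other (suc k) (suc l)       p q = cong suc (swap-other k l (p ∘ cong suc) (q ∘ cong suc))
... | no p≢k = ℤ.neg-injective (≡.trans (≡.sym (det-swap k A))
    (det-repeated-< m (λ i l → A i (swap k l)) {p} {inject₁ k} (≡.trans (Fin.toℕ-inject₁ k) (ℕ.suc-injective q≡m)) p<k
      λ i → ≡.trans (cong (A i) (swap-fixes k p<k)) (≡.trans (e i) (cong (A i) (≡.sym (swap-inject₁ k))))))
  where
  p<k : p Fin.< inject₁ k
  p<k = ℕ.≤∧≢⇒< (subst (toℕ p ℕ.≤_) (≡.sym (Fin.toℕ-inject₁ k)) (ℕ.s≤s⁻¹ p<q)) (p≢k ∘ Fin.toℕ-injective)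

det-repeated : ∀ {n} (A : Matrix ℤ n) {k l} → k ≢ l → (∀ i → A i k ≡ A i l) → det A ≡ 0ℤ
det-repeated A {k} {l} k≢l e with Fin.<-cmp k l
... | tri< k<l _ _ = det-repeated-< (toℕ l) A refl k<l e
... | tri≈ _ k≡l _ = contradiction k≡l k≢l
... | tri> _ _ l<k = det-repeated-< (toℕ k) A refl l<k (≡.sym ∘ e)

module ℤLinear = LinearForms ℤ.+-*-commutativeRing

setColumn : ∀ {n} → Matrix ℤ n → Fin n → Vector ℤ n → Matrix ℤ n
setColumn A k w i = updateAt (A i) k (const (w i))

-- Cofactors are written as determinants with a unit vector in column k, so that linearity in that
-- column stands in for a column expansion.
adjugate : ∀ {n} → Matrix ℤ n → Matrix ℤ n
adjugate A k j = det (setColumn A k (ℤLinear.basis j))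

module _ {n} (A : Matrix ℤ n) (k : Fin n) where

  setColumn-at : ∀ w i → setColumn A k w i k ≡ w i
  setColumn-at w i = Vec.updateAt-updates k (A i)

  setColumn-off : ∀ w i {l} → l ≢ k → setColumn A k w i l ≡ A i l
  setColumn-off w i {l} l≢k = Vec.updateAt-minimal l k (A i) l≢k

  setColumn-linear : ℤLinear.IsLinear (λ w → det (setColumn A k w))
  setColumn-linear = record
    { respects = λ {u} {v} e → det-cong λ i l → respects e i l
    ; linear = λ c u v → det-linear k c {setColumn A k (λ i → u i ℤ.+ c ℤ.* v i)} {setColumn A k u} {setColumn A k v}
        (λ i → ≡.trans (setColumn-at (λ i → u i ℤ.+ c ℤ.* v i) i) (≡.sym (cong₂ (λ a b → a ℤ.+ c ℤ.* b) (setColumn-at u i) (setColumn-at v i))))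
        (λ i l l≢k → ≡.trans (setColumn-off (λ i → u i ℤ.+ c ℤ.* v i) i l≢k) (≡.sym (setColumn-off u i l≢k)))
        (λ i l l≢k → ≡.trans (setColumn-off (λ i → u i ℤ.+ c ℤ.* v i) i l≢k) (≡.sym (setColumn-off v i l≢k))) }
    where
    respects : ∀ {u v : Vector ℤ n} → (∀ i → u i ≡ v i) → ∀ i l → setColumn A k u i l ≡ setColumn A k v i l
    respects {u} {v} e i l with l Fin.≟ k
    ... | yes refl = ≡.trans (setColumn-at u i) (≡.trans (e i) (≡.sym (setColumn-at v i)))
    ... | no l≢k   = ≡.trans (setColumn-off u i l≢k) (≡.sym (setColumn-off v i l≢k))

  det-setColumn : ∀ l → det (setColumn A k (λ i → A i l)) ≡ det A ℤ.* ℤLinear.basis k l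
  det-setColumn l with l Fin.≟ k
  ... | yes refl = ≡.trans (det-cong same) (≡.sym (≡.trans (cong (det A ℤ.*_) (basis-diagonal k)) (ℤ.*-identityʳ (det A))))
    where
    basis-diagonal : ∀ {n} (k : Fin n) → ℤLinear.basis k k ≡ 1ℤ
    basis-diagonal zero    = refl
    basis-diagonal (suc k) = basis-diagonal k
    same : ∀ i m → setColumn A k (λ i → A i k) i m ≡ A i m
    same i m with m Fin.≟ k
    ... | yes refl = setColumn-at (λ i → A i k) i
    ... | no m≢k   = setColumn-off (λ i → A i k) i m≢k
  ... | no l≢k = ≡.trans
      (det-repeated (setColumn A k (λ i → A i l)) l≢k (λ i → ≡.trans (setColumn-off (λ i → A i l) i l≢k) (≡.sym (setColumn-at (λ i → A i l) i))))
      (≡.sym (≡.trans (cong (det A ℤ.*_) (basis-off k l l≢k)) (ℤ.*-zeroʳ (det A))))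
    where
    basis-off : ∀ {n} (k l : Fin n) → l ≢ k → ℤLinear.basis k l ≡ 0ℤ
    basis-off zero    zero    p = contradiction refl p
    basis-off zero    (suc l) p = refl
    basis-off (suc k) zero    p = refl
    basis-off (suc k) (suc l) p = basis-off k l (p ∘ cong suc)

-- Cramer: replacing column k by column l gives det A on the diagonal and a repeated column off it.
adjugate-inverse : ∀ {n} (A : Matrix ℤ n) k l →
  ∑ℤ.sum (λ j → adjugate A k j ℤ.* A j l) ≡ det A ℤ.* ℤLinear.basis k l
adjugate-inverse A k l = ≡.trans (≡.sym (ℤLinear.expand (setColumn-linear A k) (λ i → A i l))) (det-setColumn A k l)

-- Contractions and rational affine maps in the supremum norm.

module ℚLinear = LinearForms ℚ.+-*-commutativeRing

module _ {d : ℕ} where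

  ≋-refl : {x : ℝ^ d} → x ≋ x
  ≋-refl i = ≈-refl

  ≋-sym : {x y : ℝ^ d} → x ≋ y → y ≋ x
  ≋-sym e i = ≈-sym (e i)

  ≋-trans : {x y z : ℝ^ d} → x ≋ y → y ≋ z → x ≋ z
  ≋-trans e f i = ≈-trans (e i) (f i)

  ∣∣≤‖‖ : ∀ (x : ℝ^ d) i → ∣ x i ∣ ≤ ‖ x ‖
  ∣∣≤‖‖ x i = ≤⨆ (λ i → ∣ x i ∣) i

  ‖‖-lub : ∀ {x : ℝ^ d} {b} → 0ℝ ≤ b → (∀ i → ∣ x i ∣ ≤ b) → ‖ x ‖ ≤ b
  ‖‖-lub {x} 0≤b h = ⨆-lub (λ i → ∣ x i ∣) 0≤b h

  0≤‖‖ : ∀ (x : ℝ^ d) → 0ℝ ≤ ‖ x ‖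
  0≤‖‖ x = 0≤⨆ (λ i → ∣ x i ∣) (λ i → 0≤∣x∣ (x i))
    where
    0≤⨆ : ∀ {n} (v : Vector ℝ n) → (∀ i → 0ℝ ≤ v i) → 0ℝ ≤ foldr _⊔_ 0ℝ v
    0≤⨆ {zero}  v h = ≤-refl
    0≤⨆ {suc n} v h = ≤-trans (h zero) (≤⨆ v zero)

  -- For b ≥ 0 this is ‖x - y‖ ≤ b; the coordinatewise form keeps maxima out of the estimates.
  Within : ℝ → ℝ^ d → ℝ^ d → Set
  Within b x y = ∀ i → ∣ x i - y i ∣ ≤ b

  within-weaken : ∀ {b c} {x y : ℝ^ d} → b ≤ c → Within b x y → Within c x y
  within-weaken h w i = ≤-trans (w i) h

  within-sym : ∀ {b} {x y : ℝ^ d} → Within b x y → Within b y x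
  within-sym {x = x} {y} w i = ≤-trans (≈⇒≤ (∣x-y∣≈∣y-x∣ (y i) (x i))) (w i)

  within-trans : ∀ {b c} {x y z : ℝ^ d} → Within b x y → Within c y z → Within (b + c) x z
  within-trans {x = x} {y} {z} v w i = ≤-trans
    (≈⇒≤ (∣∣-cong (solve 3 (λ x y z → x :- z := (x :- y) :+ (y :- z)) ≈-refl (x i) (y i) (z i))))
    (≤-trans (∣x+y∣≤∣x∣+∣y∣ (x i - y i) (y i - z i)) (+-mono-≤ (v i) (w i)))

  within-resp : ∀ {b} {x x′ y y′ : ℝ^ d} → x ≋ x′ → y ≋ y′ → Within b x y → Within b x′ y′
  within-resp e f w i = ≤-trans (≈⇒≥ (∣∣-cong (+-cong (e i) (neg-cong (f i))))) (w i)

  ≋⇒within : ∀ {x y : ℝ^ d} → x ≋ y → Within 0ℝ x y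
  ≋⇒within {x} {y} e i = ≤-trans (≈⇒≤ (∣∣-cong (≈-trans (+-cong (e i) (≈-refl { - y i})) (R.-‿inverseʳ (y i)))))
    (≤-termwise λ _ → ℚ.≤-refl)

  within⇒≋ : ∀ {b} {x y : ℝ^ d} → b ≤ 0ℝ → Within b x y → x ≋ y
  within⇒≋ h w i = ∣x-y∣≤0⇒x≈y (≤-trans (w i) h)

  -- Phrased for arbitrary bounds b, so that composition multiplies the rates; the case b = 0 shows
  -- that g respects equality.
  record Contracts (ρ : ℝ) (g : ℝ^ d → ℝ^ d) : Set where
    field
      0≤ρ    : 0ℝ ≤ ρ
      shrink : ∀ {b x y} → 0ℝ ≤ b → Within b x y → Within (ρ * b) (g x) (g y)

    respects : ∀ {x y} → x ≋ y → g x ≋ g y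
    respects {x} {y} e = within⇒≋ (≈⇒≤ (R.zeroʳ ρ)) (shrink {0ℝ} {x} {y} ≤-refl (≋⇒within e))

  -- Affinity is expressed by preservation of the combinations x + c (y - z), which passes to
  -- compositions without multiplying matrices.
  record RationalAffine (g : ℝ^ d → ℝ^ d) : Set where
    field
      respects : ∀ {x y} → x ≋ y → g x ≋ g y
      rational : ∀ r → Rational (g (fromℚᵥ r))
      affine   : ∀ c x y z → g (x +ᵥ c ⊛ᵥ (y -ᵥ z)) ≋ g x +ᵥ c ⊛ᵥ (g y -ᵥ g z)

  rationalAffine-id : RationalAffine (λ x → x)
  rationalAffine-id = record
    { respects = λ e → e ; rational = λ r → r , ≋-refl ; affine = λ c x y z → ≋-refl }

  rationalAffine-∘ : ∀ {g h} → RationalAffine g → RationalAffine h → RationalAffine (g ∘ h)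
  rationalAffine-∘ {g} {h} G H = record
    { respects = G.respects ∘ H.respects
    ; rational = λ r → let s , e = H.rational r ; t , f = G.rational s in t , ≋-trans (G.respects e) f
    ; affine = λ c x y z → ≋-trans (G.respects (H.affine c x y z)) (G.affine c (h x) (h y) (h z)) }
    where
    module G = RationalAffine G
    module H = RationalAffine H

  rational-resp : ∀ {x y : ℝ^ d} → x ≋ y → Rational x → Rational y
  rational-resp e (r , f) = r , ≋-trans (≋-sym e) f

  module _ {g : ℝ^ d → ℝ^ d} (G : RationalAffine g) where
    private module G = RationalAffine G

    onℚ : Vector ℚ d → Vector ℚ d
    onℚ r = proj₁ (G.rational r)

    onℚ-correct : ∀ r → g (fromℚᵥ r) ≋ fromℚᵥ (onℚ r)
    onℚ-correct r = proj₂ (G.rational r)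

    onℚ-cong : ∀ {r s} → (∀ i → r i ≡ s i) → ∀ i → onℚ r i ≡ onℚ s i
    onℚ-cong {r} {s} e i = fromℚ-injective (≈-trans (≈-sym (onℚ-correct r i))
      (≈-trans (G.respects (λ i → fromℚ-cong (e i)) i) (onℚ-correct s i)))

    onℚ-affine : ∀ c r s t i → onℚ (λ i → r i ℚ.+ c ℚ.* (s i ℚ.- t i)) i ≡ onℚ r i ℚ.+ c ℚ.* (onℚ s i ℚ.- onℚ t i)
    onℚ-affine c r s t i = fromℚ-injective (≈-trans (≈-sym (onℚ-correct _ i)) (≈-trans
      (G.respects (λ i → lift (r i) (s i) (t i)) i) (≈-trans
      (G.affine (fromℚ c) (fromℚᵥ r) (fromℚᵥ s) (fromℚᵥ t) i) (≈-trans
      (+-cong (onℚ-correct r i) (*-cong (≈-refl {fromℚ c}) (+-cong (onℚ-correct s i) (neg-cong (onℚ-correct t i)))))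
      (≈-sym (lift (onℚ r i) (onℚ s i) (onℚ t i)))))))
      where
      lift : ∀ p q r → fromℚ (p ℚ.+ c ℚ.* (q ℚ.- r)) ≈ fromℚ p + fromℚ c * (fromℚ q - fromℚ r)
      lift p q r = ≈-termwise λ _ → refl

    private
      0⃗ : Vector ℚ d
      0⃗ _ = 0ℚ

    linearPart : Fin d → Vector ℚ d → ℚ
    linearPart i w = onℚ w i ℚ.- onℚ 0⃗ i

    linearPart-linear : ∀ i → ℚLinear.IsLinear (linearPart i)
    linearPart-linear i = record
      { respects = λ e → cong (ℚ._- onℚ 0⃗ i) (onℚ-cong e i)
      ; linear = λ c u v → ≡.trans
          (cong (ℚ._- onℚ 0⃗ i) (≡.trans (onℚ-cong (λ i → cong (λ z → u i ℚ.+ c ℚ.* z) (≡.sym (ℚ.+-identityʳ (v i)))) i) (onℚ-affine c u v 0⃗ i)))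
          (shuffle (onℚ u i) c (onℚ v i) (onℚ 0⃗ i)) }
      where
      shuffle : ∀ p c q z → p ℚ.+ c ℚ.* (q ℚ.- z) ℚ.- z ≡ (p ℚ.- z) ℚ.+ c ℚ.* (q ℚ.- z)
      shuffle = solve-∀ Q.ring

    -- A linear relation between g 0 and the columns of 1 - (linear part of g); a coefficient 0 at g 0
    -- would make the other coefficients a vector fixed by the linear part, against contraction.
    fixedPoint : ∀ {ρ} → ρ < 1ℝ → Contracts ρ g → ∃ λ r → g (fromℚᵥ r) ≋ fromℚᵥ r
    fixedPoint {ρ} ρ<1 K = conclude (v zero ℚ.≟ 0ℚ)
      where
      M : Fin d → Fin (suc d) → ℚ
      M i = onℚ 0⃗ i ∷ λ j → ℚLinear.basis j i ℚ.- 1ℚ ℚ.* linearPart i (ℚLinear.basis j)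

      v : Vector ℚ (suc d)
      v = proj₁ (kernel M)

      w : Vector ℚ d
      w i = v (suc i)

      coordinate-linear : ∀ i → ℚLinear.IsLinear (λ u → u i)
      coordinate-linear i = record { respects = λ e → e i ; linear = λ c u v → refl }

      relation : ∀ i → onℚ 0⃗ i ℚ.* v zero ℚ.+ (w i ℚ.- linearPart i w) ≡ 0ℚ
      relation i = ≡.trans (cong (onℚ 0⃗ i ℚ.* v zero ℚ.+_) (≡.sym (≡.trans
          (sum-eliminate (λ j → ℚLinear.basis j i) (λ j → linearPart i (ℚLinear.basis j)) w 1ℚ)
          (cong₂ ℚ._-_ (≡.sym (ℚLinear.expand (coordinate-linear i) w))
            (≡.trans (ℚ.*-identityˡ _) (≡.sym (ℚLinear.expand (linearPart-linear i) w)))))))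
        (proj₂ (proj₂ (kernel M)) i)

      w-fixed : v zero ≡ 0ℚ → ∀ i → linearPart i w ≡ w i
      w-fixed v₀≡0 i = ≡.trans (isolate (onℚ 0⃗ i) (w i) (linearPart i w)) (≡.trans
          (cong (λ z → w i ℚ.- z) (≡.trans (cong (λ z → onℚ 0⃗ i ℚ.* z ℚ.+ (w i ℚ.- linearPart i w)) (≡.sym v₀≡0)) (relation i)))
          (ℚ.+-identityʳ (w i)))
        where
        isolate : ∀ a w l → l ≡ w ℚ.- (a ℚ.* 0ℚ ℚ.+ (w ℚ.- l))
        isolate = solve-∀ Q.ring

      w-zero : v zero ≡ 0ℚ → ∀ i → w i ≡ 0ℚ
      w-zero v₀≡0 i = fromℚ-injective (within⇒≋ b≤0 bound i)
        where
        x = fromℚᵥ w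
        b = ‖ x -ᵥ 0ᵥ ‖
        bound : Within b x 0ᵥ
        bound = ∣∣≤‖‖ (x -ᵥ 0ᵥ)
        shrunk : Within (ρ * b) x 0ᵥ
        shrunk i = ≤-trans (≈⇒≤ (∣∣-cong (≈-trans (≈-termwise {x i - 0ᵥ {d} i} {fromℚ (onℚ w i) - fromℚ (onℚ 0⃗ i)} λ _ → ≡.trans (ℚ.+-identityʳ (w i)) (≡.sym (w-fixed v₀≡0 i)))
            (≈-sym (+-cong (onℚ-correct w i) (neg-cong (onℚ-correct 0⃗ i)))))))
          (Contracts.shrink K (0≤‖‖ (x -ᵥ 0ᵥ)) bound i)
        b≤ρb : b ≤ ρ * b
        b≤ρb = ‖‖-lub {x = x -ᵥ 0ᵥ} (*-nonNeg (Contracts.0≤ρ K) (0≤‖‖ (x -ᵥ 0ᵥ))) shrunk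
        b≤0 : b ≤ 0ℝ
        b≤0 = let e , 0<e , h = <⇒gap ρ<1 in *-cancel-≤0 0<e (begin
          b * fromℚ e                        ≈⟨ solve 3 (λ b e ρ → b :* e := b :* (ρ :+ e) :- ρ :* b) ≈-refl b (fromℚ e) ρ ⟩
          b * (ρ + fromℚ e) - ρ * b          ≤⟨ +-mono-≤ (*-monoˡ-≤ b (0≤‖‖ (x -ᵥ 0ᵥ)) h) (neg-mono-≤ b≤ρb) ⟩
          b * 1ℝ - b                         ≈⟨ solve 1 (λ b → b :* con 1ℚ :- b := con 0ℚ) ≈-refl b ⟩
          0ℝ                                 ∎)
          where open ≤-Reasoning

      conclude : Dec (v zero ≡ 0ℚ) → ∃ λ r → g (fromℚᵥ r) ≋ fromℚᵥ r
      conclude (yes v₀≡0) with proj₁ (proj₂ (kernel M))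
      ... | zero  , v≢0 = contradiction v₀≡0 v≢0
      ... | suc k , v≢0 = contradiction (w-zero v₀≡0 k) v≢0
      conclude (no v₀≢0) = r , ≋-trans (onℚ-correct r) (λ i → fromℚ-cong (r-fixed i))
        where
        instance
          _ = ℚ.≢-nonZero v₀≢0
        -- Dividing the relation by `v zero` shows that r = -w / v₀ satisfies r = g 0 + L r, with L
        -- the linear part. The zeros in the definition of `r` make `onℚ-affine` applicable as it
        -- stands.
        c = ℚ.- ℚ.1/ v zero
        r : Vector ℚ d
        r i = 0ℚ ℚ.+ c ℚ.* (w i ℚ.- 0ℚ)
        r-fixed : ∀ i → onℚ r i ≡ r i
        r-fixed i = ≡.trans (onℚ-affine c 0⃗ w 0⃗ i) (≡.trans
          (shuffle (onℚ 0⃗ i) (w i) (onℚ w i) (v zero) (ℚ.1/ v zero)) (≡.trans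
          (cong₂ (λ y z → 0ℚ ℚ.+ c ℚ.* (w i ℚ.- 0ℚ) ℚ.+ onℚ 0⃗ i ℚ.* (1ℚ ℚ.- y) ℚ.+ ℚ.1/ v zero ℚ.* z) (ℚ.*-inverseˡ (v zero)) (relation i))
          (cancel (r i) (onℚ 0⃗ i) (ℚ.1/ v zero))))
          where
          shuffle : ∀ a w g v i → a ℚ.+ (ℚ.- i) ℚ.* (g ℚ.- a) ≡
            0ℚ ℚ.+ (ℚ.- i) ℚ.* (w ℚ.- 0ℚ) ℚ.+ a ℚ.* (1ℚ ℚ.- i ℚ.* v) ℚ.+ i ℚ.* (a ℚ.* v ℚ.+ (w ℚ.- (g ℚ.- a)))
          shuffle = solve-∀ Q.ring
          cancel : ∀ r a i → r ℚ.+ a ℚ.* (1ℚ ℚ.- 1ℚ) ℚ.+ i ℚ.* 0ℚ ≡ r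
          cancel = solve-∀ Q.ring

·ᵥ-affine : ∀ {n} (a x y z : Vector ℝ n) c →
  foldr _+_ 0ℝ (λ j → a j * (x j + c * (y j - z j))) ≈
  foldr _+_ 0ℝ (λ j → a j * x j) + c * (foldr _+_ 0ℝ (λ j → a j * y j) - foldr _+_ 0ℝ (λ j → a j * z j))
·ᵥ-affine {zero}  a x y z c = solve 1 (λ c → con 0ℚ := con 0ℚ :+ c :* (con 0ℚ :- con 0ℚ)) ≈-refl c
·ᵥ-affine {suc n} a x y z c = ≈-trans
  (+-cong (≈-refl {a zero * (x zero + c * (y zero - z zero))}) (·ᵥ-affine (a ∘ suc) (x ∘ suc) (y ∘ suc) (z ∘ suc) c))
  (solve 8 (λ a x y z c s t u → a :* (x :+ c :* (y :- z)) :+ (s :+ c :* (t :- u)) := (a :* x :+ s) :+ c :* ((a :* y :+ t) :- (a :* z :+ u)))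
    ≈-refl (a zero) (x zero) (y zero) (z zero) c _ _ _)

-- Compositions of the maps and rationality of ultimately periodic points.

module _ {d J : ℕ} (F : IFS d J) where
  open IFS F

  ρ : ℝ
  ρ = maxRate F

  rate≤ρ : ∀ j → rate j ≤ ρ
  rate≤ρ = ≤⨆ rate

  0<ρ : Fin J → 0ℝ < ρ
  0<ρ j = <-≤-trans (0<rate j) (rate≤ρ j)

  ρ<1 : ρ < 1ℝ
  ρ<1 = ⨆-< rate (fromℚ-mono-< Q.0<1) rate<1

  map-contracts : ∀ j → Contracts ρ (map j)
  map-contracts j = record
    { 0≤ρ = <⇒≤ (0<ρ j)
    ; shrink = λ {b} {x} {y} 0≤b w i → ≤-trans (∣∣≤‖‖ (map j x -ᵥ map j y) i) (≤-trans (contraction j x y)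
        (*-mono-≤ {rate j} {ρ} {‖ x -ᵥ y ‖} {b} (<⇒≤ (0<rate j)) 0≤b (rate≤ρ j) (‖‖-lub {x = x -ᵥ y} 0≤b w))) }

  map-cong : ∀ j {x y} → x ≋ y → map j x ≋ map j y
  map-cong j = Contracts.respects (map-contracts j)

  compose-contracts : ∀ ω n → Contracts (ρ ^ᴿ n) (compose F ω n)
  compose-contracts ω zero = record
    { 0≤ρ = 0≤1 ; shrink = λ {b} {x} {y} 0≤b → within-weaken {x = x} {y} (≈⇒≥ (R.*-identityˡ b)) }
  compose-contracts ω (suc n) = record
    { 0≤ρ = *-nonNeg (Contracts.0≤ρ (map-contracts (ω 0))) (Contracts.0≤ρ rest)
    ; shrink = λ {b} {x} {y} 0≤b w → within-weaken {x = compose F ω (suc n) x} {compose F ω (suc n) y} (≈⇒≥ (R.*-assoc ρ (ρ ^ᴿ n) b))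
        (Contracts.shrink (map-contracts (ω 0)) {x = compose F (ω ∘ suc) n x} {compose F (ω ∘ suc) n y}
          (*-nonNeg (Contracts.0≤ρ rest) 0≤b) (Contracts.shrink rest {b} {x} {y} 0≤b w)) }
    where
    rest = compose-contracts (ω ∘ suc) n

  compose-cong : ∀ ω n {x y} → x ≋ y → compose F ω n x ≋ compose F ω n y
  compose-cong ω n = Contracts.respects (compose-contracts ω n)

  compose-≗ : ∀ {ω ω′} n → (∀ i → i ℕ.< n → ω i ≡ ω′ i) → ∀ x → compose F ω n x ≋ compose F ω′ n x
  compose-≗ zero    e x = ≋-refl
  compose-≗ {ω} {ω′} (suc n) e x rewrite e 0 ℕ.z<s = map-cong (ω′ 0) (compose-≗ n (λ i i<n → e (suc i) (ℕ.s<s i<n)) x)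

  compose-+ : ∀ ω m n x → compose F ω (m ℕ.+ n) x ≡ compose F ω m (compose F (λ i → ω (m ℕ.+ i)) n x)
  compose-+ ω zero    n x = refl
  compose-+ ω (suc m) n x = cong (map (ω 0)) (compose-+ (ω ∘ suc) m n x)

  module _ (affine : Affine F) (preserving : RationalPreserving F) where

    map-rationalAffine : ∀ j → RationalAffine (map j)
    map-rationalAffine j = record
      { respects = map-cong j ; rational = preserving j
      ; affine = λ c x y z i → ≈-trans (formula (x +ᵥ c ⊛ᵥ (y -ᵥ z)) i) (≈-trans
          (≈-trans (+-cong (·ᵥ-affine (A i) x y z c) (≈-refl {b i}))
            (solve 5 (λ s t u c b → s :+ c :* (t :- u) :+ b := (s :+ b) :+ c :* ((t :+ b) :- (u :+ b))) ≈-refl ((A ·ᵥ x) i) ((A ·ᵥ y) i) ((A ·ᵥ z) i) c (b i)))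
          (≈-sym (+-cong (formula x i) (*-cong (≈-refl {c}) (+-cong (formula y i) (neg-cong (formula z i))))))) }
      where
      A = proj₁ (affine j)
      b = proj₁ (proj₂ (affine j))
      formula = proj₂ (proj₂ (affine j))

    compose-rationalAffine : ∀ ω n → RationalAffine (compose F ω n)
    compose-rationalAffine ω zero    = rationalAffine-id
    compose-rationalAffine ω (suc n) = rationalAffine-∘ (map-rationalAffine (ω 0)) (compose-rationalAffine (ω ∘ suc) n)

    -- The limit defining ξ does not depend on the starting point, as compositions of length l
    -- contract by ρ^l. Started at the fixed point r of the period, the compositions of length m + k
    -- n all equal ζ, so ξ equals ζ.
    ultimatelyPeriodic⇒rational : ∀ ξ → UltimatelyPeriodicAddress F ξ → Rational ξ
    ultimatelyPeriodic⇒rational ξ a = rational-resp (≋-sym ξ≋ζ) (RationalAffine.rational (compose-rationalAffine ω m) r)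
      where
      open UltimatelyPeriodicAddress a renaming (preperiod to m; period to n)
      tail : ℕ → Fin J
      tail i = ω (m ℕ.+ i)
      ρⁿ<1 : ∀ n → {{NonZero n}} → ρ ^ᴿ n < 1ℝ
      ρⁿ<1 (suc n) = ≤-<-trans (≤-trans (*-monoˡ-≤ ρ 0≤ρ (x^n≤1 0≤ρ (<⇒≤ ρ<1) n)) (≈⇒≤ (R.*-identityʳ ρ))) ρ<1
        where 0≤ρ = <⇒≤ (0<ρ (ω 0))
      fixed = fixedPoint (compose-rationalAffine tail n) (ρⁿ<1 n) (compose-contracts tail n)
      r = proj₁ fixed
      tail-periodic : ∀ i → tail (n ℕ.+ i) ≡ tail i
      tail-periodic i = ≡.trans (cong ω (≡.trans (cong (m ℕ.+_) (ℕ.+-comm n i)) (≡.sym (ℕ.+-assoc m i n))))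
        (periodic (m ℕ.+ i) (ℕ.m≤m+n m i))
      repeat : ∀ k → compose F tail (k ℕ.* n) (fromℚᵥ r) ≋ fromℚᵥ r
      repeat zero    = ≋-refl
      repeat (suc k) rewrite compose-+ tail n (k ℕ.* n) (fromℚᵥ r) = ≋-trans
        (compose-cong tail n (≋-trans (compose-≗ (k ℕ.* n) (λ i _ → tail-periodic i) (fromℚᵥ r)) (repeat k))) (proj₂ fixed)
      ζ = compose F ω m (fromℚᵥ r)
      b = ‖ 0ᵥ -ᵥ fromℚᵥ r ‖
      B = proj₁ (bounded-above b)
      b≤B = proj₂ (bounded-above b)
      ξ≋ζ : ξ ≋ ζ
      ξ≋ζ i = ≈-limit λ ε 0<ε →
        let 0<½ε = 0<½* {ε} 0<ε
            N₁ , near = isAddress (fromℚ (½ ℚ.* ε)) (fromℚ-mono-< 0<½ε)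
            N₂ , small = pow-small (<⇒≤ (0<ρ (ω 0))) ρ<1 (Q.ι B) (½ ℚ.* ε) 0<½ε
            -- One k meets both thresholds, since n ≥ 1 gives l = m + k n ≥ k.
            k = N₁ ℕ.⊔ N₂
            l = m ℕ.+ k ℕ.* n
            k≤l = ℕ.≤-trans (ℕ.m≤m*n k n) (ℕ.m≤n+m (k ℕ.* n) m)
            x = compose F ω l 0ᵥ
            x~ξ : Within (fromℚ (½ ℚ.* ε)) x ξ
            x~ξ i = ≤-trans (∣∣≤‖‖ (x -ᵥ ξ) i) (<⇒≤ (near l (ℕ.≤-trans (ℕ.m≤m⊔n N₁ N₂) k≤l)))
            x~y : Within (fromℚ (½ ℚ.* ε)) x (compose F ω l (fromℚᵥ r))
            x~y = within-weaken {x = x} {compose F ω l (fromℚᵥ r)}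
              (≤-trans (*-monoˡ-≤ (ρ ^ᴿ l) (Contracts.0≤ρ (compose-contracts ω l)) b≤B) (small l (ℕ.≤-trans (ℕ.m≤n⊔m N₁ N₂) k≤l)))
              (Contracts.shrink (compose-contracts ω l) {b} {0ᵥ} {fromℚᵥ r} (0≤‖‖ (0ᵥ -ᵥ fromℚᵥ r)) (∣∣≤‖‖ (0ᵥ -ᵥ fromℚᵥ r)))
            y≋ζ : compose F ω l (fromℚᵥ r) ≋ ζ
            y≋ζ = ≋-trans (λ i → ≈-reflexive (cong (λ f → f i) (compose-+ ω m (k ℕ.* n) (fromℚᵥ r)))) (compose-cong ω m (repeat k))
        in ≤-trans (within-trans {x = ξ} {x} {ζ} (within-sym {x = x} {ξ} x~ξ) (within-resp {x = x} {x} {compose F ω l (fromℚᵥ r)} {ζ} ≋-refl y≋ζ x~y) i)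
          (≤-trans (≈⇒≥ (fromℚ-+ (½ ℚ.* ε) (½ ℚ.* ε))) (≈⇒≤ (fromℚ-cong (Q.half+half ε))))

-- Integers among the reals and common denominators.

module ∑ℝ = Algebra.Properties.Semiring.Sum R.semiring

private
  toℚᵘ-/1 : ∀ z → ℚ.toℚᵘ (z ℚ./ 1) ℚᵘ.≃ ℚᵘ.mkℚᵘ z 0
  toℚᵘ-/1 z = ℚ.toℚᵘ-fromℚᵘ (ℚᵘ.mkℚᵘ z 0)

/1-+ : ∀ a b → (a ℤ.+ b) ℚ./ 1 ≡ a ℚ./ 1 ℚ.+ b ℚ./ 1
/1-+ a b = ℚ.toℚᵘ-injective (begin
  ℚ.toℚᵘ ((a ℤ.+ b) ℚ./ 1)                     ≈⟨ toℚᵘ-/1 (a ℤ.+ b) ⟩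
  ℚᵘ.mkℚᵘ (a ℤ.+ b) 0                          ≈⟨ ℚᵘ.*≡* (shuffle a b) ⟩
  ℚᵘ.mkℚᵘ a 0 ℚᵘ.+ ℚᵘ.mkℚᵘ b 0                 ≈⟨ ℚᵘ.+-cong (ℚᵘ.≃-sym (toℚᵘ-/1 a)) (ℚᵘ.≃-sym (toℚᵘ-/1 b)) ⟩
  ℚ.toℚᵘ (a ℚ./ 1) ℚᵘ.+ ℚ.toℚᵘ (b ℚ./ 1)       ≈⟨ ℚᵘ.≃-sym (ℚ.toℚᵘ-homo-+ (a ℚ./ 1) (b ℚ./ 1)) ⟩
  ℚ.toℚᵘ (a ℚ./ 1 ℚ.+ b ℚ./ 1)                 ∎)
  where
  open ℚᵘ.≃-Reasoning
  shuffle : ∀ a b → (a ℤ.+ b) ℤ.* 1ℤ ≡ (a ℤ.* 1ℤ ℤ.+ b ℤ.* 1ℤ) ℤ.* 1ℤ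
  shuffle = ℤ-solve-∀

/1-* : ∀ a b → (a ℤ.* b) ℚ./ 1 ≡ (a ℚ./ 1) ℚ.* (b ℚ./ 1)
/1-* a b = ℚ.toℚᵘ-injective (begin
  ℚ.toℚᵘ ((a ℤ.* b) ℚ./ 1)                     ≈⟨ toℚᵘ-/1 (a ℤ.* b) ⟩
  ℚᵘ.mkℚᵘ a 0 ℚᵘ.* ℚᵘ.mkℚᵘ b 0                 ≈⟨ ℚᵘ.*-cong (ℚᵘ.≃-sym (toℚᵘ-/1 a)) (ℚᵘ.≃-sym (toℚᵘ-/1 b)) ⟩
  ℚ.toℚᵘ (a ℚ./ 1) ℚᵘ.* ℚ.toℚᵘ (b ℚ./ 1)       ≈⟨ ℚᵘ.≃-sym (ℚ.toℚᵘ-homo-* (a ℚ./ 1) (b ℚ./ 1)) ⟩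
  ℚ.toℚᵘ ((a ℚ./ 1) ℚ.* (b ℚ./ 1))             ∎)
  where open ℚᵘ.≃-Reasoning

/1-mono-≤ : ∀ {a b} → a ℤ.≤ b → a ℚ./ 1 ℚ.≤ b ℚ./ 1
/1-mono-≤ {a} {b} h = ℚ.toℚᵘ-cancel-≤ (ℚᵘ.≤-respˡ-≃ (ℚᵘ.≃-sym (toℚᵘ-/1 a))
  (ℚᵘ.≤-respʳ-≃ (ℚᵘ.≃-sym (toℚᵘ-/1 b)) (ℚᵘ.*≤* (ℤ.*-monoʳ-≤-nonNeg (+ 1) h))))

*-/-cancel : ∀ z q {{_ : NonZero q}} → (+ q ℚ./ 1) ℚ.* (z ℚ./ q) ≡ z ℚ./ 1
*-/-cancel z q@(suc k) = ℚ.toℚᵘ-injective (begin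
  ℚ.toℚᵘ ((+ q ℚ./ 1) ℚ.* (z ℚ./ q))           ≈⟨ ℚ.toℚᵘ-homo-* (+ q ℚ./ 1) (z ℚ./ q) ⟩
  ℚ.toℚᵘ (+ q ℚ./ 1) ℚᵘ.* ℚ.toℚᵘ (z ℚ./ q)     ≈⟨ ℚᵘ.*-cong (toℚᵘ-/1 (+ q)) (ℚ.toℚᵘ-fromℚᵘ (ℚᵘ.mkℚᵘ z k)) ⟩
  ℚᵘ.mkℚᵘ (+ q) 0 ℚᵘ.* ℚᵘ.mkℚᵘ z k             ≈⟨ ℚᵘ.*≡* (shuffle (+ q) z) ⟩
  ℚᵘ.mkℚᵘ z 0                                  ≈⟨ ℚᵘ.≃-sym (toℚᵘ-/1 z) ⟩
  ℚ.toℚᵘ (z ℚ./ 1)                             ∎)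
  where
  open ℚᵘ.≃-Reasoning
  shuffle : ∀ q z → (q ℤ.* z) ℤ.* 1ℤ ≡ z ℤ.* (1ℤ ℤ.* q)
  shuffle = ℤ-solve-∀

fromℤ-+ : ∀ a b → fromℤ (a ℤ.+ b) ≈ fromℤ a + fromℤ b
fromℤ-+ a b = ≈-trans (fromℚ-cong (/1-+ a b)) (fromℚ-+ (a ℚ./ 1) (b ℚ./ 1))

fromℤ-* : ∀ a b → fromℤ (a ℤ.* b) ≈ fromℤ a * fromℤ b
fromℤ-* a b = ≈-trans (fromℚ-cong (/1-* a b)) (fromℚ-* (a ℚ./ 1) (b ℚ./ 1))

fromℤ-neg : ∀ a → fromℤ (ℤ.- a) ≈ - fromℤ a
fromℤ-neg a = ≈-trans (≈-sym (R.+-identityʳ (fromℤ (ℤ.- a)))) (≈-trans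
  (+-cong (≈-refl {fromℤ (ℤ.- a)}) (≈-sym (R.-‿inverseʳ (fromℤ a)))) (≈-trans
  (≈-sym (R.+-assoc (fromℤ (ℤ.- a)) (fromℤ a) (- fromℤ a))) (≈-trans
  (+-cong (≈-trans (≈-sym (fromℤ-+ (ℤ.- a) a)) (fromℚ-cong (cong (ℚ._/ 1) (ℤ.+-inverseˡ a)))) (≈-refl { - fromℤ a}))
  (R.+-identityˡ (- fromℤ a)))))

fromℤ-mono-≤ : ∀ {a b} → a ℤ.≤ b → fromℤ a ≤ fromℤ b
fromℤ-mono-≤ h = fromℚ-mono-≤ (/1-mono-≤ h)

fromℤ-sum : ∀ {n} (v : Vector ℤ n) → fromℤ (∑ℤ.sum v) ≈ ∑ℝ.sum (λ i → fromℤ (v i))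
fromℤ-sum {zero}  v = ≈-refl
fromℤ-sum {suc n} v = ≈-trans (fromℤ-+ (v zero) (∑ℤ.sum (v ∘ suc))) (+-cong (≈-refl {fromℤ (v zero)}) (fromℤ-sum (v ∘ suc)))

fromℕ-+ : ∀ m n → fromℕ (m ℕ.+ n) ≈ fromℕ m + fromℕ n
fromℕ-+ m n = ≈-trans (fromℚ-cong (cong (ℚ._/ 1) (ℤ.pos-+ m n))) (fromℤ-+ (+ m) (+ n))

fromℕ-* : ∀ m n → fromℕ (m ℕ.* n) ≈ fromℕ m * fromℕ n
fromℕ-* m n = ≈-trans (fromℚ-cong (cong (ℚ._/ 1) (ℤ.pos-* m n))) (fromℤ-* (+ m) (+ n))

fromℕ-mono-≤ : ∀ {m n} → m ℕ.≤ n → fromℕ m ≤ fromℕ n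
fromℕ-mono-≤ h = fromℤ-mono-≤ (ℤ.+≤+ h)

close⇒≤ : ∀ {a b} → fromℤ a - fromℤ b < 1ℝ → a ℤ.≤ b
close⇒≤ {a} {b} h = ℤ.≮⇒≥ λ b<a → <-irrefl (≤-<-trans (begin
  1ℝ                             ≈⟨ solve 1 (λ b → con 1ℚ := con 1ℚ :+ b :- b) ≈-refl (fromℤ b) ⟩
  1ℝ + fromℤ b - fromℤ b         ≈⟨ +-cong (≈-sym (fromℤ-+ 1ℤ b)) (≈-refl { - fromℤ b}) ⟩
  fromℤ (ℤ.suc b) - fromℤ b      ≤⟨ +-mono-≤ (fromℤ-mono-≤ (ℤ.i<j⇒suc[i]≤j b<a)) (≤-refl { - fromℤ b}) ⟩
  fromℤ a - fromℤ b              ∎) h)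
  where open ≤-Reasoning

close⇒≡ : ∀ {a b} → ∣ fromℤ a - fromℤ b ∣ < 1ℝ → a ≡ b
close⇒≡ {a} {b} h = ℤ.≤-antisym (close⇒≤ (≤-<-trans (x≤∣x∣ (fromℤ a - fromℤ b)) h))
  (close⇒≤ (≤-<-trans (≤-trans (x≤∣x∣ (fromℤ b - fromℤ a)) (≈⇒≤ (∣x-y∣≈∣y-x∣ (fromℤ b) (fromℤ a)))) h))

∣fromℤ∣≤⇒∣∣≤ : ∀ z {n} → ∣ fromℤ z ∣ ≤ fromℕ n → ℤ.∣ z ∣ ℕ.≤ n
∣fromℤ∣≤⇒∣∣≤ z {n} h = ℕ.≮⇒≥ λ n<∣z∣ → <-irrefl (≤-<-trans (≤-trans (fromℕ-mono-≤ n<∣z∣) (≤-trans (abs z) h))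
  (fromℚ-mono-< (subst (Q.ι n ℚ.<_) (≡.sym (Q.ι-suc n)) (subst (ℚ._< 1ℚ ℚ.+ Q.ι n) (ℚ.+-identityˡ (Q.ι n)) (ℚ.+-monoˡ-< (Q.ι n) Q.0<1)))))
  where
  abs : ∀ z → fromℕ ℤ.∣ z ∣ ≤ ∣ fromℤ z ∣
  abs (+ n)        = x≤∣x∣ (fromℕ n)
  abs ℤ.-[1+ n ]   = ≤-trans (≈⇒≤ (fromℤ-neg ℤ.-[1+ n ])) (-x≤∣x∣ (fromℤ ℤ.-[1+ n ]))

module _ {d : ℕ} where

  record HasDenominator (Q : ℕ) (x : ℝ^ d) : Set where
    constructor mkDenominator
    field
      numerator : Vector ℤ d
      scaled    : ∀ i → fromℕ Q * x i ≈ fromℤ (numerator i)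

  ratio-hasDenominator : ∀ p q {{_ : NonZero q}} → HasDenominator q (ratio p q)
  ratio-hasDenominator p q = mkDenominator p λ i → ≈-trans (≈-sym (fromℚ-* (+ q ℚ./ 1) (p i ℚ./ q))) (fromℚ-cong (*-/-cancel (p i) q))

  hasDenominator-* : ∀ {Q x} s → HasDenominator Q x → HasDenominator (Q ℕ.* s) x
  hasDenominator-* {Q} {x} s (mkDenominator p e) = mkDenominator (λ i → p i ℤ.* + s) λ i → ≈-trans
    (*-cong (fromℕ-* Q s) (≈-refl {x i})) (≈-trans
    (solve 3 (λ q s x → q :* s :* x := q :* x :* s) ≈-refl (fromℕ Q) (fromℕ s) (x i)) (≈-trans
    (*-cong (e i) (≈-refl {fromℕ s})) (≈-sym (fromℤ-* (p i) (+ s)))))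

  fromℕ-cancelˡ : ∀ Q {{_ : NonZero Q}} {x y} → fromℕ Q * x ≈ fromℕ Q * y → x ≈ y
  fromℕ-cancelˡ (suc k) {x} {y} e = ≈-trans (≈-sym (undo x)) (≈-trans (*-cong (≈-refl {fromℚ (Q.c k)}) e) (undo y))
    where
    undo : ∀ x → fromℚ (Q.c k) * (fromℕ (suc k) * x) ≈ x
    undo x = ≈-trans (≈-sym (R.*-assoc (fromℚ (Q.c k)) (fromℕ (suc k)) x)) (≈-trans
      (*-cong (≈-trans (≈-sym (fromℚ-* (Q.c k) (Q.ι (suc k)))) (fromℚ-cong (≡.trans (ℚ.*-comm (Q.c k) (Q.ι (suc k))) (Q.ι*c k)))) (≈-refl {x}))
      (R.*-identityˡ x))

  -- A unit δ of ℤ is its own inverse.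
  ±1-cancel : ∀ {δ} → δ ≡ 1ℤ ⊎ δ ≡ -1ℤ → ∀ {m x} → fromℤ δ * x ≈ fromℤ m → x ≈ fromℤ (δ ℤ.* m)
  ±1-cancel {δ} h {m} {x} e = ≈-trans (≈-trans (≈-sym (R.*-identityˡ x)) (*-cong (≈-sym (square h)) (≈-refl {x}))) (≈-trans
    (R.*-assoc (fromℤ δ) (fromℤ δ) x) (≈-trans (*-cong (≈-refl {fromℤ δ}) e) (≈-sym (fromℤ-* δ m))))
    where
    square : ∀ {δ} → δ ≡ 1ℤ ⊎ δ ≡ -1ℤ → fromℤ δ * fromℤ δ ≈ 1ℝ
    square (inj₁ refl) = ≈-termwise λ _ → refl
    square (inj₂ refl) = ≈-termwise λ _ → refl

  -- The adjugate is integral, so A z ∈ ℤᵈ gives det A · z ∈ ℤᵈ.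
  unimodular-solve : ∀ (A : Matrix ℤ d) → det A ≡ 1ℤ ⊎ det A ≡ -1ℤ → ∀ (z : ℝ^ d) (m : Vector ℤ d) →
    (∀ i → ((λ i j → fromℤ (A i j)) ·ᵥ z) i ≈ fromℤ (m i)) → ∃ λ (p : Vector ℤ d) → ∀ k → z k ≈ fromℤ (p k)
  unimodular-solve A unit z m Az≈m = (λ k → det A ℤ.* m′ k) , λ k → ±1-cancel unit (det*z k)
    where
    B = adjugate A
    m′ : Vector ℤ d
    m′ k = ∑ℤ.sum (λ i → B k i ℤ.* m i)
    basis-sum : ∀ {n} (k : Fin n) (z : Vector ℝ n) → ∑ℝ.sum (λ l → fromℤ (ℤLinear.basis k l) * z l) ≈ z k
    basis-sum {suc n} zero z = ≈-trans (+-cong (R.*-identityˡ (z zero)) (≈-trans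
      (∑ℝ.sum-cong-≋ {n} (λ l → R.zeroˡ (z (suc l)))) (∑ℝ.sum-replicate-zero n))) (R.+-identityʳ (z zero))
    basis-sum {suc n} (suc k) z = ≈-trans (+-cong (R.zeroˡ (z zero)) (basis-sum k (z ∘ suc))) (R.+-identityˡ (z (suc k)))
    det*z : ∀ k → fromℤ (det A) * z k ≈ fromℤ (m′ k)
    det*z k = begin
      fromℤ (det A) * z k
        ≈⟨ *-cong (≈-refl {fromℤ (det A)}) (≈-sym (basis-sum k z)) ⟩
      fromℤ (det A) * ∑ℝ.sum (λ l → fromℤ (ℤLinear.basis k l) * z l)
        ≈⟨ ∑ℝ.*-distribˡ-sum (fromℤ (det A)) (λ l → fromℤ (ℤLinear.basis k l) * z l) ⟩
      ∑ℝ.sum (λ l → fromℤ (det A) * (fromℤ (ℤLinear.basis k l) * z l))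
        ≈⟨ ∑ℝ.sum-cong-≋ {d} column ⟩
      ∑ℝ.sum (λ l → ∑ℝ.sum (λ i → fromℤ (B k i) * (fromℤ (A i l) * z l)))
        ≈⟨ ∑ℝ.∑-comm (λ l i → fromℤ (B k i) * (fromℤ (A i l) * z l)) ⟩
      ∑ℝ.sum (λ i → ∑ℝ.sum (λ l → fromℤ (B k i) * (fromℤ (A i l) * z l)))
        ≈⟨ ∑ℝ.sum-cong-≋ {d} (λ i → ≈-trans (≈-sym (∑ℝ.*-distribˡ-sum (fromℤ (B k i)) (λ l → fromℤ (A i l) * z l)))
             (≈-trans (*-cong (≈-refl {fromℤ (B k i)}) (Az≈m i)) (≈-sym (fromℤ-* (B k i) (m i))))) ⟩
      ∑ℝ.sum (λ i → fromℤ (B k i ℤ.* m i))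
        ≈⟨ ≈-sym (fromℤ-sum (λ i → B k i ℤ.* m i)) ⟩
      fromℤ (m′ k) ∎
      where
      open import Relation.Binary.Reasoning.Setoid R.setoid
      column : ∀ l → fromℤ (det A) * (fromℤ (ℤLinear.basis k l) * z l) ≈ ∑ℝ.sum (λ i → fromℤ (B k i) * (fromℤ (A i l) * z l))
      column l = begin
        fromℤ (det A) * (fromℤ (ℤLinear.basis k l) * z l)
          ≈⟨ R.sym (R.*-assoc (fromℤ (det A)) (fromℤ (ℤLinear.basis k l)) (z l)) ⟩
        fromℤ (det A) * fromℤ (ℤLinear.basis k l) * z l
          ≈⟨ *-cong (≈-trans (≈-sym (fromℤ-* (det A) (ℤLinear.basis k l))) (≈-trans
               (fromℚ-cong (cong (ℚ._/ 1) (≡.sym (adjugate-inverse A k l)))) (fromℤ-sum (λ i → B k i ℤ.* A i l)))) (≈-refl {z l}) ⟩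
        ∑ℝ.sum (λ i → fromℤ (B k i ℤ.* A i l)) * z l
          ≈⟨ ∑ℝ.*-distribʳ-sum (z l) (λ i → fromℤ (B k i ℤ.* A i l)) ⟩
        ∑ℝ.sum (λ i → fromℤ (B k i ℤ.* A i l) * z l)
          ≈⟨ ∑ℝ.sum-cong-≋ {d} (λ i → ≈-trans (*-cong (fromℤ-* (B k i) (A i l)) (≈-refl {z l})) (R.*-assoc (fromℤ (B k i)) (fromℤ (A i l)) (z l))) ⟩
        ∑ℝ.sum (λ i → fromℤ (B k i) * (fromℤ (A i l) * z l)) ∎

-- Backward orbits, cyclic addresses and repetitions.

module _ {d J : ℕ} (F : IFS d J) where
  open IFS F

  -- Denominators do not grow along preimages. Multiplying x = A y / q + b / s by q Q gives A (Q y)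
  -- = q (Q x) - q (Q b / s), which is integral because s divides Q, and the integral inverse of A
  -- recovers Q y.
  preimage-hasDenominator : ∀ {f : ℝ^ d → ℝ^ d} (U : UnimodularMap F f) {Q} → UnimodularMap.s U ∣ Q →
    ∀ {x y} → x ≋ f y → HasDenominator Q x → HasDenominator Q y
  preimage-hasDenominator U {Q} (divides c Q≡cs) {x} {y} x≋fy (mkDenominator p Qx≈p) =
    let p′ , e = unimodular-solve A det-±1 (λ k → fromℕ Q * y k) m Az≈m in mkDenominator p′ e
    where
    open UnimodularMap U
    m : Vector ℤ d
    m i = + q ℤ.* p i ℤ.- + q ℤ.* (+ c ℤ.* b i)
    Ay = (λ i j → fromℤ (A i j)) ·ᵥ y
    Qq⁻¹ : fromℕ q * fromℚ (1ℤ ℚ./ q) ≈ 1ℝ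
    Qq⁻¹ = ≈-trans (≈-sym (fromℚ-* (+ q ℚ./ 1) (1ℤ ℚ./ q))) (fromℚ-cong (*-/-cancel 1ℤ q))
    Qb/s : ∀ i → fromℕ Q * fromℚ (b i ℚ./ s) ≈ fromℤ (+ c ℤ.* b i)
    Qb/s i = begin
      fromℕ Q * fromℚ (b i ℚ./ s)                 ≈⟨ *-cong (≈-trans (≈-reflexive (cong fromℕ Q≡cs)) (fromℕ-* c s)) (≈-refl {fromℚ (b i ℚ./ s)}) ⟩
      fromℕ c * fromℕ s * fromℚ (b i ℚ./ s)       ≈⟨ R.*-assoc (fromℕ c) (fromℕ s) (fromℚ (b i ℚ./ s)) ⟩
      fromℕ c * (fromℕ s * fromℚ (b i ℚ./ s))     ≈⟨ *-cong (≈-refl {fromℕ c}) (≈-trans (≈-sym (fromℚ-* (+ s ℚ./ 1) (b i ℚ./ s))) (fromℚ-cong (*-/-cancel (b i) s))) ⟩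
      fromℕ c * fromℤ (b i)                       ≈⟨ ≈-sym (fromℤ-* (+ c) (b i)) ⟩
      fromℤ (+ c ℤ.* b i)                         ∎
      where open import Relation.Binary.Reasoning.Setoid R.setoid
    pull : ∀ {n} (a : Vector ℝ n) z (v : Vector ℝ n) → ∑ℝ.sum (λ j → a j * (z * v j)) ≈ z * ∑ℝ.sum (λ j → a j * v j)
    pull {n} a z v = ≈-trans (∑ℝ.sum-cong-≋ {n} {λ j → a j * (z * v j)} {λ j → z * (a j * v j)} (λ j → solve 3 (λ a z v → a :* (z :* v) := z :* (a :* v)) ≈-refl (a j) z (v j)))
      (≈-sym (∑ℝ.*-distribˡ-sum z (λ j → a j * v j)))
    Az≈m : ∀ i → ((λ i j → fromℤ (A i j)) ·ᵥ (λ k → fromℕ Q * y k)) i ≈ fromℤ (m i)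
    Az≈m i = begin
      ((λ i j → fromℤ (A i j)) ·ᵥ (λ k → fromℕ Q * y k)) i
        ≈⟨ pull (λ j → fromℤ (A i j)) (fromℕ Q) y ⟩
      fromℕ Q * Ay i
        ≈⟨ ≈-sym (R.*-identityˡ (fromℕ Q * Ay i)) ⟩
      1ℝ * (fromℕ Q * Ay i)
        ≈⟨ *-cong (≈-sym Qq⁻¹) (≈-refl {fromℕ Q * Ay i}) ⟩
      fromℕ q * fromℚ (1ℤ ℚ./ q) * (fromℕ Q * Ay i)
        ≈⟨ solve 5 (λ q r Q a t → q :* r :* (Q :* a) := q :* (Q :* (r :* a :+ t)) :- q :* (Q :* t)) ≈-refl
             (fromℕ q) (fromℚ (1ℤ ℚ./ q)) (fromℕ Q) (Ay i) (fromℚ (b i ℚ./ s)) ⟩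
      fromℕ q * (fromℕ Q * (fromℚ (1ℤ ℚ./ q) * Ay i + fromℚ (b i ℚ./ s))) - fromℕ q * (fromℕ Q * fromℚ (b i ℚ./ s))
        ≈⟨ +-cong (*-cong (≈-refl {fromℕ q}) (≈-trans (*-cong (≈-refl {fromℕ Q}) (≈-sym (≈-trans (x≋fy i) (formula y i)))) (Qx≈p i)))
             (neg-cong (*-cong (≈-refl {fromℕ q}) (Qb/s i))) ⟩
      fromℕ q * fromℤ (p i) - fromℕ q * fromℤ (+ c ℤ.* b i)
        ≈⟨ +-cong (≈-sym (fromℤ-* (+ q) (p i))) (≈-trans (neg-cong (≈-sym (fromℤ-* (+ q) (+ c ℤ.* b i)))) (≈-sym (fromℤ-neg (+ q ℤ.* (+ c ℤ.* b i))))) ⟩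
      fromℤ (+ q ℤ.* p i) + fromℤ (ℤ.- (+ q ℤ.* (+ c ℤ.* b i)))
        ≈⟨ ≈-sym (fromℤ-+ (+ q ℤ.* p i) (ℤ.- (+ q ℤ.* (+ c ℤ.* b i)))) ⟩
      fromℤ (m i) ∎
      where open import Relation.Binary.Reasoning.Setoid R.setoid

  -- Instead of membership in the attractor only a uniform bound is kept, which is what convergence
  -- to the first point and counting use; it passes at once to the cyclic reindexing.
  record Orbit (x : ℕ → ℝ^ d) (ω : ℕ → Fin J) : Set where
    field
      bound   : ℕ
      bounded : ∀ i k → ∣ x i k ∣ ≤ fromℕ bound
      step    : ∀ i → x i ≋ map (ω i) (x (suc i))

  orbit-compose : ∀ {x : ℕ → ℝ^ d} {ω : ℕ → Fin J} → (∀ i → x i ≋ map (ω i) (x (suc i))) → ∀ n → x 0 ≋ compose F ω n (x n)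
  orbit-compose step zero    = ≋-refl
  orbit-compose {x} {ω} step (suc n) = ≋-trans (step 0) (map-cong F (ω 0) (orbit-compose {x ∘ suc} {ω ∘ suc} (step ∘ suc) n))

  module _ {x ω} (O : Orbit x ω) where
    open Orbit O

    -- The first point is the n-fold composition applied to x n, and x n has bounded distance from
    -- 0, so replacing it by 0 costs at most ρ^n times the bound. Half of the gap is spent on this
    -- to keep the inequality strict.
    orbit-isAddress : IsAddress F (x 0) ω
    orbit-isAddress ε 0<ε =
      let g , 0<g , g≤ε = <⇒gap 0<ε
          N , small = pow-small (<⇒≤ (0<ρ F (ω 0))) (ρ<1 F) (Q.ι bound) (½ ℚ.* g) (0<½* {g} 0<g)
      in N , λ n N≤n → ≤-<-trans
        (‖‖-lub {x = compose F ω n 0ᵥ -ᵥ x 0} (fromℚ-mono-≤ (ℚ.<⇒≤ (0<½* {g} 0<g)))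
          (within-weaken {x = compose F ω n 0ᵥ} {x 0} (small n N≤n)
            (within-resp {x = compose F ω n 0ᵥ} {y = compose F ω n (x n)} ≋-refl (≋-sym (orbit-compose {x} {ω} step n))
              (Contracts.shrink (compose-contracts F ω n) {fromℕ bound} {0ᵥ} {x n} (0≤fromℕ bound)
                (λ k → ≤-trans (≈⇒≤ (≈-trans (∣∣-cong (R.+-identityˡ (- x n k))) (∣-x∣≈∣x∣ (x n k)))) (bounded n k))))))
        (gap⇒< (½ ℚ.* g) (0<½* {g} 0<g) (≤-trans (≈⇒≤ (≈-trans (≈-sym (fromℚ-+ (½ ℚ.* g) (½ ℚ.* g))) (fromℚ-cong (Q.half+half g))))
          (≤-trans (≈⇒≥ (R.+-identityˡ (fromℚ g))) g≤ε)))

  -- The indices 0, 1, …, b - 1 followed by the cycle a, a + 1, …, b - 1.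
  module Cycle {a b} (a<b : a ℕ.< b) where

    next : ℕ → ℕ
    next i with suc i ℕ.≟ b
    ... | yes _ = a
    ... | no  _ = suc i

    index : ℕ → ℕ
    index zero    = zero
    index (suc i) = next (index i)

    next-wraps : ∀ {i} → suc i ≡ b → next i ≡ a
    next-wraps {i} e with suc i ℕ.≟ b
    ... | yes _ = refl
    ... | no ≢b = contradiction e ≢b

    index-< : ∀ i → i ℕ.< b → index i ≡ i
    index-< zero    _ = refl
    index-< (suc i) si<b rewrite index-< i (ℕ.<-trans (ℕ.n<1+n i) si<b) with suc i ℕ.≟ b
    ... | yes si≡b = contradiction si≡b (ℕ.<⇒≢ si<b)
    ... | no _     = refl

    index-b : ∀ {b′} → b′ ≡ b → index b′ ≡ a
    index-b {zero}   refl = contradiction a<b ℕ.n≮0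
    index-b {suc b′} refl = ≡.trans (cong next (index-< b′ (ℕ.n<1+n b′))) (next-wraps refl)

    -- `next` sees only the current index, so the agreement of `index` at a and b propagates to all
    -- later places.
    index-periodic : ∀ i → a ℕ.≤ i → index (i ℕ.+ (b ℕ.∸ a)) ≡ index i
    index-periodic i a≤i = subst (λ i → index (i ℕ.+ (b ℕ.∸ a)) ≡ index i) (ℕ.m∸n+n≡m a≤i) (from-a (i ℕ.∸ a))
      where
      from-a : ∀ k → index (k ℕ.+ a ℕ.+ (b ℕ.∸ a)) ≡ index (k ℕ.+ a)
      from-a zero    = ≡.trans (index-b (ℕ.m+[n∸m]≡n (ℕ.<⇒≤ a<b))) (≡.sym (index-< a a<b))
      from-a (suc k) = cong next (from-a k)

  module _ {x ω} (O : Orbit x ω) {a b} (a<b : a ℕ.< b) (return : x a ≋ x b) where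
    open Orbit O
    open Cycle a<b

    cyclicOrbit : Orbit (x ∘ index) (ω ∘ index)
    cyclicOrbit = record
      { bound = bound ; bounded = bounded ∘ index
      ; step = λ i → ≋-trans (step (index i)) (map-cong F (ω (index i)) (x-next (index i))) }
      where
      x-next : ∀ i → x (suc i) ≋ x (next i)
      x-next i with suc i ℕ.≟ b
      ... | yes refl = ≋-sym return
      ... | no  _    = ≋-refl

    cyclicAddress : UltimatelyPeriodicAddress F (x 0)
    cyclicAddress = record
      { ω = ω ∘ index ; isAddress = orbit-isAddress cyclicOrbit
      ; preperiod = a ; period = b ℕ.∸ a ; period≢0 = ℕ.>-nonZero (ℕ.m<n⇒0<n∸m a<b)
      ; periodic = λ i a≤i → cong ω (index-periodic i a≤i) }

    cyclicAddress-length : UltimatelyPeriodicAddress.totalLength cyclicAddress ≡ b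
    cyclicAddress-length = ℕ.m+[n∸m]≡n (ℕ.<⇒≤ a<b)

  Return : (ℕ → ℝ^ d) → ℕ → Set
  Return x L = ∃₂ λ a b → a ℕ.< b × b ℕ.≤ L × x a ≋ x b

  -- The L + 1 points with indices 0 to L share L codes, so the later index of the repetition is at
  -- most L.
  pigeonhole-return : ∀ {x L} (code : ℕ → Fin L) → (∀ i j → code i ≡ code j → x i ≋ x j) → Return x L
  pigeonhole-return {x} {L} code decode =
    let i , j , i<j , e = Fin.pigeonhole (ℕ.n<1+n L) (λ (i : Fin (suc L)) → code (toℕ i)) in
    toℕ i , toℕ j , i<j , ℕ.s≤s⁻¹ (Fin.toℕ<n j) , decode (toℕ i) (toℕ j) e

  module _ {x ω} (O : Orbit x ω) (Q : ℕ) {{_ : NonZero Q}} (denominator : ∀ i → HasDenominator Q (x i)) where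
    open Orbit O

    private
      p : ℕ → Vector ℤ d
      p i = HasDenominator.numerator (denominator i)
      Qx≈p : ∀ i k → fromℕ Q * x i k ≈ fromℤ (p i k)
      Qx≈p i = HasDenominator.scaled (denominator i)

    numerators-determine : ∀ i j → (∀ k → p i k ≡ p j k) → x i ≋ x j
    numerators-determine i j e k = fromℕ-cancelˡ {d} Q
      (≈-trans (Qx≈p i k) (≈-trans (fromℚ-cong (cong (ℚ._/ 1) (e k))) (≈-sym (Qx≈p j k))))

    -- The number of integers from -H to H with H = Q times the bound, the range of each numerator.
    boxSize : ℕ
    boxSize = suc (Q ℕ.* bound ℕ.+ Q ℕ.* bound)

    box-return : Return x (boxSize ^ d)
    box-return = pigeonhole-return (λ i → Fin.funToFin (λ k → encode (p i k) (p≤H i k))) λ i j e →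
      numerators-determine i j λ k → encode-injective (p i k) (p j k) (p≤H i k) (p≤H j k)
        (≡.trans (≡.sym (Fin.finToFun-funToFin _ k)) (≡.trans (cong (λ c → Fin.finToFun c k) e) (Fin.finToFun-funToFin _ k)))
      where
      H = Q ℕ.* bound
      p≤H : ∀ i k → ℤ.∣ p i k ∣ ℕ.≤ H
      p≤H i k = ∣fromℤ∣≤⇒∣∣≤ (p i k) (begin
        ∣ fromℤ (p i k) ∣             ≈⟨ ∣∣-cong (≈-sym (Qx≈p i k)) ⟩
        ∣ fromℕ Q * x i k ∣           ≈⟨ ≈-termwise (λ n → ℚ.∣p*q∣≡∣p∣*∣q∣ (Q.ι Q) (seq (x i k) n)) ⟩
        ∣ fromℕ Q ∣ * ∣ x i k ∣       ≈⟨ *-cong (≈-sym (≈∣∣ (0≤fromℕ Q))) (≈-refl {∣ x i k ∣}) ⟩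
        fromℕ Q * ∣ x i k ∣           ≤⟨ *-monoˡ-≤ (fromℕ Q) (0≤fromℕ Q) (bounded i k) ⟩
        fromℕ Q * fromℕ bound         ≈⟨ ≈-sym (fromℕ-* Q bound) ⟩
        fromℕ H                       ∎)
        where open ≤-Reasoning
      shift-bound : ∀ z → ℤ.∣ z ∣ ℕ.≤ H → ℤ.∣ z ℤ.+ + H ∣ ℕ.< boxSize
      shift-bound z h = ℕ.s≤s (ℕ.≤-trans (ℤ.∣i+j∣≤∣i∣+∣j∣ z (+ H)) (ℕ.+-monoˡ-≤ H h))
      encode : ∀ z → ℤ.∣ z ∣ ℕ.≤ H → Fin boxSize
      encode z h = Fin.fromℕ< (shift-bound z h)
      shift-nonNeg : ∀ z → ℤ.∣ z ∣ ℕ.≤ H → + ℤ.∣ z ℤ.+ + H ∣ ≡ z ℤ.+ + H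
      shift-nonNeg (+ n)      h = refl
      shift-nonNeg ℤ.-[1+ n ] h = ℤ.0≤i⇒+∣i∣≡i (subst (0ℤ ℤ.≤_) (≡.sym (ℤ.⊖-≥ h)) (ℤ.+≤+ ℕ.z≤n))
      encode-injective : ∀ z w h k → encode z h ≡ encode w k → z ≡ w
      encode-injective z w h k e = Algebra.Properties.Group.∙-cancelʳ (CommutativeRing.+-group ℤ.+-*-commutativeRing) (+ H) z w (≡.trans (≡.sym (shift-nonNeg z h)) (≡.trans
        (cong +_ (≡.trans (≡.sym (Fin.toℕ-fromℕ< (shift-bound z h))) (≡.trans (cong toℕ e) (Fin.toℕ-fromℕ< (shift-bound w k)))))
        (shift-nonNeg w k)))

    -- Points of (1/Q)ℤᵈ in one cylinder of diameter below 1/Q coincide.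
    word-return : ∀ n → ρ F ^ᴿ n * fromℕ (Q ℕ.* (bound ℕ.+ bound)) < 1ℝ → Return x (J ^ n)
    word-return n small = pigeonhole-return (λ i → Fin.funToFin (word i)) λ i j e →
      numerators-determine i j λ k → close⇒≡ (≤-<-trans (close i j (λ l → ≡.trans (≡.sym (Fin.finToFun-funToFin (word i) l))
        (≡.trans (cong (λ c → Fin.finToFun c l) e) (Fin.finToFun-funToFin (word j) l))) k) small)
      where
      open ≤-Reasoning
      word : ℕ → Fin n → Fin J
      word i l = ω (i ℕ.+ toℕ l)
      -- Twice the bound dominates the distance of any two points of the orbit.
      D = fromℕ (bound ℕ.+ bound)
      unfold : ∀ i → x i ≋ compose F (λ l → ω (i ℕ.+ l)) n (x (i ℕ.+ n))
      unfold i = subst (λ m → x m ≋ compose F (λ l → ω (i ℕ.+ l)) n (x (i ℕ.+ n))) (ℕ.+-identityʳ i)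
        (orbit-compose {λ l → x (i ℕ.+ l)} {λ l → ω (i ℕ.+ l)}
          (λ l → subst (λ m → x (i ℕ.+ l) ≋ map (ω (i ℕ.+ l)) (x m)) (≡.sym (ℕ.+-suc i l)) (step (i ℕ.+ l))) n)
      bounded-apart : ∀ i j → Within D (x i) (x j)
      bounded-apart i j k = ≤-trans (∣x+y∣≤∣x∣+∣y∣ (x i k) (- x j k)) (≤-trans
        (+-mono-≤ (bounded i k) (≤-trans (≈⇒≤ (∣-x∣≈∣x∣ (x j k))) (bounded j k))) (≈⇒≥ (fromℕ-+ bound bound)))
      same-word : ∀ i j → (∀ l → word i l ≡ word j l) → Within (ρ F ^ᴿ n * D) (x i) (x j)
      same-word i j e = within-resp {x = compose F (λ l → ω (i ℕ.+ l)) n (x (i ℕ.+ n))} {y = compose F (λ l → ω (i ℕ.+ l)) n (x (j ℕ.+ n))}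
        (≋-sym (unfold i))
        (≋-trans (compose-≗ F n (λ l l<n → subst (λ l → ω (i ℕ.+ l) ≡ ω (j ℕ.+ l)) (Fin.toℕ-fromℕ< l<n) (e (Fin.fromℕ< l<n))) (x (j ℕ.+ n)))
          (≋-sym (unfold j)))
        (Contracts.shrink (compose-contracts F (λ l → ω (i ℕ.+ l)) n) {D} {x (i ℕ.+ n)} {x (j ℕ.+ n)} (0≤fromℕ (bound ℕ.+ bound)) (bounded-apart (i ℕ.+ n) (j ℕ.+ n)))
      close : ∀ i j → (∀ l → word i l ≡ word j l) → ∀ k → ∣ fromℤ (p i k) - fromℤ (p j k) ∣ ≤ ρ F ^ᴿ n * fromℕ (Q ℕ.* (bound ℕ.+ bound))
      close i j e k = begin
        ∣ fromℤ (p i k) - fromℤ (p j k) ∣         ≈⟨ ∣∣-cong (+-cong (≈-sym (Qx≈p i k)) (neg-cong (≈-sym (Qx≈p j k)))) ⟩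
        ∣ fromℕ Q * x i k - fromℕ Q * x j k ∣     ≈⟨ ∣∣-cong (solve 3 (λ q a b → q :* a :- q :* b := q :* (a :- b)) ≈-refl (fromℕ Q) (x i k) (x j k)) ⟩
        ∣ fromℕ Q * (x i k - x j k) ∣             ≈⟨ ≈-termwise (λ n → ℚ.∣p*q∣≡∣p∣*∣q∣ (Q.ι Q) (seq (x i k) n ℚ.- seq (x j k) n)) ⟩
        ∣ fromℕ Q ∣ * ∣ x i k - x j k ∣           ≈⟨ *-cong (≈-sym (≈∣∣ (0≤fromℕ Q))) (≈-refl {∣ x i k - x j k ∣}) ⟩
        fromℕ Q * ∣ x i k - x j k ∣               ≤⟨ *-monoˡ-≤ (fromℕ Q) (0≤fromℕ Q) (same-word i j e k) ⟩
        fromℕ Q * (ρ F ^ᴿ n * D)                  ≈⟨ solve 3 (λ q r d → q :* (r :* d) := r :* (q :* d)) ≈-refl (fromℕ Q) (ρ F ^ᴿ n) D ⟩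
        ρ F ^ᴿ n * (fromℕ Q * D)                  ≈⟨ *-cong (≈-refl {ρ F ^ᴿ n}) (≈-sym (fromℕ-* Q (bound ℕ.+ bound))) ⟩
        ρ F ^ᴿ n * fromℕ (Q ℕ.* (bound ℕ.+ bound)) ∎

-- Boundedness of the attractor, denominators and minima.

abstract
  -- Open balls of integer radius about 0 cover everything. The sum of the radii in a finite
  -- subcover bounds each of them.
  attractor-bounded : ∀ {d} {C : Pred (ℝ^ d) 0ℓ} → Compact C → ∃ λ M → ∀ x → x ∈ C → ∀ k → ∣ x k ∣ ≤ fromℕ M
  attractor-bounded {d} {C} compact =
    let ns , cover = compact ℕ Ball Ball-open covered in
    ListAction.sum ns , λ x x∈C k → ≤-trans (∣∣≤‖‖ x k) (below-sum ns (cover x x∈C))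
    where
    Ball : ℕ → Pred (ℝ^ d) 0ℓ
    Ball n x = ‖ x ‖ < fromℕ n
    Ball-open : ∀ n → Open (Ball n)
    Ball-open n x x<n =
      let g , 0<g , h = <⇒gap x<n in
      fromℚ g , fromℚ-mono-< 0<g , λ y y-x<g → let e , 0<e , k = <⇒gap y-x<g in gap⇒< e 0<e (begin
        ‖ y ‖ + fromℚ e                       ≤⟨ +-mono-≤ (‖‖-lub {x = y} (+-nonNeg (0≤‖‖ (y -ᵥ x)) (0≤‖‖ x)) (triangle y x)) (≤-refl {fromℚ e}) ⟩
        ‖ y -ᵥ x ‖ + ‖ x ‖ + fromℚ e          ≈⟨ solve 3 (λ a b e → a :+ b :+ e := b :+ (a :+ e)) ≈-refl (‖ y -ᵥ x ‖) (‖ x ‖) (fromℚ e) ⟩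
        ‖ x ‖ + (‖ y -ᵥ x ‖ + fromℚ e)        ≤⟨ +-mono-≤ (≤-refl {‖ x ‖}) k ⟩
        ‖ x ‖ + fromℚ g                       ≤⟨ h ⟩
        fromℕ n                               ∎)
      where
      open ≤-Reasoning
      triangle : ∀ (y x : ℝ^ d) i → ∣ y i ∣ ≤ ‖ y -ᵥ x ‖ + ‖ x ‖
      triangle y x i = ≤-trans (≈⇒≤ (∣∣-cong (solve 2 (λ y x → y := y :- x :+ x) ≈-refl (y i) (x i))))
        (≤-trans (∣x+y∣≤∣x∣+∣y∣ (y i - x i) (x i)) (+-mono-≤ (∣∣≤‖‖ (y -ᵥ x) i) (∣∣≤‖‖ x i)))
    covered : ∀ x → x ∈ C → ∃ λ n → x ∈ Ball n
    covered x _ = let n , h = bounded-above ‖ x ‖ in suc n , gap⇒< 1ℚ Q.0<1 (≤-trans (+-mono-≤ h (≤-refl {1ℝ}))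
      (≈⇒≤ (≈-trans (R.+-comm (fromℕ n) 1ℝ) (≈-sym (fromℕ-suc n)))))
    below-sum : ∀ ns {x} → Any (λ n → x ∈ Ball n) ns → ‖ x ‖ ≤ fromℕ (ListAction.sum ns)
    below-sum (n List.∷ ns) (here h)  = ≤-trans (<⇒≤ h) (fromℕ-mono-≤ (ℕ.m≤m+n n (ListAction.sum ns)))
    below-sum (n List.∷ ns) (there h) = ≤-trans (below-sum ns h) (fromℕ-mono-≤ (ℕ.m≤n+m (ListAction.sum ns) n))

∏ : ∀ {n} → Vector ℕ n → ℕ
∏ = foldr ℕ._*_ 1

∏-nonZero : ∀ {n} (v : Vector ℕ n) → (∀ i → NonZero (v i)) → NonZero (∏ v)
∏-nonZero {zero}  v h = _
∏-nonZero {suc n} v h = ℕ.m*n≢0 (v zero) (∏ (v ∘ suc)) {{h zero}} {{∏-nonZero (v ∘ suc) (h ∘ suc)}}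

∣∏ : ∀ {n} (v : Vector ℕ n) i → v i ∣ ∏ v
∣∏ v zero    = ∣.m∣m*n (∏ (v ∘ suc))
∣∏ v (suc i) = ∣.∣n⇒∣m*n (v zero) (∣∏ (v ∘ suc) i)

rational-hasDenominator : ∀ {d} {x : ℝ^ d} → Rational x → ∃ λ q → NonZero q × HasDenominator q x
rational-hasDenominator {d} {x} (r , x≋r) = ∏ q , ∏-nonZero q (λ i → _) , mkDenominator (λ i → + ∣.quotient (∣∏ q i) ℤ.* ℚ.↥ r i) scaled
  where
  q : Vector ℕ d
  q i = ℚ.↧ₙ r i
  scaled : ∀ i → fromℕ (∏ q) * x i ≈ fromℤ (+ ∣.quotient (∣∏ q i) ℤ.* ℚ.↥ r i)
  scaled i = begin
    fromℕ (∏ q) * x i                               ≈⟨ *-cong (≈-trans (≈-reflexive (cong fromℕ (∣.m∣n⇒n≡quotient*m (∣∏ q i)))) (fromℕ-* c (q i)))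
                                                         (≈-trans (x≋r i) (fromℚ-cong (≡.sym (ℚ.↥p/↧p≡p (r i))))) ⟩
    fromℕ c * fromℕ (q i) * fromℚ (ℚ.↥ r i ℚ./ q i) ≈⟨ R.*-assoc (fromℕ c) (fromℕ (q i)) (fromℚ (ℚ.↥ r i ℚ./ q i)) ⟩
    fromℕ c * (fromℕ (q i) * fromℚ (ℚ.↥ r i ℚ./ q i)) ≈⟨ *-cong (≈-refl {fromℕ c})
                                                         (≈-trans (≈-sym (fromℚ-* (+ q i ℚ./ 1) (ℚ.↥ r i ℚ./ q i))) (fromℚ-cong (*-/-cancel (ℚ.↥ r i) (q i)))) ⟩
    fromℕ c * fromℤ (ℚ.↥ r i)                       ≈⟨ ≈-sym (fromℤ-* (+ c) (ℚ.↥ r i)) ⟩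
    fromℤ (+ c ℤ.* ℚ.↥ r i)                         ∎
    where
    open import Relation.Binary.Reasoning.Setoid R.setoid
    c = ∣.quotient (∣∏ q i)

^-distribʳ-* : ∀ m n o → (m ℕ.* n) ^ o ≡ m ^ o ℕ.* n ^ o
^-distribʳ-* m n zero    = refl
^-distribʳ-* m n (suc o) = ≡.trans (cong (m ℕ.* n ℕ.*_) (^-distribʳ-* m n o)) (ℕ.[m*n]*[o*p]≡[m*o]*[n*p] m n (m ^ o) (n ^ o))

fromℕ-^ : ∀ m n → fromℕ (m ^ n) ≈ fromℕ m ^ᴿ n
fromℕ-^ m zero    = ≈-refl
fromℕ-^ m (suc n) = ≈-trans (fromℕ-* m (m ^ n)) (*-cong (≈-refl {fromℕ m}) (fromℕ-^ m n))

-- The two bounds come from different addresses, but the final estimate wants one address below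
-- both. Natural numbers k and l can be compared, and the address with the smaller bound meets both.
shorter : ∀ {A : Set} (length : A → ℕ) {k l} → (Σ A λ a → length a ℕ.≤ k) → (Σ A λ a → length a ℕ.≤ l) →
  Σ A λ a → length a ℕ.≤ k × length a ℕ.≤ l
shorter length {k} {l} (a , a≤k) (b , b≤l) =
  [ (λ k≤l → a , a≤k , ℕ.≤-trans a≤k k≤l) , (λ l≤k → b , ℕ.≤-trans b≤l l≤k , b≤l) ]′ (ℕ.≤-total k l)

fromℕ-*-⊓ : ∀ k x y → (fromℕ k * x) ⊓ (fromℕ k * y) ≤ fromℕ k * (x ⊓ y)
fromℕ-*-⊓ k x y = ≤-termwise λ n → ℚ.≤-reflexive (≡.sym
  (ℚ.*-distribˡ-⊓-nonNeg (Q.ι k) {{ℚ.nonNegative (Q.ι-mono {0} {k} ℕ.z≤n)}} (seq x n) (seq y n)))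

-- Addresses of rational points and their length.

module _ {d J : ℕ} (F : IFS d J) {C : Pred (ℝ^ d) 0ℓ} (attractor : IsAttractor F C) where
  open IFS F
  open IsAttractor attractor

  private
    M : ℕ
    M = proj₁ (attractor-bounded compact)

    C-bounded : ∀ x → x ∈ C → ∀ k → ∣ x k ∣ ≤ fromℕ M
    C-bounded = proj₂ (attractor-bounded compact)

    preimage : ∀ x → x ∈ C → ∃₂ λ j y → y ∈ C × x ≋ map j y
    preimage x = Equivalence.to (invariant x)

    digit₀ : Fin J
    digit₀ = proj₁ (preimage (proj₁ nonempty) (proj₂ nonempty))

    0≤ρ : 0ℝ ≤ ρ F
    0≤ρ = <⇒≤ (0<ρ F digit₀)

    instance
      J≢0 : NonZero J
      J≢0 = Fin.nonZeroIndex digit₀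

    module _ (ξ : ℝ^ d) (ξ∈C : ξ ∈ C) where

      points : ℕ → ∃ C
      points zero    = ξ , ξ∈C
      points (suc i) = let x , x∈C = points i ; _ , y , y∈C , _ = preimage x x∈C in y , y∈C

      digits : ℕ → Fin J
      digits i = let x , x∈C = points i in proj₁ (preimage x x∈C)

      orbit : Orbit F (proj₁ ∘ points) digits
      orbit = record
        { bound = M
        ; bounded = λ i → C-bounded (proj₁ (points i)) (proj₂ (points i))
        ; step = λ i → let x , x∈C = points i in proj₂ (proj₂ (proj₂ (preimage x x∈C))) }

  module _ (unimodular : Unimodular F) where

    private
      S : ℕ
      S = ∏ (UnimodularMap.s ∘ unimodular)

      instance
        S≢0 : NonZero S
        S≢0 = ∏-nonZero (UnimodularMap.s ∘ unimodular) (UnimodularMap.s≢0 ∘ unimodular)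

      module _ (ξ : ℝ^ d) (ξ∈C : ξ ∈ C) (q : ℕ) {{_ : NonZero q}} (ξ-den : HasDenominator q ξ) where

        instance
          qS≢0 : NonZero (q ℕ.* S)
          qS≢0 = ℕ.m*n≢0 q S

        denominators : ∀ i → HasDenominator (q ℕ.* S) (proj₁ (points ξ ξ∈C i))
        denominators zero    = hasDenominator-* S ξ-den
        denominators (suc i) = preimage-hasDenominator F (unimodular (digits ξ ξ∈C i))
          (∣.∣n⇒∣m*n q (∣∏ (UnimodularMap.s ∘ unimodular) (digits ξ ξ∈C i))) (Orbit.step (orbit ξ ξ∈C) i) (denominators i)

        address : ∀ {L} → Return F (proj₁ ∘ points ξ ξ∈C) L →
          Σ (UltimatelyPeriodicAddress F ξ) λ a → UltimatelyPeriodicAddress.totalLength a ℕ.≤ L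
        address (a , b , a<b , b≤L , e) = cyclicAddress F (orbit ξ ξ∈C) a<b e ,
          ℕ.≤-trans (ℕ.≤-reflexive (cyclicAddress-length F (orbit ξ ξ∈C) a<b e)) b≤L

        boxes : ℕ
        boxes = suc (q ℕ.* S ℕ.* M ℕ.+ q ℕ.* S ℕ.* M) ^ d

        abstract
          box-address : Σ (UltimatelyPeriodicAddress F ξ) λ a → UltimatelyPeriodicAddress.totalLength a ℕ.≤ boxes
          box-address = address (box-return F (orbit ξ ξ∈C) (q ℕ.* S) denominators)

          word-address : ∀ n → ρ F ^ᴿ n * fromℕ (q ℕ.* S ℕ.* (M ℕ.+ M)) < 1ℝ →
            Σ (UltimatelyPeriodicAddress F ξ) λ a → UltimatelyPeriodicAddress.totalLength a ℕ.≤ J ^ n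
          word-address n small = address (word-return F (orbit ξ ξ∈C) (q ℕ.* S) denominators n small)

          shorter-address : ∀ n → ρ F ^ᴿ n * fromℕ (q ℕ.* S ℕ.* (M ℕ.+ M)) < 1ℝ →
            Σ (UltimatelyPeriodicAddress F ξ) λ a →
              UltimatelyPeriodicAddress.totalLength a ℕ.≤ J ^ n × UltimatelyPeriodicAddress.totalLength a ℕ.≤ boxes
          shorter-address n small = shorter UltimatelyPeriodicAddress.totalLength (word-address n small) box-address

    rational⇒ultimatelyPeriodic : ∀ ξ → ξ ∈ C → Rational ξ → UltimatelyPeriodicAddress F ξ
    rational⇒ultimatelyPeriodic ξ ξ∈C rational =
      let q , q≢0 , ξ-den = rational-hasDenominator rational in proj₁ (box-address ξ ξ∈C q {{q≢0}} ξ-den)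

    module _ (D : ℝ) (exponent : IsExponent F D) where

      private
        logJ logρ : ℝ
        logJ = proj₁ exponent
        logρ = proj₁ (proj₂ exponent)

        exp-logJ : exp logJ ≈ fromℕ J
        exp-logJ = proj₁ (proj₂ (proj₂ exponent))

        exp-logρ : exp logρ ≈ ρ F
        exp-logρ = proj₁ (proj₂ (proj₂ (proj₂ exponent)))

        D-logρ : D * logρ ≈ - logJ
        D-logρ = proj₂ (proj₂ (proj₂ (proj₂ exponent)))

        0≤logJ : 0ℝ ≤ logJ
        0≤logJ = exp-cancel-≤ (≤-trans (≈⇒≤ exp-0) (≤-trans (fromℕ-mono-≤ (ℕ.>-nonZero⁻¹ J)) (≈⇒≥ exp-logJ)))

        -- Suppose D < 0. Then log ρ < 0 would make D log ρ positive, against D log ρ = -log J ≤ 0;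
        -- so log ρ ≥ 0 and ρ ≥ 1, against ρ < 1.
        0≤D : 0ℝ ≤ D
        0≤D = ≮⇒≥ λ D<0 → ≤⇒≯ (≤-trans (≈⇒≥ exp-0) (≤-trans (exp-mono-≤ (≮⇒≥ (λ logρ<0 → ≤⇒≯ nonpositive (positive D<0 logρ<0)))) (≈⇒≤ exp-logρ))) (ρ<1 F)
          where
          nonpositive : D * logρ ≤ 0ℝ
          nonpositive = ≤-trans (≈⇒≤ D-logρ) (≤-trans (neg-mono-≤ 0≤logJ) (≈⇒≤ -0≈0))
          0<- : ∀ {x} → x < 0ℝ → 0ℝ < - x
          0<- {x} h = let g , 0<g , k = <⇒gap h in gap⇒< g 0<g (≤-trans
            (≈⇒≤ (solve 2 (λ x g → con 0ℚ :+ g := :- x :+ (x :+ g)) ≈-refl x (fromℚ g)))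
            (≤-trans (+-mono-≤ (≤-refl { - x}) k) (≈⇒≤ (R.+-identityʳ (- x)))))
          positive : D < 0ℝ → logρ < 0ℝ → 0ℝ < D * logρ
          positive h k = <-≤-trans (*-pos (0<- h) (0<- k)) (≈⇒≤ (solve 2 (λ a b → :- a :* :- b := a :* b) ≈-refl D logρ))

        -- Logarithms turn the hypothesis into m log ρ ≤ log q + n log ρ. Multiplied by D ≥ 0, with
        -- D log ρ = -log J, it reads n log J ≤ m log J + D log q.
        word-count : ∀ m n q l → exp l ≈ fromℕ q → ρ F ^ᴿ m ≤ fromℕ q * ρ F ^ᴿ n → fromℕ (J ^ n) ≤ fromℕ (J ^ m) * exp (D * l)
        word-count m n q l exp-l h = begin
          fromℕ (J ^ n)                               ≈⟨ J^ n ⟩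
          exp (fromℕ n * logJ)                        ≤⟨ exp-mono-≤ exponents ⟩
          exp (fromℕ m * logJ + D * l)                ≈⟨ exp-+ (fromℕ m * logJ) (D * l) ⟩
          exp (fromℕ m * logJ) * exp (D * l)          ≈⟨ *-cong (≈-sym (J^ m)) (≈-refl {exp (D * l)}) ⟩
          fromℕ (J ^ m) * exp (D * l)                 ∎
          where
          open ≤-Reasoning
          J^ : ∀ n → fromℕ (J ^ n) ≈ exp (fromℕ n * logJ)
          J^ n = ≈-trans (fromℕ-^ J n) (≈-trans (^ᴿ-cong (≈-sym exp-logJ) n) (≈-sym (exp-^ logJ n)))
          ρ^ : ∀ n → exp (fromℕ n * logρ) ≈ ρ F ^ᴿ n
          ρ^ n = ≈-trans (exp-^ logρ n) (^ᴿ-cong exp-logρ n)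
          logs : fromℕ m * logρ ≤ l + fromℕ n * logρ
          logs = exp-cancel-≤ (≤-trans (≈⇒≤ (ρ^ m)) (≤-trans h
            (≈⇒≥ (≈-trans (exp-+ l (fromℕ n * logρ)) (*-cong exp-l (ρ^ n))))))
          D-logs : ∀ n → D * (fromℕ n * logρ) ≈ - (fromℕ n * logJ)
          D-logs n = ≈-trans (solve 3 (λ d n r → d :* (n :* r) := n :* (d :* r)) ≈-refl D (fromℕ n) logρ)
            (≈-trans (*-cong (≈-refl {fromℕ n}) D-logρ) (solve 2 (λ n j → n :* :- j := :- (n :* j)) ≈-refl (fromℕ n) logJ))
          exponents : fromℕ n * logJ ≤ fromℕ m * logJ + D * l
          exponents = begin
            fromℕ n * logJ
              ≈⟨ solve 2 (λ a b → a := a :+ b :+ :- b) ≈-refl (fromℕ n * logJ) (fromℕ m * logJ) ⟩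
            fromℕ n * logJ + fromℕ m * logJ + - (fromℕ m * logJ)
              ≈⟨ +-cong (≈-refl {fromℕ n * logJ + fromℕ m * logJ}) (≈-sym (D-logs m)) ⟩
            fromℕ n * logJ + fromℕ m * logJ + D * (fromℕ m * logρ)
              ≤⟨ +-mono-≤ (≤-refl {fromℕ n * logJ + fromℕ m * logJ}) (*-monoˡ-≤ D 0≤D logs) ⟩
            fromℕ n * logJ + fromℕ m * logJ + D * (l + fromℕ n * logρ)
              ≈⟨ +-cong (≈-refl {fromℕ n * logJ + fromℕ m * logJ}) (≈-trans (R.distribˡ D l (fromℕ n * logρ)) (+-cong (≈-refl {D * l}) (D-logs n))) ⟩
            fromℕ n * logJ + fromℕ m * logJ + (D * l + - (fromℕ n * logJ))
              ≈⟨ solve 3 (λ a b e → a :+ b :+ (e :+ :- a) := b :+ e) ≈-refl (fromℕ n * logJ) (fromℕ m * logJ) (D * l) ⟩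
            fromℕ m * logJ + D * l ∎

        -- The common denominator q S times the diameter bound 2M, with q taken out.
        c : ℕ
        c = S ℕ.* (M ℕ.+ M)

        abstract
          small-power : ∃ λ m → ρ F ^ᴿ m * fromℕ (4 ℕ.* c) ≤ 1ℝ
          small-power = let m , h = pow-vanishes 0≤ρ (ρ<1 F) (Q.ι (4 ℕ.* c)) in m , h m ℕ.≤-refl

        -- Independent of q: the power from `small-power` absorbs the constant 4c, and the
        -- additional factor ρ pays for the step from the last failing length to the one found.
        m : ℕ
        m = suc (proj₁ small-power)

        -- The search wants a value at most ½, hence below 1. That a length fails this cannot be
        -- decided for reals, so `separate` certifies the weaker fact that the value exceeds ¼.
        ¼ : ℚ
        ¼ = ½ ℚ.* ½

        -- The first length at which the cylinders separate the points in question.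
        search : ∀ T N → ρ F ^ᴿ N * fromℕ T ≤ fromℚ ½ →
          ∃ λ n → ρ F ^ᴿ n * fromℕ T ≤ fromℚ ½ × (n ≡ 0 ⊎ ∃ λ n′ → n ≡ suc n′ × fromℚ ¼ < ρ F ^ᴿ n′ * fromℕ T)
        search T zero    h = 0 , h , inj₁ refl
        search T (suc N) h = [ search T N , (λ k → suc N , h , inj₂ (N , refl , k)) ]′
          (separate (ρ F ^ᴿ N * fromℕ T) {¼} {½} (ℚ.*<* (ℤ.+<+ (ℕ.s≤s (ℕ.s≤s (ℕ.s≤s ℕ.z≤n))))))

        abstract
          -- The length is large enough to separate points with denominator q S, yet not much
          -- larger: for n = n′ + 1 the failure at n′ gives 1 < 4 ρ^n′ q c, and multiplying by ρ^m
          -- and using ρ^(m - 1) 4 c ≤ 1 leaves q ρ^n.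
          word-length : ∀ q {{_ : NonZero q}} → ∃ λ n →
            ρ F ^ᴿ n * fromℕ (q ℕ.* c) < 1ℝ × ρ F ^ᴿ m ≤ fromℕ q * ρ F ^ᴿ n
          word-length q =
            let N , h = pow-small 0≤ρ (ρ<1 F) (Q.ι (q ℕ.* c)) ½ Q.pos-½
                n , small , minimal = search (q ℕ.* c) N (h N ℕ.≤-refl)
            in n , ≤-<-trans small (fromℚ-mono-< (ℚ.*<* (ℤ.+<+ (ℕ.s≤s (ℕ.s≤s ℕ.z≤n))))) , large n minimal
            where
            large : ∀ n → n ≡ 0 ⊎ (∃ λ n′ → n ≡ suc n′ × fromℚ ¼ < ρ F ^ᴿ n′ * fromℕ (q ℕ.* c)) → ρ F ^ᴿ m ≤ fromℕ q * ρ F ^ᴿ n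
            -- At length 0 no shorter length has failed, but ρ^m ≤ 1 ≤ q.
            large n (inj₁ refl) = ≤-trans (x^n≤1 0≤ρ (<⇒≤ (ρ<1 F)) m) (≤-trans (fromℕ-mono-≤ (ℕ.>-nonZero⁻¹ q)) (≈⇒≥ (R.*-identityʳ (fromℕ q))))
            large n (inj₂ (n′ , refl , ¼<)) = begin
              ρ F * r
                ≈⟨ ≈-sym (R.*-identityʳ (ρ F * r)) ⟩
              ρ F * r * 1ℝ
                ≈⟨ *-cong (≈-refl {ρ F * r}) (≈-termwise λ _ → refl) ⟩
              ρ F * r * (fromℕ 4 * fromℚ ¼)
                ≤⟨ *-monoˡ-≤ (ρ F * r) (*-nonNeg 0≤ρ (^ᴿ-nonNeg 0≤ρ (proj₁ small-power))) (*-monoˡ-≤ (fromℕ 4) (0≤fromℕ 4) (<⇒≤ ¼<)) ⟩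
              ρ F * r * (fromℕ 4 * (ρ F ^ᴿ n′ * fromℕ (q ℕ.* c)))
                ≈⟨ *-cong (≈-refl {ρ F * r}) (*-cong (≈-refl {fromℕ 4}) (*-cong (≈-refl {ρ F ^ᴿ n′}) (fromℕ-* q c))) ⟩
              ρ F * r * (fromℕ 4 * (ρ F ^ᴿ n′ * (fromℕ q * fromℕ c)))
                ≈⟨ solve 6 (λ a r f p q c → a :* r :* (f :* (p :* (q :* c))) := q :* (a :* p) :* (r :* (f :* c))) ≈-refl (ρ F) r (fromℕ 4) (ρ F ^ᴿ n′) (fromℕ q) (fromℕ c) ⟩
              fromℕ q * (ρ F * ρ F ^ᴿ n′) * (r * (fromℕ 4 * fromℕ c))
                ≤⟨ *-monoˡ-≤ (fromℕ q * (ρ F * ρ F ^ᴿ n′)) (*-nonNeg (0≤fromℕ q) (^ᴿ-nonNeg 0≤ρ (suc n′)))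
                     (≤-trans (≈⇒≤ (*-cong (≈-refl {r}) (≈-sym (fromℕ-* 4 c)))) (proj₂ small-power)) ⟩
              fromℕ q * (ρ F * ρ F ^ᴿ n′) * 1ℝ
                ≈⟨ R.*-identityʳ (fromℕ q * (ρ F * ρ F ^ᴿ n′)) ⟩
              fromℕ q * (ρ F * ρ F ^ᴿ n′) ∎
              where
              open ≤-Reasoning
              r : ℝ
              r = ρ F ^ᴿ proj₁ small-power

        -- Since q ≥ 1, the side 2 q S M + 1 of the box is at most q times this constant.
        E : ℕ
        E = suc (S ℕ.* M ℕ.+ S ℕ.* M)

        box-count : ∀ q {{_ : NonZero q}} → suc (q ℕ.* S ℕ.* M ℕ.+ q ℕ.* S ℕ.* M) ^ d ℕ.≤ E ^ d ℕ.* q ^ d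
        box-count q = ℕ.≤-trans (ℕ.^-monoˡ-≤ d side) (ℕ.≤-reflexive (^-distribʳ-* E q d))
          where
          open ℕ.≤-Reasoning
          side : suc (q ℕ.* S ℕ.* M ℕ.+ q ℕ.* S ℕ.* M) ℕ.≤ E ℕ.* q
          side = begin
            suc (q ℕ.* S ℕ.* M ℕ.+ q ℕ.* S ℕ.* M)       ≡⟨ cong (λ z → suc (z ℕ.+ z)) (ℕ.*-assoc q S M) ⟩
            suc (q ℕ.* (S ℕ.* M) ℕ.+ q ℕ.* (S ℕ.* M))   ≤⟨ ℕ.+-monoˡ-≤ _ (ℕ.>-nonZero⁻¹ q) ⟩
            q ℕ.+ (q ℕ.* (S ℕ.* M) ℕ.+ q ℕ.* (S ℕ.* M)) ≡⟨ cong (q ℕ.+_) (≡.sym (ℕ.*-distribˡ-+ q (S ℕ.* M) (S ℕ.* M))) ⟩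
            q ℕ.+ q ℕ.* (S ℕ.* M ℕ.+ S ℕ.* M)           ≡⟨ cong (q ℕ.+_) (ℕ.*-comm q (S ℕ.* M ℕ.+ S ℕ.* M)) ⟩
            E ℕ.* q                                     ∎

        -- The sum dominates both constants, so that it can be pulled out of the minimum.
        K : ℕ
        K = J ^ m ℕ.+ E ^ d

        length-bound : ∀ q {{_ : NonZero q}} l n {N} → exp l ≈ fromℕ q → ρ F ^ᴿ m ≤ fromℕ q * ρ F ^ᴿ n →
          N ℕ.≤ J ^ n → N ℕ.≤ suc (q ℕ.* S ℕ.* M ℕ.+ q ℕ.* S ℕ.* M) ^ d →
          fromℕ N ≤ fromℕ K * (exp (D * l) ⊓ fromℕ (q ^ d))
        length-bound q l n {N} exp-l large N≤words N≤boxes = ≤-trans (⊓-glb below-words below-boxes) (fromℕ-*-⊓ K (exp (D * l)) (fromℕ (q ^ d)))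
          where
          below-words : fromℕ N ≤ fromℕ K * exp (D * l)
          below-words = ≤-trans (fromℕ-mono-≤ N≤words) (≤-trans (word-count m n q l exp-l large)
            (*-monoʳ-≤ (exp (D * l)) (0≤exp (D * l)) (fromℕ-mono-≤ (ℕ.m≤m+n (J ^ m) (E ^ d)))))
          below-boxes : fromℕ N ≤ fromℕ K * fromℕ (q ^ d)
          below-boxes = ≤-trans (fromℕ-mono-≤ (ℕ.≤-trans N≤boxes (ℕ.≤-trans (box-count q) (ℕ.*-monoˡ-≤ (q ^ d) (ℕ.m≤n+m (E ^ d) (J ^ m))))))
            (≈⇒≤ (fromℕ-* K (q ^ d)))

      short-address : ∃ λ (K : ℝ) → ∀ (p : Vector ℤ d) (q : ℕ) {{_ : NonZero q}} → ratio p q ∈ C →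
        ∀ logq → IsLog (fromℕ q) logq →
        Σ (UltimatelyPeriodicAddress F (ratio p q)) λ a →
          fromℕ (UltimatelyPeriodicAddress.totalLength a) ≤ K * (exp (D * logq) ⊓ fromℕ (q ^ d))
      short-address = fromℕ K , bounded-address
        where
        bounded-address : ∀ (p : Vector ℤ d) (q : ℕ) {{_ : NonZero q}} → ratio p q ∈ C →
          ∀ logq → IsLog (fromℕ q) logq →
          Σ (UltimatelyPeriodicAddress F (ratio p q)) λ a →
            fromℕ (UltimatelyPeriodicAddress.totalLength a) ≤ fromℕ K * (exp (D * logq) ⊓ fromℕ (q ^ d))
        bounded-address p q p/q∈C logq exp-logq = map₂
          (λ {a} (a≤words , a≤boxes) → length-bound q logq (proj₁ n) exp-logq (proj₂ (proj₂ n)) a≤words a≤boxes)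
          (shorter-address (ratio p q) p/q∈C q (ratio-hasDenominator p q) (proj₁ n)
            (subst (λ T → ρ F ^ᴿ proj₁ n * fromℕ T < 1ℝ) (≡.sym (ℕ.*-assoc q S (M ℕ.+ M))) (proj₁ (proj₂ n))))
          where
          n = word-length q

theorem4p3 : ∀ {d J : ℕ} (F : IFS d J) (C : Pred (ℝ^ d) 0ℓ) →
    Affine F → RationalPreserving F → IsAttractor F C →
    (∀ ξ → ξ ∈ C → UltimatelyPeriodicAddress F ξ → Rational ξ)
    ×
    (Unimodular F →
    (∀ ξ → ξ ∈ C → Rational ξ ⇔ UltimatelyPeriodicAddress F ξ)
    ×
    (∀ D → IsExponent F D →
    ∃ λ (K : ℝ) → ∀ (p : Vector ℤ d) (q : ℕ) {{_ : NonZero q}} → ratio p q ∈ C →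
    ∀ logq → IsLog (fromℕ q) logq →
    Σ (UltimatelyPeriodicAddress F (ratio p q)) λ a →
    fromℕ (UltimatelyPeriodicAddress.totalLength a) ≤ K * (exp (D * logq) ⊓ fromℕ (q ^ d))))
theorem4p3 F C affine preserving attractor =
  (λ ξ _ → periodic⇒rational ξ) , λ unimodular →
    (λ ξ ξ∈C → mk⇔ (rational⇒ultimatelyPeriodic F attractor unimodular ξ ξ∈C) (periodic⇒rational ξ)) ,
    short-address F attractor unimodular
  where
  periodic⇒rational = ultimatelyPeriodic⇒rational F affine preserving
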